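{- Let $N$ be a positive integer, let $a\in\{1,2,\ldots,N\}$, and let $r$ be a variable. For formal variables $u,w$, we have $$1+\sum_{k\geq 2n,\ n\geq 1}X_0^r(k,n,n)\,u^{k-2n}w^{2n}=\exp\left\{\sum_{n=2}^\infty\frac{t_{N,a}(n)}{n}\left(\alpha_1^n+\alpha_2^n-\gamma_1^n-\gamma_2^n\right)\right\},$$ where $\alpha_1,\alpha_2$ are determined by $\alpha_1+\alpha_2=u$, $\alpha_1\alpha_2=-rw^2$, and $\gamma_1,\gamma_2$ are determined by $\gamma_1+\gamma_2=u$, $\gamma_1\gamma_2=(1-r)w^2$.
   Context: An index is a finite sequence $\mathbf{k}=(k_1,\ldots,k_n)$ of positive integers. Its weight is $k_1+\cdots+k_n$, its depth is $\operatorname{dep}(\mathbf{k})=n$, and its height is the number of $i$ with $k_i\geq 2$. It is admissible if $k_1>1$. For an admissible index define the multiple $t$-value of level $N$ $$t_{N,a}(\mathbf{k})=\sum_{\substack{m_1>\cdots>m_n>0\\ m_i\equiv a \ (\mathrm{mod}\ N)}}\frac{1}{m_1^{k_1}\cdots m_n^{k_n}}$$ (so $t_{N,a}(n)=\sum_{m>0,\ m\equiv a\,(\mathrm{mod}\ N)}m^{ -n}$ in depth one) and the interpolated multiple $t$-value of level $N$ $$t_{N,a}^r(\mathbf{k})=\sum_{\mathbf{p}}r^{\,n-\operatorname{dep}(\mathbf{p})}\,t_{N,a}(\mathbf{p}),$$ where $\mathbf{p}$ runs over all $2^{n-1}$ indices obtained from $(k_1\,\Box\, k_2\,\Box\cdots\Box\,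 k_n)$ by replacing each $\Box$ with either a comma or a plus sign (each choice of replacements counted once). $I_0(k,n,s)$ is the set of all admissible indices of weight $k$, depth $n$ and height $s$, and $X_0^r(k,n,s)=\sum_{\mathbf{k}\in I_0(k,n,s)}t_{N,a}^r(\mathbf{k})$. The identity is one of formal power series in $u,w$; the power sums $\alpha_1^n+\alpha_2^n$ and $\gamma_1^n+\gamma_2^n$ are polynomials in $u,w$ (and $r$) since they are symmetric. -}

module Defs where

open import Algebra.Bundles using (CommutativeRing)
import Algebra.Consequences.Setoid as Consequences
import Algebra.Properties.CommutativeSemigroup as CommutativeSemigroupProperties
import Algebra.Properties.Ring as RingProperties
import Algebra.Properties.Semiring.Exp as Exp
import Algebra.Properties.Semiring.Sum as Sum
import Algebra.Solver.Ring.NaturalCoefficients.Default as SemiringSolver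
open import Data.Bool.Base using (true; false; if_then_else_)
open import Data.Empty using (⊥)
open import Data.Fin.Base as Fin using (toℕ)
import Data.Fin.Properties as Finₚ
open import Data.Integer.Base as ℤ using (+_)
import Data.Integer.Properties as ℤₚ
open import Data.List.Base using (List; []; _∷_; _++_; map; foldr; filter; length; cartesianProductWith; applyUpTo)
open import Data.List.Relation.Unary.All as All using (All; []; _∷_)
import Data.List.Relation.Unary.All.Properties as Allₚ
open import Data.Nat.Base as ℕ using (ℕ; zero; suc; NonZero; _∸_; _!; ⌊_/2⌋)
open import Data.Nat.DivMod using (_%_)
import Data.Nat.ListAction as ListAction
import Data.Nat.Properties as ℕₚ
open import Data.Product using (_×_; _,_; proj₁; proj₂; ∃)
open import Data.Rational.Base as Rat using (ℚ; 0ℚ; 1ℚ; ½; _/_)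
import Data.Rational.Properties as ℚₚ
open import Data.Rational.Solver using (module +-*-Solver)
import Data.Rational.Unnormalised.Base as ℚᵘ
import Data.Rational.Unnormalised.Properties as ℚᵘₚ
open import Data.Sum.Base using (inj₁; inj₂)
import Data.Vec.Functional as Vector
open import Function.Base using (_∘_)
open import Level using (_⊔_; 0ℓ)
open import Relation.Binary.Bundles using (Setoid)
open import Relation.Binary.Core using (Rel)
open import Relation.Binary.PropositionalEquality as ≡ using (_≡_)
import Relation.Binary.Reasoning.Setoid as SetoidReasoning
open import Relation.Binary.Structures using (IsEquivalence)
open import Relation.Nullary.Decidable using (Dec; does; yes; no; _×-dec_)


record RingLaws {c ℓ} {A : Set c} (_≈_ : Rel A ℓ) (_+_ _*_ : A → A → A)
                (-_ : A → A) (0# 1# : A) : Set (c ⊔ ℓ) where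
  field
    isEquivalence : IsEquivalence _≈_
    +-cong   : ∀ {x y u v} → x ≈ y → u ≈ v → (x + u) ≈ (y + v)
    *-cong   : ∀ {x y u v} → x ≈ y → u ≈ v → (x * u) ≈ (y * v)
    -‿cong   : ∀ {x y} → x ≈ y → (- x) ≈ (- y)
    +-assoc  : ∀ x y z → ((x + y) + z) ≈ (x + (y + z))
    +-comm   : ∀ x y → (x + y) ≈ (y + x)
    +-idˡ    : ∀ x → (0# + x) ≈ x
    -‿invˡ   : ∀ x → ((- x) + x) ≈ 0#
    *-assoc  : ∀ x y z → ((x * y) * z) ≈ (x * (y * z))
    *-comm   : ∀ x y → (x * y) ≈ (y * x)
    *-idˡ    : ∀ x → (1# * x) ≈ x
    distribˡ : ∀ x y z → (x * (y + z)) ≈ ((x * y) + (x * z))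

  commutativeRing : CommutativeRing c ℓ
  commutativeRing = record
    { Carrier = A ; _≈_ = _≈_ ; _+_ = _+_ ; _*_ = _*_ ; -_ = -_ ; 0# = 0# ; 1# = 1#
    ; isCommutativeRing = record
      { isRing = record
        { +-isAbelianGroup = record
          { isGroup = record
            { isMonoid = record
              { isSemigroup = record
                { isMagma = record { isEquivalence = isEquivalence ; ∙-cong = +-cong }
                ; assoc = +-assoc }
              ; identity = comm∧idˡ⇒id +-comm +-idˡ }
            ; inverse = comm∧invˡ⇒inv +-comm -‿invˡ
            ; ⁻¹-cong = -‿cong }
          ; comm = +-comm }
        ; *-cong = *-cong
        ; *-assoc = *-assoc
        ; *-identity = comm∧idˡ⇒id *-comm *-idˡ
        ; distrib = comm∧distrˡ⇒distr +-cong *-comm distribˡ }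
      ; *-comm = *-comm } }
    where
    setoid : Setoid c ℓ
    setoid = record { isEquivalence = isEquivalence }
    open Consequences setoid

open Exp (CommutativeRing.semiring ℚₚ.+-*-commutativeRing) public using () renaming (_^_ to _^ℚ_)
open Sum (CommutativeRing.semiring ℚₚ.+-*-commutativeRing) public using () renaming (sum to sumℚ)

module RationalFacts where
  open ≡ using (refl; sym; trans; cong; cong₂; subst)
  open Rat
  open ℚₚ
  open +-*-Solver

  half : ∀ ε → ½ * ε + ½ * ε ≡ ε
  half ε = trans (sym (*-distribʳ-+ ε ½ ½)) (*-identityˡ ε)

  pos* : ∀ {p q} → 0ℚ < p → 0ℚ < q → 0ℚ < p * q
  pos* {p} {q} 0<p 0<q =
    positive⁻¹ (p * q) {{pos*pos⇒pos p {{positive 0<p}} q {{positive 0<q}}}}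

  half-pos : ∀ {ε} → 0ℚ < ε → 0ℚ < ½ * ε
  half-pos = pos* (positive⁻¹ ½)

  nonNeg* : ∀ {p q} → 0ℚ ≤ p → 0ℚ ≤ q → 0ℚ ≤ p * q
  nonNeg* {p} {q} 0≤p 0≤q =
    nonNegative⁻¹ (p * q) {{nonNeg*nonNeg⇒nonNeg p {{nonNegative 0≤p}} q {{nonNegative 0≤q}}}}

  *-mono-≤ : ∀ {p q r s} → 0ℚ ≤ q → 0ℚ ≤ r → p ≤ q → r ≤ s → p * r ≤ q * s
  *-mono-≤ {p} {q} {r} {s} 0≤q 0≤r p≤q r≤s = ≤-trans
    (*-monoʳ-≤-nonNeg r {{nonNegative 0≤r}} p≤q) (*-monoˡ-≤-nonNeg q {{nonNegative 0≤q}} r≤s)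

  divide : ∀ {B ε} → 0ℚ < B → 0ℚ < ε → ∃ λ δ → 0ℚ < δ × B * δ ≡ ε
  divide {B} {ε} 0<B 0<ε = 1/B * ε , pos* (positive⁻¹ 1/B {{1/pos⇒pos B}}) 0<ε ,
    trans (sym (*-assoc B 1/B ε)) (trans (cong (_* ε) (*-inverseʳ B)) (*-identityˡ ε))
    where
    instance
      _ = positive 0<B
      _ = pos⇒nonZero B
    1/B : ℚ
    1/B = 1/ B

  ι : ℕ → ℚ
  ι n = + n / 1

  private
    toℚᵘ-/ : ∀ i n → toℚᵘ (i / suc n) ℚᵘ.≃ ℚᵘ.mkℚᵘ i n
    toℚᵘ-/ i n = toℚᵘ-fromℚᵘ (ℚᵘ.mkℚᵘ i n)

  ι-suc : ∀ n → ι (suc n) ≡ 1ℚ + ι n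
  ι-suc n = toℚᵘ-injective (ℚᵘₚ.≃-trans (toℚᵘ-/ (+ suc n) 0) (ℚᵘₚ.≃-sym
    (ℚᵘₚ.≃-trans (toℚᵘ-homo-+ 1ℚ (ι n))
    (ℚᵘₚ.≃-trans (ℚᵘₚ.+-congʳ (toℚᵘ 1ℚ) (toℚᵘ-/ (+ n) 0))
    (ℚᵘ.*≡* (cong (ℤ._* (+ 1)) (cong (λ x → + 1 ℤ.+ x) (ℤₚ.*-identityʳ (+ n)))))))))

  recip-* : ∀ n → + 1 / suc n * ι (suc n) ≡ 1ℚ
  recip-* n = toℚᵘ-injective
    (ℚᵘₚ.≃-trans (toℚᵘ-homo-* (+ 1 / suc n) (ι (suc n)))
    (ℚᵘₚ.≃-trans (ℚᵘₚ.*-cong (toℚᵘ-/ (+ 1) n) (toℚᵘ-/ (+ suc n) 0))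
    (ℚᵘ.*≡* (trans (ℤₚ.*-identityʳ _) (trans (ℤₚ.*-identityˡ (+ suc n))
      (sym (trans (ℤₚ.*-identityˡ _) (cong +_ (ℕₚ.*-identityʳ (suc n))))))))))

  recip-pos : ∀ n → 0ℚ < + 1 / suc n
  recip-pos n = positive⁻¹ (+ 1 / suc n) {{normalize-pos 1 (suc n)}}

  ι-nonNeg : ∀ n → 0ℚ ≤ ι n
  ι-nonNeg n = nonNegative⁻¹ (ι n) {{normalize-nonNeg n 1}}

  ι-mono : ∀ {m n} → m ℕ.≤ n → ι m ≤ ι n
  ι-mono {n = n} ℕ.z≤n = ι-nonNeg n
  ι-mono (ℕ.s≤s {m} {n} m≤n) rewrite ι-suc m | ι-suc n = +-monoʳ-≤ 1ℚ (ι-mono m≤n)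

  archimedes : ∀ p → ∃ λ n → p ≤ ι n
  archimedes p@record{} = ℤ.∣ ↥ p ∣ , toℚᵘ-cancel-≤ (ℚᵘₚ.≤-respʳ-≃ (ℚᵘₚ.≃-sym (toℚᵘ-/ (+ ℤ.∣ ↥ p ∣) 0)) (lemma (↥ p) (ℚ.denominator-1 p)))
    where
    lemma : ∀ i d → ℚᵘ.mkℚᵘ i d ℚᵘ.≤ ℚᵘ.mkℚᵘ (+ ℤ.∣ i ∣) 0
    lemma (+ n) d = ℚᵘ.*≤* (ℤₚ.*-monoˡ-≤-nonNeg (+ n) (ℤ.+≤+ (ℕ.s≤s ℕ.z≤n)))
    lemma (ℤ.-[1+ n ]) d = ℚᵘ.*≤* (ℤₚ.≤-trans ℤ.-≤+ (ℤ.+≤+ ℕ.z≤n))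

  recip-diff : ∀ n → + 1 / suc n - + 1 / suc (suc n) ≡ (+ 1 / suc n) * (+ 1 / suc (suc n))
  recip-diff n = begin
    x - y                        ≡⟨ solve 2 (λ a b → a :- b := con 1ℚ :* a :- con 1ℚ :* b) refl x y ⟩
    1ℚ * x - 1ℚ * y              ≡⟨ cong₂ (λ a b → a * x - b * y) (sym (recip-* (suc n))) (sym (recip-* n)) ⟩
    y * ι (suc (suc n)) * x - x * k * y ≡⟨ cong (λ a → y * a * x - x * k * y) (ι-suc (suc n)) ⟩
    y * (1ℚ + k) * x - x * k * y ≡⟨ solve 3 (λ a b c → b :* (con 1ℚ :+ c) :* a :- a :* c :* b := a :* b) refl x y k ⟩
    x * y                        ∎
    where
    open ≡.≡-Reasoning
    x y k : ℚ
    x = + 1 / suc n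
    y = + 1 / suc (suc n)
    k = ι (suc n)

  recip-anti : ∀ n → + 1 / suc (suc n) ≤ + 1 / suc n
  recip-anti n = begin
    y           ≡⟨ +-identityʳ y ⟨
    y + 0ℚ      ≤⟨ +-monoʳ-≤ y (nonNeg* (<⇒≤ (recip-pos n)) (<⇒≤ (recip-pos (suc n)))) ⟩
    y + x * y   ≡⟨ cong (λ q → y + q) (recip-diff n) ⟨
    y + (x - y) ≡⟨ solve 2 (λ a b → b :+ (a :- b) := a) refl x y ⟩
    x           ∎
    where
    open ≤-Reasoning
    x y : ℚ
    x = + 1 / suc n
    y = + 1 / suc (suc n)

  recip≤1 : ∀ n → + 1 / suc n ≤ 1ℚ
  recip≤1 zero = ≤-refl
  recip≤1 (suc n) = ≤-trans (recip-anti n) (recip≤1 n)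

  -- 1/(n+1)² ≤ 2/((n+1)(n+2))
  recip²≤ : ∀ n → (+ 1 / suc n) * (+ 1 / suc n) ≤ (1ℚ + 1ℚ) * ((+ 1 / suc n) * (+ 1 / suc (suc n)))
  recip²≤ n = begin
    x * x               ≤⟨ *-monoˡ-≤-nonNeg x {{nonNegative (<⇒≤ (recip-pos n))}} x≤2y ⟩
    x * ((1ℚ + 1ℚ) * y) ≡⟨ solve 3 (λ a b c → a :* (c :* b) := c :* (a :* b)) refl x y (1ℚ + 1ℚ) ⟩
    (1ℚ + 1ℚ) * (x * y) ∎
    where
    open ≤-Reasoning
    x y : ℚ
    x = + 1 / suc n
    y = + 1 / suc (suc n)
    x≤2y : x ≤ (1ℚ + 1ℚ) * y
    x≤2y = begin
      x                ≡⟨ solve 2 (λ a b → a := b :+ (a :- b)) refl x y ⟩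
      y + (x - y)      ≡⟨ cong (λ q → y + q) (recip-diff n) ⟩
      y + x * y        ≤⟨ +-monoʳ-≤ y (*-monoʳ-≤-nonNeg y {{nonNegative (<⇒≤ (recip-pos (suc n)))}} (recip≤1 n)) ⟩
      y + 1ℚ * y       ≡⟨ cong (_+ 1ℚ * y) (*-identityˡ y) ⟨
      1ℚ * y + 1ℚ * y  ≡⟨ *-distribʳ-+ y 1ℚ 1ℚ ⟨
      (1ℚ + 1ℚ) * y    ∎

  pow-nonNeg : ∀ {p} → 0ℚ ≤ p → ∀ k → 0ℚ ≤ p ^ℚ k
  pow-nonNeg 0≤p zero    = nonNegative⁻¹ 1ℚ
  pow-nonNeg 0≤p (suc k) = nonNeg* 0≤p (pow-nonNeg 0≤p k)

  pow≤1 : ∀ {p} → 0ℚ ≤ p → p ≤ 1ℚ → ∀ k → p ^ℚ k ≤ 1ℚ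
  pow≤1 0≤p p≤1 zero    = ≤-refl
  pow≤1 {p} 0≤p p≤1 (suc k) = *-mono-≤ (nonNegative⁻¹ 1ℚ) (pow-nonNeg 0≤p k) p≤1 (pow≤1 0≤p p≤1 k)

  sum-last : ∀ (f : ℕ → ℚ) n → sumℚ {suc n} (f ∘ toℕ) ≡ sumℚ {n} (f ∘ toℕ) + f n
  sum-last f zero    = trans (+-identityʳ (f 0)) (sym (+-identityˡ (f 0)))
  sum-last f (suc n) = trans (cong (_+_ (f 0)) (sum-last (f ∘ suc) n)) (sym (+-assoc (f 0) _ _))

open RationalFacts

IsCauchy : (ℕ → ℚ) → Set
IsCauchy x = ∀ ε → 0ℚ Rat.< ε →
  ∃ λ N → ∀ m n → N ℕ.≤ m → N ℕ.≤ n → Rat.∣ x m Rat.- x n ∣ Rat.< ε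

record ℝ : Set where
  constructor real
  field
    seq      : ℕ → ℚ
    isCauchy : IsCauchy seq
open ℝ public

infix 4 _≈ᵣ_
record _≈ᵣ_ (x y : ℝ) : Set where
  constructor mk≈
  field
    null : ∀ ε → 0ℚ Rat.< ε → ∃ λ N → ∀ n → N ℕ.≤ n → Rat.∣ seq x n Rat.- seq y n ∣ Rat.< ε
open _≈ᵣ_ public

module Real where
  open ≡ using (refl; sym; trans; cong; subst)
  open Rat using (_+_; _*_; -_; _-_; ∣_∣; _<_; _≤_)
  open ℚₚ
  open +-*-Solver using (solve; _:+_; _:*_; _:-_; :-_; _:=_; con)

  -- `D N i` says that the index `i` (a natural number or a pair of them) is
  -- beyond `N`.
  module Vanishing {I : Set} (D : ℕ → I → Set)
                   (D-mono : ∀ {M N i} → M ℕ.≤ N → D N i → D M i) where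

    record Vanishes (z : I → ℚ) : Set where
      constructor vanishes
      field eventually : ∀ ε → 0ℚ < ε → ∃ λ N → ∀ i → D N i → ∣ z i ∣ < ε
    open Vanishes public

    record Bounded (z : I → ℚ) : Set where
      constructor bound
      field
        {B}   : ℚ
        0<B   : 0ℚ < B
        {N}   : ℕ
        ∣z∣≤B : ∀ i → D N i → ∣ z i ∣ ≤ B

    resp : ∀ {z z′} → Vanishes z → (∀ i → z i ≡ z′ i) → Vanishes z′
    resp (vanishes z→0) z≡z′ = vanishes λ ε 0<ε → let N , h = z→0 ε 0<ε in
      N , λ i d → subst (λ q → ∣ q ∣ < ε) (z≡z′ i) (h i d)

    neg : ∀ {z} → Vanishes z → Vanishes (λ i → - z i)
    neg {z} (vanishes z→0) = vanishes λ ε 0<ε → let N , h = z→0 ε 0<ε in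
      N , λ i d → subst (_< ε) (sym (∣-p∣≡∣p∣ (z i))) (h i d)

    add : ∀ {z z′} → Vanishes z → Vanishes z′ → Vanishes (λ i → z i + z′ i)
    add {z} {z′} (vanishes z→0) (vanishes z′→0) = vanishes λ ε 0<ε →
      let N  , h  = z→0  (½ * ε) (half-pos 0<ε)
          N′ , h′ = z′→0 (½ * ε) (half-pos 0<ε)
      in N ℕ.⊔ N′ , λ i d → ≤-<-trans (∣p+q∣≤∣p∣+∣q∣ (z i) (z′ i))
           (subst (∣ z i ∣ + ∣ z′ i ∣ <_) (half ε)
             (+-mono-< (h i (D-mono (ℕₚ.m≤m⊔n N N′) d)) (h′ i (D-mono (ℕₚ.m≤n⊔m N N′) d))))

    mul : ∀ {b z} → Bounded b → Vanishes z → Vanishes (λ i → b i * z i)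
    mul {b} {z} (bound {B} 0<B {N} h) (vanishes z→0) = vanishes λ ε 0<ε →
      let δ , 0<δ , Bδ≡ε = divide 0<B 0<ε
          N′ , h′ = z→0 δ 0<δ
      in N ℕ.⊔ N′ , λ i d → begin-strict
        ∣ b i * z i ∣     ≡⟨ ∣p*q∣≡∣p∣*∣q∣ (b i) (z i) ⟩
        ∣ b i ∣ * ∣ z i ∣ ≤⟨ *-monoʳ-≤-nonNeg ∣ z i ∣ {{∣-∣-nonNeg (z i)}} (h i (D-mono (ℕₚ.m≤m⊔n N N′) d)) ⟩
        B * ∣ z i ∣       <⟨ *-monoʳ-<-pos B {{Rat.positive 0<B}} (h′ i (D-mono (ℕₚ.m≤n⊔m N N′) d)) ⟩
        B * δ             ≡⟨ Bδ≡ε ⟩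
        ε                 ∎
      where open ≤-Reasoning

  open Vanishing ℕ._≤_ ℕₚ.≤-trans
  module Pairs = Vanishing {I = ℕ × ℕ} (λ N i → N ℕ.≤ proj₁ i × N ℕ.≤ proj₂ i)
    (λ M≤N d → ℕₚ.≤-trans M≤N (proj₁ d) , ℕₚ.≤-trans M≤N (proj₂ d))

  pairs : ∀ x → IsCauchy x → Pairs.Vanishes (λ i → x (proj₁ i) - x (proj₂ i))
  pairs x cx = Pairs.vanishes λ ε 0<ε → let N , h = cx ε 0<ε in
    N , λ i d → h (proj₁ i) (proj₂ i) (proj₁ d) (proj₂ d)

  cauchy : ∀ x → Pairs.Vanishes (λ i → x (proj₁ i) - x (proj₂ i)) → IsCauchy x
  cauchy x (Pairs.vanishes vx) ε 0<ε = let N , h = vx ε 0<ε in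
    N , λ m n N≤m N≤n → h (m , n) (N≤m , N≤n)

  bounded : ∀ x → IsCauchy x → Bounded x
  bounded x cx =
    let N , h = cx 1ℚ (positive⁻¹ 1ℚ)
    in bound (+-mono-≤-< (0≤∣p∣ (x N)) (positive⁻¹ 1ℚ)) {N} λ n N≤n → begin
      ∣ x n ∣                 ≡⟨ cong ∣_∣ (solve 2 (λ a b → a := b :+ (a :- b)) refl (x n) (x N)) ⟩
      ∣ x N + (x n - x N) ∣   ≤⟨ ∣p+q∣≤∣p∣+∣q∣ (x N) (x n - x N) ⟩
      ∣ x N ∣ + ∣ x n - x N ∣ ≤⟨ +-monoʳ-≤ ∣ x N ∣ (<⇒≤ (h n N N≤n ℕₚ.≤-refl)) ⟩
      ∣ x N ∣ + 1ℚ            ∎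
    where open ≤-Reasoning

  bounded₁ : ∀ x → IsCauchy x → Pairs.Bounded (λ i → x (proj₁ i))
  bounded₁ x cx = let bound 0<B h = bounded x cx in Pairs.bound 0<B λ i d → h (proj₁ i) (proj₁ d)

  bounded₂ : ∀ x → IsCauchy x → Pairs.Bounded (λ i → x (proj₂ i))
  bounded₂ x cx = let bound 0<B h = bounded x cx in Pairs.bound 0<B λ i d → h (proj₂ i) (proj₂ d)

  pointwise : ∀ {x y} → (∀ n → seq x n ≡ seq y n) → x ≈ᵣ y
  pointwise {x} {y} x≡y = mk≈ λ ε 0<ε → 0 , λ n _ →
    subst (λ q → ∣ q ∣ < ε) (sym (trans (cong (λ q → q - seq y n) (x≡y n)) (+-inverseʳ (seq y n)))) 0<ε

  fromℚ : ℚ → ℝ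
  fromℚ q = real (λ _ → q) λ ε 0<ε → 0 , λ _ _ _ _ →
    subst (λ p → ∣ p ∣ < ε) (sym (+-inverseʳ q)) 0<ε

  infixl 6 _+ᵣ_
  infixl 7 _*ᵣ_
  infix 8 -ᵣ_

  private
    +-identity₄ : ∀ a b c d → (a - b) + (c - d) ≡ (a + c) - (b + d)
    +-identity₄ = solve 4 (λ a b c d → (a :- b) :+ (c :- d) := (a :+ c) :- (b :+ d)) refl

    *-identity₄ : ∀ a b c d → a * (c - d) + d * (a - b) ≡ a * c - b * d
    *-identity₄ = solve 4 (λ a b c d → a :* (c :- d) :+ d :* (a :- b) := a :* c :- b :* d) refl

    neg-identity : ∀ a b → - (a - b) ≡ (- a) - (- b)
    neg-identity = solve 2 (λ a b → :- (a :- b) := (:- a) :- (:- b)) refl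

  _+ᵣ_ : ℝ → ℝ → ℝ
  real x cx +ᵣ real y cy = real (λ n → x n + y n) (cauchy (λ n → x n + y n) (Pairs.resp
    (Pairs.add (pairs x cx) (pairs y cy)) λ i → +-identity₄ (x (proj₁ i)) (x (proj₂ i)) (y (proj₁ i)) (y (proj₂ i))))

  _*ᵣ_ : ℝ → ℝ → ℝ
  real x cx *ᵣ real y cy = real (λ n → x n * y n) (cauchy (λ n → x n * y n) (Pairs.resp
    (Pairs.add (Pairs.mul (bounded₁ x cx) (pairs y cy)) (Pairs.mul (bounded₂ y cy) (pairs x cx)))
    λ i → *-identity₄ (x (proj₁ i)) (x (proj₂ i)) (y (proj₁ i)) (y (proj₂ i))))

  -ᵣ_ : ℝ → ℝ
  -ᵣ real x cx = real (λ n → - x n) (cauchy (λ n → - x n) (Pairs.resp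
    (Pairs.neg (pairs x cx)) λ i → neg-identity (x (proj₁ i)) (x (proj₂ i))))

  laws : RingLaws _≈ᵣ_ _+ᵣ_ _*ᵣ_ -ᵣ_ (fromℚ 0ℚ) (fromℚ 1ℚ)
  laws = record
    { isEquivalence = record
      { refl  = pointwise λ _ → refl
      ; sym   = λ {x} {y} (mk≈ p) → mk≈ (eventually (resp (neg (vanishes p))
          λ n → solve 2 (λ a b → :- (a :- b) := b :- a) refl (seq x n) (seq y n)))
      ; trans = λ {x} {y} {z} (mk≈ p) (mk≈ q) → mk≈ (eventually (resp (add (vanishes p) (vanishes q))
          λ n → solve 3 (λ a b c → (a :- b) :+ (b :- c) := a :- c) refl (seq x n) (seq y n) (seq z n))) }
    ; +-cong = λ {x} {y} {u} {v} (mk≈ p) (mk≈ q) → mk≈ (eventually (resp (add (vanishes p) (vanishes q))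
          λ n → +-identity₄ (seq x n) (seq y n) (seq u n) (seq v n)))
    ; *-cong = λ {x} {y} {u} {v} (mk≈ p) (mk≈ q) → mk≈ (eventually (resp
          (add (mul (bounded (seq x) (isCauchy x)) (vanishes q)) (mul (bounded (seq v) (isCauchy v)) (vanishes p)))
          λ n → *-identity₄ (seq x n) (seq y n) (seq u n) (seq v n)))
    ; -‿cong = λ {x} {y} (mk≈ p) → mk≈ (eventually (resp (neg (vanishes p)) λ n → neg-identity (seq x n) (seq y n)))
    ; +-assoc  = λ x y z → pointwise λ n → +-assoc (seq x n) (seq y n) (seq z n)
    ; +-comm   = λ x y → pointwise λ n → +-comm (seq x n) (seq y n)
    ; +-idˡ    = λ x → pointwise λ n → +-identityˡ (seq x n)
    ; -‿invˡ   = λ x → pointwise λ n → +-inverseˡ (seq x n)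
    ; *-assoc  = λ x y z → pointwise λ n → *-assoc (seq x n) (seq y n) (seq z n)
    ; *-comm   = λ x y → pointwise λ n → *-comm (seq x n) (seq y n)
    ; *-idˡ    = λ x → pointwise λ n → *-identityˡ (seq x n)
    ; distribˡ = λ x y z → pointwise λ n → *-distribˡ-+ (seq x n) (seq y n) (seq z n)
    }

open Real public using (fromℚ)

ℝ-ring : CommutativeRing 0ℓ 0ℓ
ℝ-ring = RingLaws.commutativeRing Real.laws

module PowerSeries {c ℓ} (R : CommutativeRing c ℓ) where
  open CommutativeRing R
  open Sum semiring
  open SemiringSolver commutativeSemiring
  open SetoidReasoning setoid

  Series : Set c
  Series = ℕ → Carrier

  infix 4 _≋_
  _≋_ : Series → Series → Set ℓ
  f ≋ g = ∀ n → f n ≈ g n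

  const : Carrier → Series
  const a zero    = a
  const a (suc _) = 0#

  X : Series
  X zero          = 0#
  X (suc zero)    = 1#
  X (suc (suc _)) = 0#

  infixl 6 _⊕_
  infixl 7 _⊛_
  infix  8 ⊝_

  _⊕_ _⊛_ : Series → Series → Series
  (f ⊕ g) n = f n + g n
  (f ⊛ g) n = ∑[ i ≤ n ] (f (toℕ i) * g (n ∸ toℕ i))

  ⊝_ : Series → Series
  (⊝ f) n = - f n

  sum-zero : ∀ {n} (t : Vector.Vector Carrier n) → (∀ i → t i ≈ 0#) → sum t ≈ 0#
  sum-zero {zero}  t t≈0 = refl
  sum-zero {suc n} t t≈0 = trans (+-cong (t≈0 Fin.zero) (sum-zero (t ∘ Fin.suc) (t≈0 ∘ Fin.suc))) (+-identityˡ 0#)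

  ⊛-cong : ∀ {f f′ g g′} → f ≋ f′ → g ≋ g′ → f ⊛ g ≋ f′ ⊛ g′
  ⊛-cong f≋f′ g≋g′ n = sum-cong-≋ {suc n} λ i → *-cong (f≋f′ (toℕ i)) (g≋g′ (n ∸ toℕ i))

  ⊛-distribˡ : ∀ f g h → f ⊛ (g ⊕ h) ≋ f ⊛ g ⊕ f ⊛ h
  ⊛-distribˡ f g h n = trans
    (sum-cong-≋ {suc n} λ i → distribˡ (f (toℕ i)) (g (n ∸ toℕ i)) (h (n ∸ toℕ i)))
    (∑-distrib-+ {suc n} (λ i → f (toℕ i) * g (n ∸ toℕ i)) (λ i → f (toℕ i) * h (n ∸ toℕ i)))

  ⊛-distribʳ : ∀ f g h → (f ⊕ g) ⊛ h ≋ f ⊛ h ⊕ g ⊛ h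
  ⊛-distribʳ f g h n = trans
    (sum-cong-≋ {suc n} λ i → distribʳ (h (n ∸ toℕ i)) (f (toℕ i)) (g (toℕ i)))
    (∑-distrib-+ {suc n} (λ i → f (toℕ i) * h (n ∸ toℕ i)) (λ i → g (toℕ i) * h (n ∸ toℕ i)))

  ⊛-scale : ∀ a f g n → ((λ m → a * f m) ⊛ g) n ≈ a * (f ⊛ g) n
  ⊛-scale a f g n = trans
    (sum-cong-≋ {suc n} λ i → *-assoc a (f (toℕ i)) (g (n ∸ toℕ i)))
    (sym (*-distribˡ-sum {suc n} a (λ i → f (toℕ i) * g (n ∸ toℕ i))))

  ⊛-lastʳ : ∀ f g n → (f ⊛ g) (suc n) ≈ (f ⊛ (g ∘ suc)) n + f (suc n) * g 0
  ⊛-lastʳ f g zero    = solve 4 (λ f₀ f₁ g₀ g₁ → f₀ :* g₁ :+ (f₁ :* g₀ :+ con 0) := f₀ :* g₁ :+ con 0 :+ f₁ :* g₀)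
    refl (f 0) (f 1) (g 0) (g 1)
  ⊛-lastʳ f g (suc n) = trans (+-congˡ (⊛-lastʳ (f ∘ suc) g n)) (sym (+-assoc _ _ _))

  ⊛-comm : ∀ f g → f ⊛ g ≋ g ⊛ f
  ⊛-comm f g zero    = +-congʳ (*-comm (f 0) (g 0))
  ⊛-comm f g (suc n) = begin
    f 0 * g (suc n) + ((f ∘ suc) ⊛ g) n ≈⟨ +-cong (*-comm _ _) (⊛-comm (f ∘ suc) g n) ⟩
    g (suc n) * f 0 + (g ⊛ (f ∘ suc)) n ≈⟨ +-comm _ _ ⟩
    (g ⊛ (f ∘ suc)) n + g (suc n) * f 0 ≈⟨ ⊛-lastʳ g f n ⟨
    (g ⊛ f) (suc n)                     ∎

  ⊛-assoc : ∀ f g h → (f ⊛ g) ⊛ h ≋ f ⊛ (g ⊛ h)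
  ⊛-assoc f g h zero    = solve 3 (λ a b c → (a :* b :+ con 0) :* c :+ con 0 := a :* (b :* c :+ con 0) :+ con 0)
    refl (f 0) (g 0) (h 0)
  ⊛-assoc f g h (suc n) = begin
    (f 0 * g 0 + 0#) * h (suc n) + (((λ m → f 0 * g (suc m)) ⊕ (f ∘ suc) ⊛ g) ⊛ h) n
      ≈⟨ +-congˡ (⊛-distribʳ (λ m → f 0 * g (suc m)) ((f ∘ suc) ⊛ g) h n) ⟩
    (f 0 * g 0 + 0#) * h (suc n) + (((λ m → f 0 * g (suc m)) ⊛ h) n + (((f ∘ suc) ⊛ g) ⊛ h) n)
      ≈⟨ +-congˡ (+-cong (⊛-scale (f 0) (g ∘ suc) h n) (⊛-assoc (f ∘ suc) g h n)) ⟩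
    (f 0 * g 0 + 0#) * h (suc n) + (f 0 * ((g ∘ suc) ⊛ h) n + ((f ∘ suc) ⊛ (g ⊛ h)) n)
      ≈⟨ solve 5 (λ a b c x y → (a :* b :+ con 0) :* c :+ (a :* x :+ y) := a :* (b :* c :+ x) :+ y)
           refl (f 0) (g 0) (h (suc n)) (((g ∘ suc) ⊛ h) n) (((f ∘ suc) ⊛ (g ⊛ h)) n) ⟩
    f 0 * (g 0 * h (suc n) + ((g ∘ suc) ⊛ h) n) + ((f ∘ suc) ⊛ (g ⊛ h)) n ∎

  ⊛-identityˡ : ∀ f → const 1# ⊛ f ≋ f
  ⊛-identityˡ f zero    = trans (+-identityʳ _) (*-identityˡ (f 0))
  ⊛-identityˡ f (suc n) = trans
    (+-cong (*-identityˡ _) (sum-zero {suc n} _ λ i → zeroˡ (f (n ∸ toℕ i)))) (+-identityʳ _)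

  laws : RingLaws _≋_ _⊕_ _⊛_ ⊝_ (λ _ → 0#) (const 1#)
  laws = record
    { isEquivalence = record
      { refl  = λ _ → refl
      ; sym   = λ p n → sym (p n)
      ; trans = λ p q n → trans (p n) (q n) }
    ; +-cong   = λ p q n → +-cong (p n) (q n)
    ; *-cong   = λ {f} {f′} {g} {g′} → ⊛-cong {f} {f′} {g} {g′}
    ; -‿cong   = λ p n → -‿cong (p n)
    ; +-assoc  = λ f g h n → +-assoc (f n) (g n) (h n)
    ; +-comm   = λ f g n → +-comm (f n) (g n)
    ; +-idˡ    = λ f n → +-identityˡ (f n)
    ; -‿invˡ   = λ f n → -‿inverseˡ (f n)
    ; *-assoc  = ⊛-assoc
    ; *-comm   = ⊛-comm
    ; *-idˡ    = ⊛-identityˡ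
    ; distribˡ = ⊛-distribˡ
    }

  seriesRing : CommutativeRing c ℓ
  seriesRing = RingLaws.commutativeRing laws

module Polynomials {c ℓ} (R : CommutativeRing c ℓ) where
  open CommutativeRing R
  open RingProperties ring using (-0#≈0#)
  open PowerSeries R using (_⊕_; _⊛_; ⊝_; sum-zero) renaming (const to constₛ; X to Xₛ)
  private module S = RingLaws (PowerSeries.laws R)

  record Polynomial : Set (c ⊔ ℓ) where
    field
      coeff     : ℕ → Carrier
      bound     : ℕ
      vanishing : ∀ n → bound ℕ.≤ n → coeff n ≈ 0#
  open Polynomial public

  infix 4 _≈ₚ_
  record _≈ₚ_ (p q : Polynomial) : Set ℓ where
    constructor mk≈ₚ
    field coeff-≈ : ∀ n → coeff p n ≈ coeff q n
  open _≈ₚ_ public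

  const : Carrier → Polynomial
  const a = record { coeff = constₛ a ; bound = 1 ; vanishing = λ { (suc _) _ → refl } }

  X : Polynomial
  X = record { coeff = Xₛ ; bound = 2
             ; vanishing = λ { (suc zero) (ℕ.s≤s ()) ; (suc (suc _)) _ → refl } }

  infixl 6 _+ₚ_
  infixl 7 _*ₚ_
  infix  8 -ₚ_

  _+ₚ_ : Polynomial → Polynomial → Polynomial
  p +ₚ q = record
    { coeff = coeff p ⊕ coeff q
    ; bound = bound p ℕ.⊔ bound q
    ; vanishing = λ n b≤n → trans
        (+-cong (vanishing p n (ℕₚ.≤-trans (ℕₚ.m≤m⊔n (bound p) (bound q)) b≤n))
                (vanishing q n (ℕₚ.≤-trans (ℕₚ.m≤n⊔m (bound p) (bound q)) b≤n)))
        (+-identityˡ 0#) }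

  _*ₚ_ : Polynomial → Polynomial → Polynomial
  p *ₚ q = record
    { coeff = coeff p ⊛ coeff q
    ; bound = bound p ℕ.+ bound q
    ; vanishing = λ n b≤n → sum-zero {suc n} _ λ i → term n b≤n (toℕ i) }
    where
    term : ∀ n → bound p ℕ.+ bound q ℕ.≤ n → ∀ i → coeff p i * coeff q (n ∸ i) ≈ 0#
    term n b≤n i with ℕₚ.≤-total (bound p) i
    ... | inj₁ b≤i = trans (*-congʳ (vanishing p i b≤i)) (zeroˡ _)
    ... | inj₂ i≤b = trans (*-congˡ (vanishing q (n ∸ i) (ℕₚ.m+n≤o⇒m≤o∸n (bound q)
      (ℕₚ.≤-trans (ℕₚ.≤-trans (ℕₚ.+-monoʳ-≤ (bound q) i≤b) (ℕₚ.≤-reflexive (ℕₚ.+-comm (bound q) (bound p)))) b≤n))))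
      (zeroʳ _)

  -ₚ_ : Polynomial → Polynomial
  -ₚ p = record
    { coeff = ⊝ coeff p
    ; bound = bound p
    ; vanishing = λ n b≤n → trans (-‿cong (vanishing p n b≤n)) -0#≈0# }

  laws : RingLaws _≈ₚ_ _+ₚ_ _*ₚ_ -ₚ_
    (record { coeff = λ _ → 0# ; bound = 0 ; vanishing = λ _ _ → refl }) (const 1#)
  laws = record
    { isEquivalence = record
      { refl  = mk≈ₚ λ _ → refl
      ; sym   = λ p → mk≈ₚ λ n → sym (coeff-≈ p n)
      ; trans = λ p q → mk≈ₚ λ n → trans (coeff-≈ p n) (coeff-≈ q n) }
    ; +-cong   = λ p q → mk≈ₚ λ n → +-cong (coeff-≈ p n) (coeff-≈ q n)
    ; *-cong   = λ {p} {p′} {q} {q′} p≈ q≈ →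
        mk≈ₚ (S.*-cong {coeff p} {coeff p′} {coeff q} {coeff q′} (coeff-≈ p≈) (coeff-≈ q≈))
    ; -‿cong   = λ p → mk≈ₚ λ n → -‿cong (coeff-≈ p n)
    ; +-assoc  = λ p q s → mk≈ₚ (S.+-assoc (coeff p) (coeff q) (coeff s))
    ; +-comm   = λ p q → mk≈ₚ (S.+-comm (coeff p) (coeff q))
    ; +-idˡ    = λ p → mk≈ₚ (S.+-idˡ (coeff p))
    ; -‿invˡ   = λ p → mk≈ₚ (S.-‿invˡ (coeff p))
    ; *-assoc  = λ p q s → mk≈ₚ (S.*-assoc (coeff p) (coeff q) (coeff s))
    ; *-comm   = λ p q → mk≈ₚ (S.*-comm (coeff p) (coeff q))
    ; *-idˡ    = λ p → mk≈ₚ (S.*-idˡ (coeff p))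
    ; distribˡ = λ p q s → mk≈ₚ (S.distribˡ (coeff p) (coeff q) (coeff s))
    }

  polynomialRing : CommutativeRing (c ⊔ ℓ) ℓ
  polynomialRing = RingLaws.commutativeRing laws

-- The universal splitting algebra of T² − e₁ T + e₂ over S, that is, S[α₁] with
-- α₁² = e₁ α₁ − e₂ and α₂ = e₁ − α₁; the pair (a , b) stands for a + b α₁.  Two
-- elements of any extension of S with sum e₁ and product e₂ are the images of
-- α₁ and α₂, so the power sums do not depend on where the roots are taken.
module Splitting {c ℓ} (S : CommutativeRing c ℓ) (e₁ e₂ : CommutativeRing.Carrier S) where
  open CommutativeRing S
  open RingProperties ring
  open SemiringSolver commutativeSemiring
  open SetoidReasoning setoid

  Elt : Set c
  Elt = Carrier × Carrier

  infix  4 _≈ₑ_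
  infixl 6 _+ₑ_
  infixl 7 _*ₑ_

  _≈ₑ_ : Elt → Elt → Set ℓ
  (a , b) ≈ₑ (a′ , b′) = a ≈ a′ × b ≈ b′

  _+ₑ_ _*ₑ_ : Elt → Elt → Elt
  (a , b) +ₑ (a′ , b′) = a + a′ , b + b′
  (a , b) *ₑ (a′ , b′) = a * a′ + - e₂ * (b * b′) , a * b′ + b * a′ + e₁ * (b * b′)

  -ₑ_ : Elt → Elt
  -ₑ (a , b) = - a , - b

  embed : Carrier → Elt
  embed a = a , 0#

  laws : RingLaws _≈ₑ_ _+ₑ_ _*ₑ_ -ₑ_ (embed 0#) (embed 1#)
  laws = record
    { isEquivalence = record
      { refl  = refl , refl
      ; sym   = λ (p , q) → sym p , sym q
      ; trans = λ (p , q) (p′ , q′) → trans p p′ , trans q q′ }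
    ; +-cong   = λ (p , q) (p′ , q′) → +-cong p p′ , +-cong q q′
    ; *-cong   = λ (p , q) (p′ , q′) →
        +-cong (*-cong p p′) (*-congˡ (*-cong q q′)) ,
        +-cong (+-cong (*-cong p q′) (*-cong q p′)) (*-congˡ (*-cong q q′))
    ; -‿cong   = λ (p , q) → -‿cong p , -‿cong q
    ; +-assoc  = λ (a , b) (c , d) (e , f) → +-assoc a c e , +-assoc b d f
    ; +-comm   = λ (a , b) (c , d) → +-comm a c , +-comm b d
    ; +-idˡ    = λ (a , b) → +-identityˡ a , +-identityˡ b
    ; -‿invˡ   = λ (a , b) → -‿inverseˡ a , -‿inverseˡ b
    ; *-assoc  = λ (a , b) (c , d) (e , f) →
        solve 8 (λ a b c d e f s q →
            (a :* c :+ q :* (b :* d)) :* e :+ q :* ((a :* d :+ b :* c :+ s :* (b :* d)) :* f)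
          := a :* (c :* e :+ q :* (d :* f)) :+ q :* (b :* (c :* f :+ d :* e :+ s :* (d :* f))))
          refl a b c d e f e₁ (- e₂) ,
        solve 8 (λ a b c d e f s q →
            (a :* c :+ q :* (b :* d)) :* f :+ (a :* d :+ b :* c :+ s :* (b :* d)) :* e
              :+ s :* ((a :* d :+ b :* c :+ s :* (b :* d)) :* f)
          := a :* (c :* f :+ d :* e :+ s :* (d :* f)) :+ b :* (c :* e :+ q :* (d :* f))
              :+ s :* (b :* (c :* f :+ d :* e :+ s :* (d :* f))))
          refl a b c d e f e₁ (- e₂)
    ; *-comm   = λ (a , b) (c , d) →
        solve 5 (λ a b c d q → a :* c :+ q :* (b :* d) := c :* a :+ q :* (d :* b)) refl a b c d (- e₂) ,
        solve 5 (λ a b c d s → a :* d :+ b :* c :+ s :* (b :* d) := c :* b :+ d :* a :+ s :* (d :* b)) refl a b c d e₁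
    ; *-idˡ    = λ (a , b) →
        solve 3 (λ a b q → con 1 :* a :+ q :* (con 0 :* b) := a) refl a b (- e₂) ,
        solve 3 (λ a b s → con 1 :* b :+ con 0 :* a :+ s :* (con 0 :* b) := b) refl a b e₁
    ; distribˡ = λ (a , b) (c , d) (e , f) →
        solve 7 (λ a b c d e f q → a :* (c :+ e) :+ q :* (b :* (d :+ f))
          := a :* c :+ q :* (b :* d) :+ (a :* e :+ q :* (b :* f))) refl a b c d e f (- e₂) ,
        solve 7 (λ a b c d e f s → a :* (d :+ f) :+ b :* (c :+ e) :+ s :* (b :* (d :+ f))
          := a :* d :+ b :* c :+ s :* (b :* d) :+ (a :* f :+ b :* e :+ s :* (b :* f))) refl a b c d e f e₁
    }

  splittingRing : CommutativeRing c ℓ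
  splittingRing = RingLaws.commutativeRing laws

  open Exp (CommutativeRing.semiring splittingRing) using () renaming (_^_ to _^ₑ_) public

  α₁ α₂ : Elt
  α₁ = 0# , 1#
  α₂ = e₁ , - 1#

  α₁+α₂ : α₁ +ₑ α₂ ≈ₑ embed e₁
  α₁+α₂ = +-identityˡ e₁ , -‿inverseʳ 1#

  α₁*α₂ : α₁ *ₑ α₂ ≈ₑ embed e₂
  α₁*α₂ = (begin
    0# * e₁ + - e₂ * (1# * - 1#)  ≈⟨ +-cong (zeroˡ e₁) (*-congˡ (*-identityˡ (- 1#))) ⟩
    0# + - e₂ * - 1#              ≈⟨ +-identityˡ _ ⟩
    - e₂ * - 1#                   ≈⟨ -‿distribʳ-* (- e₂) 1# ⟨
    - (- e₂ * 1#)                 ≈⟨ -‿cong (*-identityʳ (- e₂)) ⟩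
    - - e₂                        ≈⟨ -‿involutive e₂ ⟩
    e₂                            ∎) , (begin
    0# * - 1# + 1# * e₁ + e₁ * (1# * - 1#) ≈⟨ solve 2 (λ s m → con 0 :* m :+ con 1 :* s :+ s :* (con 1 :* m) := s :* (con 1 :+ m)) refl e₁ (- 1#) ⟩
    e₁ * (1# + - 1#)                       ≈⟨ *-congˡ (-‿inverseʳ 1#) ⟩
    e₁ * 0#                                ≈⟨ zeroʳ e₁ ⟩
    0#                                     ∎)

  -- α₁ⁿ + α₂ⁿ is symmetric, hence lies in S; powerSum n is its value there.
  powerSum : ℕ → Carrier
  powerSum n = proj₁ (α₁ ^ₑ n +ₑ α₂ ^ₑ n)

  private
    conjugate : ∀ n → let (a , b) = α₁ ^ₑ n ; (c , d) = α₂ ^ₑ n in (c ≈ a + e₁ * b) × (d ≈ - b)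
    conjugate zero    = sym (trans (+-congˡ (zeroʳ e₁)) (+-identityʳ 1#)) , sym -0#≈0#
    conjugate (suc n) =
      let (a , b) = α₁ ^ₑ n
          (c , d) = α₂ ^ₑ n
          (c≈ , d≈) = conjugate n
          -d≈b : - 1# * d ≈ b
          -d≈b = trans (-1*x≈-x d) (trans (-‿cong d≈) (-‿involutive b))
      in (begin
        e₁ * c + - e₂ * (- 1# * d)             ≈⟨ +-cong (*-congˡ c≈) (*-congˡ -d≈b) ⟩
        e₁ * (a + e₁ * b) + - e₂ * b           ≈⟨ solve 4 (λ a b s q → s :* (a :+ s :* b) :+ q :* b
            := con 0 :* a :+ q :* (con 1 :* b) :+ s :* (con 0 :* b :+ con 1 :* a :+ s :* (con 1 :* b))) refl a b e₁ (- e₂) ⟩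
        0# * a + - e₂ * (1# * b) + e₁ * (0# * b + 1# * a + e₁ * (1# * b)) ∎) , (begin
        e₁ * d + - 1# * c + e₁ * (- 1# * d)    ≈⟨ +-cong (+-cong (*-congˡ d≈) (-1*x≈-x c)) (*-congˡ -d≈b) ⟩
        e₁ * - b + - c + e₁ * b                ≈⟨ solve 4 (λ b s nb nc → s :* nb :+ nc :+ s :* b := nc :+ s :* (nb :+ b)) refl b e₁ (- b) (- c) ⟩
        - c + e₁ * (- b + b)                   ≈⟨ +-congˡ (trans (*-congˡ (-‿inverseˡ b)) (zeroʳ e₁)) ⟩
        - c + 0#                               ≈⟨ +-identityʳ (- c) ⟩
        - c                                    ≈⟨ -‿cong c≈ ⟩
        - (a + e₁ * b)                         ≈⟨ -‿cong (solve 3 (λ a b s → a :+ s :* b := con 0 :* b :+ con 1 :* a :+ s :* (con 1 :* b)) refl a b e₁) ⟩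
        - (0# * b + 1# * a + e₁ * (1# * b))    ∎)

  powerSum-correct : ∀ n → α₁ ^ₑ n +ₑ α₂ ^ₑ n ≈ₑ embed (powerSum n)
  powerSum-correct n = refl , trans (+-congˡ (proj₂ (conjugate n))) (-‿inverseʳ _)

-- The coefficients are in a ring A, which comes with a map ι from ℚ supplying
-- the rational scalars.  A series f has `f i j` as its coefficient of uⁱ wʲ.
module Bivariate {c ℓ} (A : CommutativeRing c ℓ) (ι : ℚ → CommutativeRing.Carrier A) where
  private
    module A = CommutativeRing A
    module AP = RingProperties A.ring
    module W = PowerSeries A
    module U = PowerSeries W.seriesRing

  bivariateRing : CommutativeRing c ℓ
  bivariateRing = U.seriesRing

  open CommutativeRing bivariateRing public
  open Exp semiring public using (_^_)
  open Sum A.semiring using (sum⁺-syntax)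
  open Sum semiring using (sum)

  u w : Carrier
  u = U.X
  w = U.const W.X

  const : A.Carrier → Carrier
  const a = U.const (W.const a)

  record Order≥ (n : ℕ) (f : Carrier) : Set ℓ where
    constructor order
    field coeff≈0 : ∀ i j → i ℕ.+ j ℕ.< n → f i j A.≈ A.0#
  open Order≥

  -- The sum of a family in which the n-th term has order ≥ n: only the terms
  -- with n ≤ i + j contribute to the coefficient of uⁱ wʲ.
  Σ∞ : (F : ℕ → Carrier) → (∀ n → Order≥ n (F n)) → Carrier
  Σ∞ F _ i j = ∑[ n ≤ i ℕ.+ j ] F (toℕ n) i j

  order-0 : ∀ {n} → Order≥ n 0#
  order-0 = order λ _ _ _ → A.refl

  order≥0 : ∀ {f} → Order≥ 0 f
  order≥0 = order λ _ _ ()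

  order-mono : ∀ {m n f} → m ℕ.≤ n → Order≥ n f → Order≥ m f
  order-mono m≤n (order h) = order λ i j i+j<m → h i j (ℕₚ.≤-trans i+j<m m≤n)

  order-+ : ∀ {n f g} → Order≥ n f → Order≥ n g → Order≥ n (f + g)
  order-+ (order h) (order k) = order λ i j lt → A.trans (A.+-cong (h i j lt) (k i j lt)) (A.+-identityˡ A.0#)

  order-neg : ∀ {n f} → Order≥ n f → Order≥ n (- f)
  order-neg (order h) = order λ i j lt → A.trans (A.-‿cong (h i j lt)) AP.-0#≈0#

  order-sum : ∀ {n m} (F : Vector.Vector Carrier m) → (∀ i → Order≥ n (F i)) → Order≥ n (sum F)
  order-sum {m = zero}  F h = order-0
  order-sum {m = suc m} F h = order-+ (h Fin.zero) (order-sum (F ∘ Fin.suc) (h ∘ Fin.suc))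

  order-* : ∀ {m n f g} → Order≥ m f → Order≥ n g → Order≥ (m ℕ.+ n) (f * g)
  order-* {m} {n} {f} {g} (order h) (order k) = order λ i j lt →
    at-zero j (λ a → f (toℕ a) W.⊛ g (i ∸ toℕ a)) λ a →
      W.sum-zero {suc j} _ λ b → term i j lt (toℕ a) (ℕₚ.≤-pred (Finₚ.toℕ<n a)) (toℕ b) (ℕₚ.≤-pred (Finₚ.toℕ<n b))
    where
    at-zero : ∀ j {l} (F : Vector.Vector (ℕ → A.Carrier) l) → (∀ a → F a j A.≈ A.0#) →
              Sum.sum (CommutativeRing.semiring W.seriesRing) F j A.≈ A.0#
    at-zero j {zero}  F F≈0 = A.refl
    at-zero j {suc l} F F≈0 = A.trans (A.+-cong (F≈0 Fin.zero) (at-zero j (F ∘ Fin.suc) (F≈0 ∘ Fin.suc)))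
                                      (A.+-identityˡ A.0#)

    term : ∀ i j → i ℕ.+ j ℕ.< m ℕ.+ n → ∀ a → a ℕ.≤ i → ∀ b → b ℕ.≤ j →
           f a b A.* g (i ∸ a) (j ∸ b) A.≈ A.0#
    term i j lt a a≤i b b≤j with ℕₚ.<-≤-connex (a ℕ.+ b) m
    ... | inj₁ a+b<m = A.trans (A.*-congʳ (h a b a+b<m)) (A.zeroˡ _)
    ... | inj₂ m≤a+b = A.trans (A.*-congˡ (k (i ∸ a) (j ∸ b) (ℕₚ.+-cancelˡ-< m _ _ (ℕₚ.≤-<-trans le lt)))) (A.zeroʳ _)
      where
      open ℕₚ.≤-Reasoning
      le : m ℕ.+ (i ∸ a ℕ.+ (j ∸ b)) ℕ.≤ i ℕ.+ j
      le = begin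
        m ℕ.+ (i ∸ a ℕ.+ (j ∸ b))             ≤⟨ ℕₚ.+-monoˡ-≤ _ m≤a+b ⟩
        a ℕ.+ b ℕ.+ (i ∸ a ℕ.+ (j ∸ b))       ≡⟨ [m+n]+[o+p]≡[m+o]+[n+p] a b (i ∸ a) (j ∸ b) ⟩
        a ℕ.+ (i ∸ a) ℕ.+ (b ℕ.+ (j ∸ b))     ≡⟨ ≡.cong₂ ℕ._+_ (ℕₚ.m+[n∸m]≡n a≤i) (ℕₚ.m+[n∸m]≡n b≤j) ⟩
        i ℕ.+ j                               ∎
        where
        open CommutativeSemigroupProperties ℕₚ.+-commutativeSemigroup
          using () renaming (interchange to [m+n]+[o+p]≡[m+o]+[n+p])

  order-^ : ∀ {f} → Order≥ 1 f → ∀ n → Order≥ n (f ^ n)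
  order-^ h zero    = order≥0
  order-^ h (suc n) = order-* h (order-^ h n)

  order-u : Order≥ 1 u
  order-u = order λ { zero _ _ → A.refl ; (suc _) _ (ℕ.s≤s ()) }

  order-w : Order≥ 1 w
  order-w = order λ { zero zero _ → A.refl ; zero (suc _) (ℕ.s≤s ()) ; (suc _) _ (ℕ.s≤s ()) }

  order-scale : ∀ {n f} g → Order≥ n f → Order≥ n (g * f)
  order-scale g = order-* (order≥0 {g})

  exp : (f : Carrier) → Order≥ 1 f → Carrier
  exp f f₀ = Σ∞ (λ n → const (ι ((+ 1 / n !) {{n ℕₚ.!≢0}})) * f ^ n)
                λ n → order-scale (const (ι ((+ 1 / n !) {{n ℕₚ.!≢0}}))) (order-^ f₀ n)

  order-Σ∞ : ∀ {d} (F : ℕ → Carrier) h → (∀ n → Order≥ d (F n)) → Order≥ d (Σ∞ F h)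
  order-Σ∞ F h hd = order λ i j lt →
    W.sum-zero {suc (i ℕ.+ j)} _ λ n → coeff≈0 (hd (toℕ n)) i j lt

  module _ {e₁ e₂ : Carrier} (h₁ : Order≥ 1 e₁) (h₂ : Order≥ 2 e₂) where
    open Splitting bivariateRing e₁ e₂

    private
      n≤1+pred : ∀ n → n ℕ.≤ suc (ℕ.pred n)
      n≤1+pred zero    = ℕ.z≤n
      n≤1+pred (suc n) = ℕₚ.≤-refl

      order-step : ∀ {n a b c d} → Order≥ 1 c → Order≥ n a → Order≥ (ℕ.pred n) b →
        let (a′ , b′) = (c , d) *ₑ (a , b) in Order≥ (suc n) a′ × Order≥ n b′
      order-step {n} {a} {b} {c} {d} hc ha hb =
        order-+ (order-* hc ha)
                (order-mono (ℕ.s≤s (n≤1+pred n)) (order-* (order-neg h₂) (order-scale d hb))) ,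
        order-+ (order-+ (order-mono (n≤1+pred n) (order-* hc hb)) (order-scale d ha))
                (order-mono (n≤1+pred n) (order-* h₁ (order-scale d hb)))

      order-α : ∀ {c d} → Order≥ 1 c → ∀ n →
        let (a , b) = (c , d) ^ₑ n in Order≥ n a × Order≥ (ℕ.pred n) b
      order-α hc zero    = order≥0 , order≥0
      order-α {c} {d} hc (suc n) = let ha , hb = order-α {c} {d} hc n in order-step {d = d} hc ha hb

    order-powerSum : ∀ n → Order≥ n (powerSum n)
    order-powerSum n = order-+ (proj₁ (order-α {d = 1#} order-0 n)) (proj₁ (order-α {d = - 1#} h₁ n))

Admissible : List ℕ → Set
Admissible []       = ⊥
Admissible (k ∷ ks) = 2 ℕ.≤ k × All (1 ℕ.≤_) ks

module Growth where
  open ≡ using (refl; sym; trans; cong; subst)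
  open Rat using (_+_; _*_; -_; _-_; _≤_; _<_)
  open ℚₚ
  open +-*-Solver using (solve; _:+_; _:*_; _:-_; :-_; _:=_; con)

  p : ℕ → ℚ
  p m = + 1 / suc m

  p-nonNeg : ∀ m → 0ℚ ≤ p m
  p-nonNeg m = <⇒≤ (recip-pos m)

  p*ι≤1 : ∀ m → p m * ι m ≤ 1ℚ
  p*ι≤1 m = ≤-trans (*-monoˡ-≤-nonNeg (p m) {{Rat.nonNegative (p-nonNeg m)}} (ι-mono (ℕₚ.n≤1+n m)))
                    (≤-reflexive (recip-* m))

  -- F = o(m)
  Sublinear : (ℕ → ℚ) → Set
  Sublinear F = ∀ ε → 0ℚ < ε → ∃ λ N → ∀ m → N ℕ.≤ m → F m ≤ ε * ι m

  const-sublinear : ∀ c → Sublinear (λ _ → c)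
  const-sublinear c ε 0<ε =
    let δ , _ , εδ≡1 = divide 0<ε (positive⁻¹ 1ℚ)
        N , δc≤N     = archimedes (δ * c)
    in N , λ m N≤m → begin
      c           ≡⟨ *-identityˡ c ⟨
      1ℚ * c      ≡⟨ cong (λ q → q * c) εδ≡1 ⟨
      ε * δ * c   ≡⟨ *-assoc ε δ c ⟩
      ε * (δ * c) ≤⟨ *-monoˡ-≤-nonNeg ε {{Rat.nonNegative (<⇒≤ 0<ε)}} (≤-trans δc≤N (ι-mono N≤m)) ⟩
      ε * ι m     ∎
    where open ≤-Reasoning

  halves : ∀ ε m → ½ * ε * ι m + ½ * ε * ι m ≡ ε * ι m
  halves ε m = trans (sym (*-distribʳ-+ (ι m) (½ * ε) (½ * ε))) (cong (λ q → q * ι m) (half ε))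

  add-sublinear : ∀ {F G} → Sublinear F → Sublinear G → Sublinear (λ m → F m + G m)
  add-sublinear F≪ G≪ ε 0<ε =
    let N , h = F≪ (½ * ε) (half-pos 0<ε)
        M , k = G≪ (½ * ε) (half-pos 0<ε)
    in N ℕ.⊔ M , λ m le → ≤-trans
         (+-mono-≤ (h m (ℕₚ.≤-trans (ℕₚ.m≤m⊔n N M) le)) (k m (ℕₚ.≤-trans (ℕₚ.m≤n⊔m N M) le)))
         (≤-reflexive (halves ε m))

  step-sublinear : ∀ {F G} → (∀ m → F (suc m) ≤ F m + p m * G m) → Sublinear G → Sublinear F
  step-sublinear {F} {G} step G≪ ε 0<ε =
    let N , h = G≪ (½ * ε) (half-pos 0<ε)
        M , k = const-sublinear (F N) (½ * ε) (half-pos 0<ε)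
    in N ℕ.⊔ M , λ m le →
      let N≤m = ℕₚ.≤-trans (ℕₚ.m≤m⊔n N M) le in begin
      F m                                ≡⟨ cong F (ℕₚ.m∸n+n≡m N≤m) ⟨
      F (m ∸ N ℕ.+ N)                    ≤⟨ climb N h (m ∸ N) ⟩
      F N + ½ * ε * ι (m ∸ N)            ≤⟨ +-mono-≤ (k m (ℕₚ.≤-trans (ℕₚ.m≤n⊔m N M) le))
                                              (*-monoˡ-≤-nonNeg (½ * ε) {{0≤½ε}} (ι-mono (ℕₚ.m∸n≤m m N))) ⟩
      ½ * ε * ι m + ½ * ε * ι m          ≡⟨ halves ε m ⟩
      ε * ι m                            ∎
    where
    open ≤-Reasoning
    0≤½ε : Rat.NonNegative (½ * ε)
    0≤½ε = Rat.nonNegative (<⇒≤ (half-pos 0<ε))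

    climb : ∀ N → (∀ m → N ℕ.≤ m → G m ≤ ½ * ε * ι m) → ∀ j → F (j ℕ.+ N) ≤ F N + ½ * ε * ι j
    climb N h zero    = ≤-reflexive (sym (trans (cong (λ q → F N + q) (*-zeroʳ (½ * ε))) (+-identityʳ (F N))))
    climb N h (suc j) = begin
      F (suc (j ℕ.+ N))                  ≤⟨ step m ⟩
      F m + p m * G m                    ≤⟨ +-mono-≤ (climb N h j)
                                              (*-monoˡ-≤-nonNeg (p m) {{Rat.nonNegative (p-nonNeg m)}} (h m (ℕₚ.m≤n+m N j))) ⟩
      F N + η * ι j + p m * (η * ι m)    ≡⟨ solve 5 (λ f x y z e → f :+ x :+ y :* (e :* z) := f :+ x :+ e :* (y :* z)) refl (F N) (η * ι j) (p m) (ι m) η ⟩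
      F N + η * ι j + η * (p m * ι m)    ≤⟨ +-monoʳ-≤ (F N + η * ι j) (*-monoˡ-≤-nonNeg η {{0≤½ε}} (p*ι≤1 m)) ⟩
      F N + η * ι j + η * 1ℚ             ≡⟨ solve 4 (λ f x e o → f :+ e :* x :+ e :* o := f :+ e :* (o :+ x)) refl (F N) (ι j) η 1ℚ ⟩
      F N + η * (1ℚ + ι j)               ≡⟨ cong (λ q → F N + η * q) (ι-suc j) ⟨
      F N + η * ι (suc j)                ∎
      where
      m = j ℕ.+ N
      η = ½ * ε

  abs≤ : ∀ {q b} → q ≤ b → - q ≤ b → Rat.∣ q ∣ ≤ b
  abs≤ {q} {b} q≤b -q≤b with ∣p∣≡p∨∣p∣≡-p q
  ... | inj₁ e = subst (_≤ b) (sym e) q≤b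
  ... | inj₂ e = subst (_≤ b) (sym e) -q≤b

  cauchy-criterion : (x b : ℕ → ℚ) → (∀ m → x m ≤ x (suc m)) → (∀ m → 0ℚ ≤ b m) →
    (∀ m → x (suc m) + b (suc m) ≤ x m + b m) →
    (∀ ε → 0ℚ < ε → ∃ λ N → b N < ε) → IsCauchy x
  cauchy-criterion x b x↑ 0≤b xb↓ b→0 ε 0<ε =
    let N , bN<ε = b→0 ε 0<ε
    in N , λ m n N≤m N≤n → ≤-<-trans
         (abs≤ (below N m n N≤m N≤n)
               (subst (_≤ b N) (solve 2 (λ s t → s :- t := :- (t :- s)) refl (x n) (x m)) (below N n m N≤n N≤m)))
         bN<ε
    where
    open ≤-Reasoning
    rising : ∀ N j → x N ≤ x (j ℕ.+ N)
    rising N zero    = ≤-refl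
    rising N (suc j) = ≤-trans (rising N j) (x↑ (j ℕ.+ N))

    falling : ∀ N j → x (j ℕ.+ N) + b (j ℕ.+ N) ≤ x N + b N
    falling N zero    = ≤-refl
    falling N (suc j) = ≤-trans (xb↓ (j ℕ.+ N)) (falling N j)

    lower : ∀ N m → N ℕ.≤ m → x N ≤ x m
    lower N m N≤m = subst (λ i → x N ≤ x i) (ℕₚ.m∸n+n≡m N≤m) (rising N (m ∸ N))

    upper : ∀ N m → N ℕ.≤ m → x m ≤ x N + b N
    upper N m N≤m = begin
      x m       ≡⟨ +-identityʳ (x m) ⟨
      x m + 0ℚ  ≤⟨ +-monoʳ-≤ (x m) (0≤b m) ⟩
      x m + b m ≤⟨ subst (λ i → x i + b i ≤ x N + b N) (ℕₚ.m∸n+n≡m N≤m) (falling N (m ∸ N)) ⟩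
      x N + b N ∎

    below : ∀ N m n → N ℕ.≤ m → N ℕ.≤ n → x m - x n ≤ b N
    below N m n N≤m N≤n = begin
      x m - x n         ≤⟨ +-mono-≤ (upper N m N≤m) (neg-antimono-≤ (lower N n N≤n)) ⟩
      x N + b N - x N   ≡⟨ solve 2 (λ s t → s :+ t :- s := t) refl (x N) (b N) ⟩
      b N               ∎

module MultipleT (N a : ℕ) .{{_ : NonZero N}} where
  open ≡ using (refl; sym; trans; cong; subst)
  open Rat using (_+_; _*_; -_; _-_; _≤_; _<_)
  open ℚₚ
  open +-*-Solver using (solve; _:+_; _:*_; _:-_; :-_; _:=_; con)
  open Growth

  -- truncated k M is the sum over M ≥ m₁ > ⋯ > mₙ > 0, mᵢ ≡ a (mod N), and
  -- summand k₁ (k₂,…,kₙ) m its part with m₁ = m + 1.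
  truncated : List ℕ → ℕ → ℚ
  summand   : ℕ → List ℕ → ℕ → ℚ

  truncated []       M = 1ℚ
  truncated (k ∷ ks) M = sumℚ {M} (summand k ks ∘ toℕ)

  summand k ks m =
    if does (suc m % N ℕₚ.≟ a % N) then (+ 1 / suc m) ^ℚ k * truncated ks m else 0ℚ

  private
    truncated-suc : ∀ k ks M → truncated (k ∷ ks) (suc M) ≡ truncated (k ∷ ks) M + summand k ks M
    truncated-suc k ks M = sum-last (summand k ks) M

    truncated-nonNeg : ∀ ks M → 0ℚ ≤ truncated ks M
    summand-nonNeg : ∀ k ks m → 0ℚ ≤ summand k ks m

    truncated-nonNeg []       M       = nonNegative⁻¹ 1ℚ
    truncated-nonNeg (k ∷ ks) zero    = ≤-refl
    truncated-nonNeg (k ∷ ks) (suc M) = subst (0ℚ ≤_) (sym (truncated-suc k ks M))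
      (+-mono-≤ (truncated-nonNeg (k ∷ ks) M) (summand-nonNeg k ks M))

    summand-nonNeg k ks m with does (suc m % N ℕₚ.≟ a % N)
    ... | true  = nonNeg* (pow-nonNeg (p-nonNeg m) k) (truncated-nonNeg ks m)
    ... | false = ≤-refl

    summand≤ : ∀ k ks m q → p m ^ℚ k ≤ q → 0ℚ ≤ q → summand k ks m ≤ q * truncated ks m
    summand≤ k ks m q pᵏ≤q 0≤q with does (suc m % N ℕₚ.≟ a % N)
    ... | true  = *-monoʳ-≤-nonNeg (truncated ks m) {{Rat.nonNegative (truncated-nonNeg ks m)}} pᵏ≤q
    ... | false = nonNeg* 0≤q (truncated-nonNeg ks m)

    pow≤p : ∀ {k} → 1 ℕ.≤ k → ∀ m → p m ^ℚ k ≤ p m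
    pow≤p {suc k} _ m = ≤-trans
      (*-monoˡ-≤-nonNeg (p m) {{Rat.nonNegative (p-nonNeg m)}} (pow≤1 (p-nonNeg m) (recip≤1 m) k))
      (≤-reflexive (*-identityʳ (p m)))

    pow≤p² : ∀ {k} → 2 ℕ.≤ k → ∀ m → p m ^ℚ k ≤ p m * p m
    pow≤p² {suc k} (ℕ.s≤s 1≤k) m =
      *-monoˡ-≤-nonNeg (p m) {{Rat.nonNegative (p-nonNeg m)}} (pow≤p 1≤k m)

    truncated-step : ∀ {k} → 1 ℕ.≤ k → ∀ ks M →
      truncated (k ∷ ks) (suc M) ≤ truncated (k ∷ ks) M + p M * truncated ks M
    truncated-step {k} 1≤k ks M = ≤-trans (≤-reflexive (truncated-suc k ks M))
      (+-monoʳ-≤ (truncated (k ∷ ks) M) (summand≤ k ks M (p M) (pow≤p 1≤k M) (p-nonNeg M)))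

    truncated-sublinear : ∀ {ks} → All (1 ℕ.≤_) ks → Sublinear (truncated ks)
    truncated-sublinear []                   = const-sublinear 1ℚ
    truncated-sublinear {k ∷ ks} (1≤k ∷ pos) =
      step-sublinear {truncated (k ∷ ks)} {truncated ks} (truncated-step 1≤k ks) (truncated-sublinear pos)

    -- the sum of truncated over the suffixes of an index
    suffixes : List ℕ → ℕ → ℚ
    suffixes []       M = truncated [] M
    suffixes (k ∷ ks) M = truncated (k ∷ ks) M + suffixes ks M

    suffixes-nonNeg : ∀ ks M → 0ℚ ≤ suffixes ks M
    suffixes-nonNeg []       M = truncated-nonNeg [] M
    suffixes-nonNeg (k ∷ ks) M = +-mono-≤ (truncated-nonNeg (k ∷ ks) M) (suffixes-nonNeg ks M)

    suffixes-sublinear : ∀ {ks} → All (1 ℕ.≤_) ks → Sublinear (suffixes ks)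
    suffixes-sublinear []                   = const-sublinear 1ℚ
    suffixes-sublinear {k ∷ ks} (1≤k ∷ pos) =
      add-sublinear {truncated (k ∷ ks)} {suffixes ks} (truncated-sublinear (1≤k ∷ pos)) (suffixes-sublinear pos)

    suffixes-step : ∀ {ks} → All (1 ℕ.≤_) ks → ∀ M →
      suffixes ks (suc M) ≤ suffixes ks M + p M * (suffixes ks M - truncated ks M)
    suffixes-step [] M = ≤-reflexive (solve 2 (λ x o → o := o :+ x :* (o :- o)) refl (p M) 1ℚ)
    suffixes-step {k ∷ ks} (1≤k ∷ pos) M = begin
      truncated (k ∷ ks) (suc M) + suffixes ks (suc M)
        ≤⟨ +-mono-≤ (truncated-step 1≤k ks M) (suffixes-step pos M) ⟩
      x + q * y + (z + q * (z - y))
        ≡⟨ solve 4 (λ x y z q → x :+ q :* y :+ (z :+ q :* (z :- y)) := x :+ z :+ q :* (x :+ z :- x)) refl x y z q ⟩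
      x + z + q * (x + z - x) ∎
      where
      open ≤-Reasoning
      x = truncated (k ∷ ks) M
      y = truncated ks M
      z = suffixes ks M
      q = p M

    -- twice this bounds the tail of the series for k₁ ∷ ks when k₁ ≥ 2
    tail : List ℕ → ℕ → ℚ
    tail ks M = p M * suffixes ks M

    tail-step : ∀ {ks} → All (1 ℕ.≤_) ks → ∀ M →
      p M * p (suc M) * truncated ks M + tail ks (suc M) ≤ tail ks M
    tail-step {ks} pos M = begin
      x * y * s + y * suffixes ks (suc M)  ≤⟨ +-monoʳ-≤ (x * y * s) (*-monoˡ-≤-nonNeg y {{Rat.nonNegative (p-nonNeg (suc M))}} (suffixes-step pos M)) ⟩
      x * y * s + y * (e + x * (e - s))    ≡⟨ solve 4 (λ x y s e → x :* y :* s :+ y :* (e :+ x :* (e :- s)) := (y :+ x :* y) :* e) refl x y s e ⟩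
      (y + x * y) * e                      ≡⟨ cong (λ q → (y + q) * e) (recip-diff M) ⟨
      (y + (x - y)) * e                    ≡⟨ cong (λ q → q * e) (solve 2 (λ x y → y :+ (x :- y) := x) refl x y) ⟩
      x * e                                ∎
      where
      open ≤-Reasoning
      x = p M
      y = p (suc M)
      s = truncated ks M
      e = suffixes ks M

    tail-null : ∀ {ks} → All (1 ℕ.≤_) ks → ∀ ε → 0ℚ < ε → ∃ λ M → (1ℚ + 1ℚ) * tail ks M < ε
    tail-null {ks} pos ε 0<ε =
      let M , h = suffixes-sublinear pos (½ * (½ * ε)) (half-pos (half-pos 0<ε))
      in M , (begin-strict
        (1ℚ + 1ℚ) * (p M * suffixes ks M)  ≤⟨ *-monoˡ-≤-nonNeg (1ℚ + 1ℚ) (*-monoˡ-≤-nonNeg (p M) {{Rat.nonNegative (p-nonNeg M)}} (h M ℕₚ.≤-refl)) ⟩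
        (1ℚ + 1ℚ) * (p M * (½ * η * ι M))  ≡⟨ solve 5 (λ t x h e m → t :* (x :* (h :* e :* m)) := t :* h :* e :* (x :* m)) refl (1ℚ + 1ℚ) (p M) ½ η (ι M) ⟩
        1ℚ * η * (p M * ι M)               ≤⟨ *-monoˡ-≤-nonNeg (1ℚ * η) {{Rat.nonNegative (nonNeg* (nonNegative⁻¹ 1ℚ) (<⇒≤ (half-pos 0<ε)))}} (p*ι≤1 M) ⟩
        1ℚ * η * 1ℚ                        ≡⟨ trans (*-identityʳ (1ℚ * η)) (*-identityˡ η) ⟩
        η                                  ≡⟨ +-identityʳ η ⟨
        η + 0ℚ                             <⟨ +-monoʳ-< η (half-pos 0<ε) ⟩
        η + η                              ≡⟨ half ε ⟩
        ε                                  ∎)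
      where
      open ≤-Reasoning
      η = ½ * ε

  truncated-cauchy : ∀ {k} → Admissible k → IsCauchy (truncated k)
  truncated-cauchy {k ∷ ks} (2≤k , pos) = cauchy-criterion (truncated (k ∷ ks)) (λ M → (1ℚ + 1ℚ) * tail ks M)
    (λ M → begin
      truncated (k ∷ ks) M                    ≡⟨ +-identityʳ (truncated (k ∷ ks) M) ⟨
      truncated (k ∷ ks) M + 0ℚ               ≤⟨ +-monoʳ-≤ (truncated (k ∷ ks) M) (summand-nonNeg k ks M) ⟩
      truncated (k ∷ ks) M + summand k ks M   ≡⟨ truncated-suc k ks M ⟨
      truncated (k ∷ ks) (suc M)              ∎)
    (λ M → nonNeg* (nonNegative⁻¹ (1ℚ + 1ℚ)) (nonNeg* (p-nonNeg M) (suffixes-nonNeg ks M)))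
    (λ M → let x = truncated (k ∷ ks) M ; y = p M ; z = p (suc M) ; s = truncated ks M ; t = tail ks (suc M) in begin
      truncated (k ∷ ks) (suc M) + two * t    ≡⟨ cong (λ q → q + two * t) (truncated-suc k ks M) ⟩
      x + summand k ks M + two * t            ≤⟨ +-monoˡ-≤ (two * t) (+-monoʳ-≤ x (summand≤ k ks M (two * (y * z))
                                                   (≤-trans (pow≤p² 2≤k M) (recip²≤ M)) (nonNeg* (nonNegative⁻¹ two) (nonNeg* (p-nonNeg M) (p-nonNeg (suc M)))))) ⟩
      x + two * (y * z) * s + two * t         ≡⟨ solve 6 (λ x y z s t w → x :+ w :* (y :* z) :* s :+ w :* t := x :+ w :* (y :* z :* s :+ t)) refl x y z s t two ⟩
      x + two * (y * z * s + t)               ≤⟨ +-monoʳ-≤ x (*-monoˡ-≤-nonNeg two (tail-step pos M)) ⟩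
      x + two * tail ks M                     ∎)
    (tail-null pos)
    where
    open ≤-Reasoning
    two = 1ℚ + 1ℚ

  -- the limit of the truncations m₁ ≤ M, that is, the sum of the series
  t : (k : List ℕ) → Admissible k → ℝ
  t k adm = real (truncated k) (truncated-cauchy adm)

weight depth height : List ℕ → ℕ
weight   = ListAction.sum
depth    = length
height k = length (filter (2 ℕₚ.≤?_) k)

admissible? : ∀ k → Dec (Admissible k)
admissible? []       = no λ ()
admissible? (k ∷ ks) = 2 ℕₚ.≤? k ×-dec All.all? (1 ℕₚ.≤?_) ks

InI₀ : ℕ → ℕ → ℕ → List ℕ → Set
InI₀ k n s p = Admissible p × weight p ≡ k × depth p ≡ n × height p ≡ s

inI₀? : ∀ k n s p → Dec (InI₀ k n s p)
inI₀? k n s p = admissible? p ×-dec weight p ℕₚ.≟ k ×-dec depth p ℕₚ.≟ n ×-dec height p ℕₚ.≟ s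

-- The entries of an index of weight k are at most k, so I₀ filters a finite list.
tuples : ℕ → ℕ → List (List ℕ)
tuples zero    k = [] ∷ []
tuples (suc n) k = cartesianProductWith _∷_ (applyUpTo suc k) (tuples n k)

I₀ : ℕ → ℕ → ℕ → List (List ℕ)
I₀ k n s = filter (inI₀? k n s) (tuples n k)

I₀-sound : ∀ k n s → All (InI₀ k n s) (I₀ k n s)
I₀-sound k n s = Allₚ.all-filter (inI₀? k n s) (tuples n k)

-- the indices obtained from k □ l₁ □ ⋯ □ lₘ
mergings′ : ℕ → List ℕ → List (List ℕ)
mergings′ k []       = (k ∷ []) ∷ []
mergings′ k (l ∷ ls) = map (k ∷_) (mergings′ l ls) ++ mergings′ (k ℕ.+ l) ls

mergings : List ℕ → List (List ℕ)
mergings []       = []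
mergings (k ∷ ks) = mergings′ k ks

mergings-positive : ∀ {k ks} → 1 ℕ.≤ k → All (1 ℕ.≤_) ks → All (All (1 ℕ.≤_)) (mergings′ k ks)
mergings-positive 1≤k []          = (1≤k ∷ []) ∷ []
mergings-positive 1≤k (1≤l ∷ pos) = Allₚ.++⁺
  (Allₚ.map⁺ (All.map (1≤k ∷_) (mergings-positive 1≤l pos)))
  (mergings-positive (ℕₚ.m≤n⇒m≤n+o _ 1≤k) pos)

mergings′-admissible : ∀ {k ks} → 2 ℕ.≤ k → All (1 ℕ.≤_) ks → All Admissible (mergings′ k ks)
mergings′-admissible 2≤k []          = (2≤k , []) ∷ []
mergings′-admissible 2≤k (1≤l ∷ pos) = Allₚ.++⁺
  (Allₚ.map⁺ (All.map (2≤k ,_) (mergings-positive 1≤l pos)))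
  (mergings′-admissible (ℕₚ.m≤n⇒m≤n+o _ 2≤k) pos)

mergings-admissible : ∀ {k} → Admissible k → All Admissible (mergings k)
mergings-admissible {k ∷ ks} (2≤k , pos) = mergings′-admissible 2≤k pos

module Sides {c ℓ} (A : CommutativeRing c ℓ) (ι : ℚ → CommutativeRing.Carrier A)
             (r : CommutativeRing.Carrier A) where
  open Bivariate A ι public
  open Sum semiring using (sum-syntax)
  private module A = CommutativeRing A

  -- Σ X k n u^(k−2n) w^(2n) over k ≥ 2n, n ≥ 1, grouped by k, which is the total
  -- degree of the monomial; the condition on n is that 1 ≤ n ≤ ⌊k/2⌋.
  weightPart : (ℕ → ℕ → A.Carrier) → ℕ → Carrier
  weightPart X k = ∑[ i < ⌊ k /2⌋ ] (let n = suc (toℕ i) in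
    const (X k n) * (u ^ (k ∸ 2 ℕ.* n) * w ^ (2 ℕ.* n)))

  order-weightPart : ∀ X k → Order≥ k (weightPart X k)
  order-weightPart X k = order-sum {k} {⌊ k /2⌋} _ λ i → let n = suc (toℕ i) in
    order-scale (const (X k n))
      (order-mono (ℕₚ.≤-trans (ℕₚ.m≤n+m∸n k (2 ℕ.* n)) (ℕₚ.≤-reflexive (ℕₚ.+-comm (2 ℕ.* n) (k ∸ 2 ℕ.* n))))
        (order-* (order-^ order-u (k ∸ 2 ℕ.* n)) (order-^ order-w (2 ℕ.* n))))

  generatingSeries : (ℕ → ℕ → A.Carrier) → Carrier
  generatingSeries X = Σ∞ (weightPart X) (order-weightPart X)

  αα γγ : Carrier
  αα = - (const r * w ^ 2)
  γγ = const (A.1# A.- r) * w ^ 2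

  -- α.α₁, α.α₂ are α₁, α₂ and γ.α₁, γ.α₂ are γ₁, γ₂.
  module α = Splitting bivariateRing u αα
  module γ = Splitting bivariateRing u γγ

  powerSums : ℕ → Carrier
  powerSums n = α.powerSum n - γ.powerSum n

  order-powerSums : ∀ n → Order≥ n (powerSums n)
  order-powerSums n = order-+
    (order-powerSum order-u (order-neg (order-scale (const r) (order-^ order-w 2))) n)
    (order-neg (order-powerSum order-u (order-scale (const (A.1# A.- r)) (order-^ order-w 2)) n))

  -- Σ τ n (α₁ⁿ + α₂ⁿ − γ₁ⁿ − γ₂ⁿ) over n ≥ 2; the index of summation is n − 2.
  exponentTerm : ((n : ℕ) → 2 ℕ.≤ n → A.Carrier) → ℕ → Carrier
  exponentTerm τ i = let n = 2 ℕ.+ i in const (τ n (ℕ.s≤s (ℕ.s≤s ℕ.z≤n))) * powerSums n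

  order-exponentTerm : ∀ τ i → Order≥ (2 ℕ.+ i) (exponentTerm τ i)
  order-exponentTerm τ i =
    order-scale (const (τ (2 ℕ.+ i) (ℕ.s≤s (ℕ.s≤s ℕ.z≤n)))) (order-powerSums (2 ℕ.+ i))

  exponent : ((n : ℕ) → 2 ℕ.≤ n → A.Carrier) → Carrier
  exponent τ = Σ∞ (exponentTerm τ) λ i → order-mono (ℕₚ.m≤n+m i 2) (order-exponentTerm τ i)

  order-exponent : ∀ τ → Order≥ 1 (exponent τ)
  order-exponent τ = order-Σ∞ (exponentTerm τ)
    (λ i → order-mono (ℕₚ.m≤n+m i 2) (order-exponentTerm τ i))
    (λ i → order-mono (ℕ.s≤s ℕ.z≤n) (order-exponentTerm τ i))

-- The variable r is the indeterminate of ℝ[r].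
open Polynomials ℝ-ring public using () renaming
  (Polynomial to ℝ[r]; polynomialRing to ℝ[r]-ring; const to fromℝ; X to r)

module Interpolated (N a : ℕ) .{{_ : NonZero N}} where
  open MultipleT N a public using (t)
  open CommutativeRing ℝ[r]-ring using (_+_; _*_; 0#; semiring)
  open Exp semiring using (_^_)

  sumList : List ℝ[r] → ℝ[r]
  sumList = foldr _+_ 0#

  -- All.reduce f passes to f the proofs that the indices in the list are admissible.
  tʳ : (k : List ℕ) → Admissible k → ℝ[r]
  tʳ k adm = sumList (All.reduce
    (λ {p} adm-p → r ^ (depth k ∸ depth p) * fromℝ (t p adm-p)) (mergings-admissible adm))

  X₀ʳ : ℕ → ℕ → ℕ → ℝ[r]
  X₀ʳ k n s = sumList (All.reduce (λ {p} p∈I₀ → tʳ p (proj₁ p∈I₀)) (I₀-sound k n s))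

  t/n : (n : ℕ) → 2 ℕ.≤ n → ℝ[r]
  t/n n 2≤n = fromℝ (t (n ∷ []) (2≤n , []) *ᵣ fromℚ ((+ 1 / n) {{ℕ.>-nonZero (ℕₚ.<⇒≤ 2≤n)}}))
    where open Real using (_*ᵣ_)

module ℝ[r]⟦u,w⟧ = Sides ℝ[r]-ring (fromℝ ∘ fromℚ) r

{-# OPTIONS --safe #-}
module Submission where

-- The operations on ℝ act pointwise on Cauchy sequences, so it is enough to prove
-- the identity over ℚ⟦r⟧ for the truncations m₁ ≤ M of all the series involved.
-- In tʳ a plus sign merges two indices, so tʳ is the sum over m₁ ≥ ⋯ ≥ mₙ with a
-- factor r for each equality.  Hence, writing D(x) = (1 − α₁x)(1 − α₂x) and
-- E(x) = (1 − γ₁x)(1 − γ₂x), the truncated left side is a product over m ≤ M,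
-- m ≡ a of factors E(1/m)/D(1/m).  The Euler operator θ = u∂/∂u + w∂/∂w satisfies
-- θα = α and θγ = γ, so the logarithmic θ-derivative of such a factor is
-- Σ m⁻ⁿ (α₁ⁿ + α₂ⁿ − γ₁ⁿ − γ₂ⁿ).  So both sides have the same logarithmic
-- θ-derivative, and the same constant term 1.

open import Defs
open import Algebra.Bundles using (CommutativeRing)
import Algebra.Properties.Ring as RingProperties
import Algebra.Properties.Semiring.Exp as Exp
import Algebra.Properties.Semiring.Mult as Mult
import Algebra.Properties.Semiring.Sum as Sum
import Algebra.Solver.Ring.NaturalCoefficients.Default as SemiringSolver
open import Data.Bool.Base using (Bool; true; false; if_then_else_)
open import Data.Fin.Base as Fin using (toℕ)
import Data.Fin.Properties as Finₚ
open import Data.Integer.Base using (+_)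
open import Data.List.Base using (List; []; _∷_; _++_; map; foldr; filter; length; cartesianProductWith; applyUpTo)
import Data.List.Properties as Listₚ
open import Data.List.Relation.Unary.All as All using (All; []; _∷_)
import Data.List.Relation.Unary.All.Properties as Allₚ
open import Data.Maybe.Base as Maybe using (Maybe; just; nothing; maybe)
open import Data.Nat.Base as ℕ using (ℕ; zero; suc; NonZero; _≤_; _∸_; _!; ⌊_/2⌋)
open import Data.Nat.DivMod using (_%_)
import Data.Nat.Properties as ℕₚ
open import Data.Nat.Solver using (module +-*-Solver)
open import Data.Product using (∃; _×_; _,_; proj₁; proj₂)
open import Data.Rational.Base as Rat using (ℚ; 0ℚ; 1ℚ; _/_)
import Data.Rational.Properties as ℚₚ
open import Data.Vec.Functional using (Vector)
open import Function.Base using (_∘_; case_of_)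
open import Function.Bundles using (_⇔_; mk⇔)
open import Level using (Level; _⊔_; 0ℓ) renaming (suc to lsuc)
open import Relation.Binary.PropositionalEquality as ≡ using (_≡_; _≢_)
import Relation.Binary.Reasoning.Setoid as SetoidReasoning
open import Relation.Nullary.Decidable using (Dec; does; yes; no; dec-false; does-⇔; _×-dec_)
open import Relation.Nullary.Negation using (¬_; contradiction)

-- A factor arises as follows. Let m = M + 1 contribute, put x = 1/m, and let `G` be the truncated
-- left side and `H` the part with m₁ = m. Removing the first entry k₁ of an index leaves either m₂
-- < m, or m₂ = m with a factor r; the geometric series over k₁ ≥ 2 gives (1 - xu)H = x²w²(G + rH).
-- As D = 1 - xu - rx²w² and E = D + x²w², this says (G + H)D = GE. The identity is exact at every
-- truncation, so no limit is exchanged with a sum: each coefficient of either side is a fixed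
-- finite expression in the t-values, built by ring operations that act termwise on sequences.
-- Comparing logarithmic derivatives avoids logarithms of series and the functional equation of exp.
-- Division by D becomes cancellation of 1 plus a series of positive order, and the roots enter only
-- through their power sums, which obey Newton's recurrence.

-- Relations between rings

-- Respect for the ring equalities is deliberately not required: a truncation of
-- a Cauchy sequence is compatible with the operations on ℝ, but not with ≈ᵣ.
record RingRelation {c ℓ c′ ℓ′} (A : CommutativeRing c ℓ) (B : CommutativeRing c′ ℓ′)
                    (ρ : Level) : Set (c ⊔ c′ ⊔ lsuc ρ) where
  private
    module A = CommutativeRing A
    module B = CommutativeRing B
  field
    _∼_ : A.Carrier → B.Carrier → Set ρ
    0∼  : A.0# ∼ B.0#
    1∼  : A.1# ∼ B.1#
    +∼  : ∀ {x x′ y y′} → x ∼ x′ → y ∼ y′ → (x A.+ y) ∼ (x′ B.+ y′)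
    *∼  : ∀ {x x′ y y′} → x ∼ x′ → y ∼ y′ → (x A.* y) ∼ (x′ B.* y′)
    -∼  : ∀ {x x′} → x ∼ x′ → (A.- x) ∼ (B.- x′)

module _ {c ℓ c′ ℓ′ ρ} {A : CommutativeRing c ℓ} {B : CommutativeRing c′ ℓ′}
         (R : RingRelation A B ρ) where
  open RingRelation R
  private
    module A where
      open CommutativeRing A public
      open Sum semiring public using (sum)
      open Exp semiring public using (_^_)
    module B where
      open CommutativeRing B public
      open Sum semiring public using (sum)
      open Exp semiring public using (_^_)

  sum∼ : ∀ {n} {f : Vector A.Carrier n} {g : Vector B.Carrier n} →
         (∀ i → f i ∼ g i) → A.sum f ∼ B.sum g
  sum∼ {zero}  f∼g = 0∼
  sum∼ {suc n} f∼g = +∼ (f∼g Fin.zero) (sum∼ (f∼g ∘ Fin.suc))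

  ^∼ : ∀ {x y} n → x ∼ y → (x A.^ n) ∼ (y B.^ n)
  ^∼ zero    x∼y = 1∼
  ^∼ (suc n) x∼y = *∼ x∼y (^∼ n x∼y)

  module PowerSeries∼ where
    private
      module PA = PowerSeries A
      module PB = PowerSeries B

    _∼ₛ_ : PA.Series → PB.Series → Set ρ
    f ∼ₛ g = ∀ n → f n ∼ g n

    const∼ : ∀ {a b} → a ∼ b → PA.const a ∼ₛ PB.const b
    const∼ a∼b zero    = a∼b
    const∼ a∼b (suc _) = 0∼

    X∼ : PA.X ∼ₛ PB.X
    X∼ zero          = 0∼
    X∼ (suc zero)    = 1∼
    X∼ (suc (suc _)) = 0∼

    relation : RingRelation PA.seriesRing PB.seriesRing ρ
    relation = record
      { _∼_ = _∼ₛ_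
      ; 0∼  = λ _ → 0∼
      ; 1∼  = const∼ 1∼
      ; +∼  = λ p q n → +∼ (p n) (q n)
      ; *∼  = λ p q n → sum∼ {suc n} λ i → *∼ (p (toℕ i)) (q (n ∸ toℕ i))
      ; -∼  = λ p n → -∼ (p n) }

  module Splitting∼ {e₁ e₂ e₁′ e₂′} (e₁∼ : e₁ ∼ e₁′) (e₂∼ : e₂ ∼ e₂′) where
    private
      module SA = Splitting A e₁ e₂
      module SB = Splitting B e₁′ e₂′

    relation : RingRelation SA.splittingRing SB.splittingRing ρ
    relation = record
      { _∼_ = λ x y → proj₁ x ∼ proj₁ y × proj₂ x ∼ proj₂ y
      ; 0∼  = 0∼ , 0∼
      ; 1∼  = 1∼ , 0∼
      ; +∼  = λ (p , q) (p′ , q′) → +∼ p p′ , +∼ q q′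
      ; *∼  = λ (p , q) (p′ , q′) →
          +∼ (*∼ p p′) (*∼ (-∼ e₂∼) (*∼ q q′)) ,
          +∼ (+∼ (*∼ p q′) (*∼ q p′)) (*∼ e₁∼ (*∼ q q′))
      ; -∼  = λ (p , q) → -∼ p , -∼ q }

module _ {c ℓ c′ ℓ′ ρ} {A : CommutativeRing c ℓ} {B : CommutativeRing c′ ℓ′}
         (R : RingRelation A B ρ) where
  open RingRelation R

  powerSum∼ : ∀ {e₁ e₂ e₁′ e₂′} → e₁ ∼ e₁′ → e₂ ∼ e₂′ →
              ∀ n → Splitting.powerSum A e₁ e₂ n ∼ Splitting.powerSum B e₁′ e₂′ n
  powerSum∼ e₁∼ e₂∼ n =
    +∼ (proj₁ (^∼ relation n (0∼ , 1∼))) (proj₁ (^∼ relation n (e₁∼ , -∼ 1∼)))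
    where open Splitting∼ R e₁∼ e₂∼

module Sides∼ {c ℓ c′ ℓ′} (A : CommutativeRing c ℓ) (B : CommutativeRing c′ ℓ′)
              (ι : ℚ → CommutativeRing.Carrier A) (ι′ : ℚ → CommutativeRing.Carrier B)
              (r : CommutativeRing.Carrier A) (r′ : CommutativeRing.Carrier B) where
  module A = Sides A ι r
  module B = Sides B ι′ r′

  module Related {ρ} (R : RingRelation A B ρ) (ι∼ : ∀ q → RingRelation._∼_ R (ι q) (ι′ q))
                 (r∼ : RingRelation._∼_ R r r′) where
    open RingRelation R
    private
      module W = PowerSeries∼ R
      module U = PowerSeries∼ W.relation
    module S = RingRelation U.relation
    open S using () renaming (_∼_ to _≃_)

    const∼ : ∀ {a b} → a ∼ b → A.const a ≃ B.const b
    const∼ a∼b = U.const∼ (W.const∼ a∼b)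

    u∼ : A.u ≃ B.u
    u∼ = U.X∼

    w∼ : A.w ≃ B.w
    w∼ = U.const∼ W.X∼

    Σ∞∼ : ∀ {F G} hF hG → (∀ n → F n ≃ G n) → A.Σ∞ F hF ≃ B.Σ∞ G hG
    Σ∞∼ _ _ F∼G i j = sum∼ R {suc (i ℕ.+ j)} λ n → F∼G (toℕ n) i j

    generatingSeries∼ : ∀ {X Y} → (∀ k n → X k n ∼ Y k n) → A.generatingSeries X ≃ B.generatingSeries Y
    generatingSeries∼ {X} {Y} X∼Y = Σ∞∼ {A.weightPart X} {B.weightPart Y} (A.order-weightPart X) (B.order-weightPart Y) λ k → sum∼ U.relation {⌊ k /2⌋} λ i →
      let n = suc (toℕ i) in
      S.*∼ (const∼ (X∼Y k n)) (S.*∼ (^∼ U.relation (k ∸ 2 ℕ.* n) u∼) (^∼ U.relation (2 ℕ.* n) w∼))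

    αα∼ : A.αα ≃ B.αα
    αα∼ = S.-∼ {A.const r A.* A.w A.^ 2} {B.const r′ B.* B.w B.^ 2}
      (S.*∼ {A.const r} {B.const r′} {A.w A.^ 2} {B.w B.^ 2} (const∼ r∼) (^∼ U.relation {A.w} {B.w} 2 w∼))

    γγ∼ : A.γγ ≃ B.γγ
    γγ∼ = S.*∼ {A.const _} {B.const _} {A.w A.^ 2} {B.w B.^ 2} (const∼ (+∼ 1∼ (-∼ r∼))) (^∼ U.relation {A.w} {B.w} 2 w∼)

    powerSums∼ : ∀ n → A.powerSums n ≃ B.powerSums n
    powerSums∼ n = S.+∼ {A.α.powerSum n} {B.α.powerSum n} {A.- A.γ.powerSum n} {B.- B.γ.powerSum n}
      (powerSum∼ U.relation {A.u} {A.αα} {B.u} {B.αα} u∼ αα∼ n)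
      (S.-∼ {A.γ.powerSum n} {B.γ.powerSum n} (powerSum∼ U.relation {A.u} {A.γγ} {B.u} {B.γγ} u∼ γγ∼ n))

    exponent∼ : ∀ {σ τ} → (∀ n 2≤n → σ n 2≤n ∼ τ n 2≤n) → A.exponent σ ≃ B.exponent τ
    exponent∼ {σ} {τ} σ∼τ = Σ∞∼ {A.exponentTerm σ} {B.exponentTerm τ}
      (λ i → A.order-mono (ℕₚ.m≤n+m i 2) (A.order-exponentTerm σ i))
      (λ i → B.order-mono (ℕₚ.m≤n+m i 2) (B.order-exponentTerm τ i))
      λ i → S.*∼ (const∼ (σ∼τ (2 ℕ.+ i) (ℕ.s≤s (ℕ.s≤s ℕ.z≤n)))) (powerSums∼ (2 ℕ.+ i))

    exp∼ : ∀ {f g} hf hg → f ≃ g → A.exp f hf ≃ B.exp g hg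
    exp∼ {f} {g} hf hg f∼g = Σ∞∼ {F f} {G g}
      (λ n → A.order-scale (A.const (ι (1/ n !))) (A.order-^ hf n))
      (λ n → B.order-scale (B.const (ι′ (1/ n !))) (B.order-^ hg n))
      λ n → S.*∼ (const∼ (ι∼ (1/ n !))) (^∼ U.relation n f∼g)
      where
      1/_! : ℕ → ℚ
      1/ n ! = (+ 1 / n !) {{n ℕₚ.!≢0}}
      F : A.Carrier → ℕ → A.Carrier
      F f n = A.const (ι (1/ n !)) A.* f A.^ n
      G : B.Carrier → ℕ → B.Carrier
      G g n = B.const (ι′ (1/ n !)) B.* g B.^ n

    -- The relation respects equality only on the side of `B`, so the identity in `B` yields a
    -- common partner of the two coefficients and not yet an equality in `A`.
    transfer : (∀ {x y y′} → x ∼ y → CommutativeRing._≈_ B y y′ → x ∼ y′) →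
      ∀ {X Y σ τ} → (∀ k n → X k n ∼ Y k n) → (∀ n 2≤n → σ n 2≤n ∼ τ n 2≤n) →
      B.1# B.+ B.generatingSeries Y B.≈ B.exp (B.exponent τ) (B.order-exponent τ) → ∀ h i j →
      ∃ λ y → ((A.1# A.+ A.generatingSeries X) i j ∼ y) ×
              (A.exp (A.exponent σ) h i j ∼ y)
    transfer respʳ {X} {Y} {σ} {τ} X∼Y σ∼τ identity h i j =
      B.exp (B.exponent τ) (B.order-exponent τ) i j ,
      respʳ (S.+∼ S.1∼ (generatingSeries∼ {X} {Y} X∼Y) i j) (identity i j) ,
      exp∼ h (B.order-exponent τ) (exponent∼ {σ} {τ} σ∼τ) i j

  module _ {ρ} (R : ℕ → RingRelation A B ρ)
           (ι∼ : ∀ M q → RingRelation._∼_ (R M) (ι q) (ι′ q)) (r∼ : ∀ M → RingRelation._∼_ (R M) r r′)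
           (respʳ : ∀ M {x y y′} → RingRelation._∼_ (R M) x y → CommutativeRing._≈_ B y y′ → RingRelation._∼_ (R M) x y′)
           (separating : ∀ {x x′} → (∀ M → ∃ λ y → RingRelation._∼_ (R M) x y × RingRelation._∼_ (R M) x′ y) →
                         CommutativeRing._≈_ A x x′) where

    -- A single `R M` sees one truncation only; `separating` says that all of them together detect
    -- equality in `A`.
    identity-from-relations : ∀ X σ {Y : ℕ → ℕ → ℕ → CommutativeRing.Carrier B}
      {τ : ℕ → (n : ℕ) → 2 ℕ.≤ n → CommutativeRing.Carrier B} →
      (∀ M k n → RingRelation._∼_ (R M) (X k n) (Y M k n)) →
      (∀ M n 2≤n → RingRelation._∼_ (R M) (σ n 2≤n) (τ M n 2≤n)) →
      (∀ M → B.1# B.+ B.generatingSeries (Y M) B.≈ B.exp (B.exponent (τ M)) (B.order-exponent (τ M))) →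
      ∀ {one series f} (h : A.Order≥ 1 f) → one ≡ A.1# → series ≡ A.generatingSeries X → f ≡ A.exponent σ →
      one A.+ series A.≈ A.exp f h
    identity-from-relations X σ {Y} {τ} X∼Y σ∼τ identity h ≡.refl ≡.refl ≡.refl i j = separating λ M →
      Related.transfer (R M) (ι∼ M) (r∼ M) (respʳ M) {X} {Y M} {σ} {τ M} (X∼Y M) (σ∼τ M) (identity M) h i j

-- Calculus of graded power series

-- What the differential argument needs from bivariate series: a separated filtration, sums of
-- families of growing order, and a derivation compatible with both. Coefficients and convolutions
-- stay behind this interface. In `order-θ⁻¹` the hypothesis of order 1 is there because θ kills
-- constants.
record GradedCalculus {c ℓ} (S : CommutativeRing c ℓ) (o : Level) : Set (c ⊔ ℓ ⊔ lsuc o) where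
  open CommutativeRing S
  field
    Order≥      : ℕ → Carrier → Set o
    order-resp  : ∀ {n f g} → f ≈ g → Order≥ n f → Order≥ n g
    order-mono  : ∀ {m n f} → m ℕ.≤ n → Order≥ n f → Order≥ m f
    order≥0     : ∀ {f} → Order≥ 0 f
    order-+     : ∀ {n f g} → Order≥ n f → Order≥ n g → Order≥ n (f + g)
    order-*     : ∀ {m n f g} → Order≥ m f → Order≥ n g → Order≥ (m ℕ.+ n) (f * g)
    separated   : ∀ {f} → (∀ n → Order≥ n f) → f ≈ 0#

    Σ∞          : (F : ℕ → Carrier) → (∀ n → Order≥ n (F n)) → Carrier
    Σ∞-cong     : ∀ {F G} hF hG → (∀ n → F n ≈ G n) → Σ∞ F hF ≈ Σ∞ G hG
    Σ∞-+        : ∀ {F G} hF hG hFG → Σ∞ (λ n → F n + G n) hFG ≈ Σ∞ F hF + Σ∞ G hG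
    Σ∞-*        : ∀ {F} g hF hgF → Σ∞ (λ n → g * F n) hgF ≈ g * Σ∞ F hF
    Σ∞-suc      : ∀ {F} hF hF′ → Σ∞ F hF ≈ F 0 + Σ∞ (F ∘ suc) hF′

    θ           : Carrier → Carrier
    θ-cong      : ∀ {f g} → f ≈ g → θ f ≈ θ g
    θ-+         : ∀ f g → θ (f + g) ≈ θ f + θ g
    θ-*         : ∀ f g → θ (f * g) ≈ θ f * g + f * θ g
    θ-Σ∞        : ∀ {F} hF hθF → θ (Σ∞ F hF) ≈ Σ∞ (θ ∘ F) hθF
    order-θ     : ∀ {n f} → Order≥ n f → Order≥ n (θ f)
    order-θ⁻¹   : ∀ {n f} → Order≥ 1 f → Order≥ n (θ f) → Order≥ n f

-- Bivariate series with the Euler operator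

module FiniteSum {c ℓ} (A : CommutativeRing c ℓ) where
  open CommutativeRing A hiding (zero)
  open PowerSeries A using (sum-zero)
  open Sum semiring using () renaming (sum to ∑)

  sum-extend : ∀ {m K} (t : ℕ → Carrier) → m ℕ.≤ K → (∀ n → m ℕ.≤ n → t n ≈ 0#) →
               ∑ {K} (t ∘ toℕ) ≈ ∑ {m} (t ∘ toℕ)
  sum-extend {K = K} t ℕ.z≤n h = sum-zero {K} (t ∘ toℕ) λ i → h (toℕ i) ℕ.z≤n
  sum-extend t (ℕ.s≤s m≤K) h = +-congˡ (sum-extend (t ∘ suc) m≤K λ n m≤n → h (suc n) (ℕ.s≤s m≤n))

-- θ multiplies the part of total degree n + 1 by n + 1, so this makes θ injective on series without
-- constant term.
TorsionFree : ∀ {c ℓ} → CommutativeRing c ℓ → Set (c ⊔ ℓ)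
TorsionFree A = ∀ n {x} → (suc n · 1#) * x ≈ 0# → x ≈ 0#
  where
  open CommutativeRing A
  open Mult semiring using () renaming (_×_ to _·_)

module BivariateCalculus {c ℓ} (A : CommutativeRing c ℓ) (ι : ℚ → CommutativeRing.Carrier A)
                         (torsionFree : TorsionFree A) where

  private module A = CommutativeRing A
  open Bivariate A ι hiding (zero)
  open Sum A.semiring using () renaming (sum to ∑)
  open Sum semiring using () renaming (sum to ∑∑; *-distribˡ-sum to distribˡ-∑∑)
  open FiniteSum A
  private
    module AS = Sum A.semiring
    module W = PowerSeries A
    module AM = Mult A.semiring
    open Sum (CommutativeRing.semiring W.seriesRing) using () renaming (sum to ∑W)
    nat : ℕ → A.Carrier
    nat n = n AM.× A.1#
    nat-+ : ∀ m n → nat (m ℕ.+ n) A.≈ nat m A.+ nat n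
    nat-+ = AM.×-homo-+ A.1#

  private
    ∑W-coeff : ∀ {n} (F : Vector (ℕ → A.Carrier) n) j → ∑W F j A.≈ ∑ (λ a → F a j)
    ∑W-coeff {zero}  F j = A.refl
    ∑W-coeff {suc n} F j = A.+-congˡ (∑W-coeff (F ∘ Fin.suc) j)

    ∑∑-coeff : ∀ {n} (F : Vector Carrier n) i j → ∑∑ F i j A.≈ ∑ (λ a → F a i j)
    ∑∑-coeff {zero}  F i j = A.refl
    ∑∑-coeff {suc n} F i j = A.+-congˡ (∑∑-coeff (F ∘ Fin.suc) i j)

    -- The complementary exponents are separate arguments: `convolution-cong` then replaces i and j
    -- by sums a + a′ and b + b′, and truncated subtraction disappears from the computations.
    convolution : (ℕ → ℕ → ℕ → ℕ → A.Carrier) → ℕ → ℕ → A.Carrier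
    convolution t i j = ∑ {suc i} λ a → ∑ {suc j} λ b → t (toℕ a) (toℕ b) (i ∸ toℕ a) (j ∸ toℕ b)

    convolution-cong : ∀ t t′ i j →
      (∀ a b a′ b′ → a ℕ.+ a′ ≡ i → b ℕ.+ b′ ≡ j → t a b a′ b′ A.≈ t′ a b a′ b′) →
      convolution t i j A.≈ convolution t′ i j
    convolution-cong t t′ i j h = AS.sum-cong-≋ {suc i} λ a → AS.sum-cong-≋ {suc j} λ b →
      h (toℕ a) (toℕ b) (i ∸ toℕ a) (j ∸ toℕ b)
        (ℕₚ.m+[n∸m]≡n (ℕₚ.≤-pred (Finₚ.toℕ<n a))) (ℕₚ.m+[n∸m]≡n (ℕₚ.≤-pred (Finₚ.toℕ<n b)))

    convolution-+ : ∀ t t′ i j →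
      convolution (λ a b a′ b′ → t a b a′ b′ A.+ t′ a b a′ b′) i j A.≈ convolution t i j A.+ convolution t′ i j
    convolution-+ t t′ i j = A.trans
      (AS.sum-cong-≋ {suc i} λ a → AS.∑-distrib-+ {suc j} (λ b → t (toℕ a) (toℕ b) (i ∸ toℕ a) (j ∸ toℕ b)) (λ b → t′ (toℕ a) (toℕ b) (i ∸ toℕ a) (j ∸ toℕ b)))
      (AS.∑-distrib-+ {suc i} (λ a → ∑ {suc j} λ b → t (toℕ a) (toℕ b) (i ∸ toℕ a) (j ∸ toℕ b)) (λ a → ∑ {suc j} λ b → t′ (toℕ a) (toℕ b) (i ∸ toℕ a) (j ∸ toℕ b)))

    convolution-scale : ∀ x t i j →
      x A.* convolution t i j A.≈ convolution (λ a b a′ b′ → x A.* t a b a′ b′) i j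
    convolution-scale x t i j = A.trans
      (AS.*-distribˡ-sum {suc i} x (λ a → ∑ {suc j} λ b → t (toℕ a) (toℕ b) (i ∸ toℕ a) (j ∸ toℕ b)))
      (AS.sum-cong-≋ {suc i} λ a → AS.*-distribˡ-sum {suc j} x (λ b → t (toℕ a) (toℕ b) (i ∸ toℕ a) (j ∸ toℕ b)))

    *-coeff : ∀ f g i j → (f * g) i j A.≈ convolution (λ a b a′ b′ → f a b A.* g a′ b′) i j
    *-coeff f g i j = ∑W-coeff {suc i} (λ a → f (toℕ a) W.⊛ g (i ∸ toℕ a)) j

  -- The number of terms in `Σ∞` varies with the coefficient. A cutoff K common to all coefficients
  -- involved turns it into a finite sum, to which the ring laws apply.
  Σ∞-partial : ∀ {F} hF K i j → i ℕ.+ j ℕ.< K → Σ∞ F hF i j A.≈ ∑∑ {K} (F ∘ toℕ) i j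
  Σ∞-partial {F} hF K i j i+j<K = A.sym (A.trans (∑∑-coeff {K} (F ∘ toℕ) i j)
    (sum-extend (λ n → F n i j) i+j<K λ n i+j<n → coeff≈0 (hF n) i j i+j<n))
    where open Order≥

  -- u ∂/∂u + w ∂/∂w
  θ : Carrier → Carrier
  θ f i j = nat (i ℕ.+ j) A.* f i j

  private
    -- Total degree is additive on products of monomials: the weight (a + a′) + (b + b′) regroups as
    -- (a + b) + (a′ + b′).
    θ-* : ∀ f g → θ (f * g) ≈ θ f * g + f * θ g
    θ-* f g i j = begin
      nat (i ℕ.+ j) A.* (f * g) i j
        ≈⟨ A.*-congˡ (*-coeff f g i j) ⟩
      nat (i ℕ.+ j) A.* convolution (λ a b a′ b′ → f a b A.* g a′ b′) i j
        ≈⟨ convolution-scale (nat (i ℕ.+ j)) (λ a b a′ b′ → f a b A.* g a′ b′) i j ⟩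
      convolution (λ a b a′ b′ → nat (i ℕ.+ j) A.* (f a b A.* g a′ b′)) i j
        ≈⟨ convolution-cong (λ a b a′ b′ → nat (i ℕ.+ j) A.* (f a b A.* g a′ b′))
             (λ a b a′ b′ → θ f a b A.* g a′ b′ A.+ f a b A.* θ g a′ b′) i j
             (λ { a b a′ b′ ≡.refl ≡.refl → term a b a′ b′ }) ⟩
      convolution (λ a b a′ b′ → θ f a b A.* g a′ b′ A.+ f a b A.* θ g a′ b′) i j
        ≈⟨ convolution-+ (λ a b a′ b′ → θ f a b A.* g a′ b′) (λ a b a′ b′ → f a b A.* θ g a′ b′) i j ⟩
      convolution (λ a b a′ b′ → θ f a b A.* g a′ b′) i j A.+ convolution (λ a b a′ b′ → f a b A.* θ g a′ b′) i j
        ≈⟨ A.+-cong (*-coeff (θ f) g i j) (*-coeff f (θ g) i j) ⟨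
      (θ f * g + f * θ g) i j ∎
      where
      open SetoidReasoning A.setoid
      open SemiringSolver A.commutativeSemiring using (solve; _:+_; _:*_; _:=_)
      term : ∀ a b a′ b′ → nat (a ℕ.+ a′ ℕ.+ (b ℕ.+ b′)) A.* (f a b A.* g a′ b′) A.≈
                           θ f a b A.* g a′ b′ A.+ f a b A.* θ g a′ b′
      term a b a′ b′ = begin
        nat (a ℕ.+ a′ ℕ.+ (b ℕ.+ b′)) A.* (f a b A.* g a′ b′)
          ≡⟨ ≡.cong (λ n → nat n A.* (f a b A.* g a′ b′)) (ℕ-interchange a a′ b b′) ⟩
        nat (a ℕ.+ b ℕ.+ (a′ ℕ.+ b′)) A.* (f a b A.* g a′ b′)
          ≈⟨ A.*-congʳ (nat-+ (a ℕ.+ b) (a′ ℕ.+ b′)) ⟩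
        (nat (a ℕ.+ b) A.+ nat (a′ ℕ.+ b′)) A.* (f a b A.* g a′ b′)
          ≈⟨ solve 4 (λ m n x y → (m :+ n) :* (x :* y) := m :* x :* y :+ x :* (n :* y)) A.refl
               (nat (a ℕ.+ b)) (nat (a′ ℕ.+ b′)) (f a b) (g a′ b′) ⟩
        θ f a b A.* g a′ b′ A.+ f a b A.* θ g a′ b′ ∎
        where
        open import Algebra.Properties.CommutativeSemigroup ℕₚ.+-commutativeSemigroup
          using () renaming (interchange to ℕ-interchange)

  calculus : GradedCalculus bivariateRing ℓ
  calculus = record
    { Order≥ = Order≥
    ; order-resp = λ f≈g (order h) → order λ i j lt → A.trans (A.sym (f≈g i j)) (h i j lt)
    ; order-mono = order-mono
    ; order≥0 = order≥0
    ; order-+ = order-+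
    ; order-* = order-*
    ; separated = λ h i j → Order≥.coeff≈0 (h (suc (i ℕ.+ j))) i j ℕₚ.≤-refl
    ; Σ∞ = Σ∞
    ; Σ∞-cong = λ _ _ F≈G i j → AS.sum-cong-≋ {suc (i ℕ.+ j)} λ n → F≈G (toℕ n) i j
    ; Σ∞-+ = λ {F} {G} _ _ _ i j →
        AS.∑-distrib-+ {suc (i ℕ.+ j)} (λ n → F (toℕ n) i j) (λ n → G (toℕ n) i j)
    ; Σ∞-* = λ {F} g hF hgF i j → let open SetoidReasoning A.setoid ; K = suc (i ℕ.+ j) in begin
        Σ∞ (λ n → g * F n) hgF i j              ≈⟨ Σ∞-partial hgF K i j ℕₚ.≤-refl ⟩
        ∑∑ {K} (λ n → g * F (toℕ n)) i j        ≈⟨ distribˡ-∑∑ {K} g (F ∘ toℕ) i j ⟨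
        (g * ∑∑ {K} (F ∘ toℕ)) i j              ≈⟨ *-coeff g (∑∑ {K} (F ∘ toℕ)) i j ⟩
        convolution (λ a b a′ b′ → g a b A.* ∑∑ {K} (F ∘ toℕ) a′ b′) i j
          ≈⟨ convolution-cong (λ a b a′ b′ → g a b A.* Σ∞ F hF a′ b′)
               (λ a b a′ b′ → g a b A.* ∑∑ {K} (F ∘ toℕ) a′ b′) i j
               (λ { a b a′ b′ ≡.refl ≡.refl → A.*-congˡ (Σ∞-partial hF K a′ b′
               (ℕ.s≤s (ℕₚ.+-mono-≤ (ℕₚ.m≤n+m a′ a) (ℕₚ.m≤n+m b′ b)))) }) ⟨
        convolution (λ a b a′ b′ → g a b A.* Σ∞ F hF a′ b′) i j ≈⟨ *-coeff g (Σ∞ F hF) i j ⟨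
        (g * Σ∞ F hF) i j ∎
    ; Σ∞-suc = λ {F} hF hF′ i j → A.trans (Σ∞-partial hF (suc (suc (i ℕ.+ j))) i j (ℕₚ.n≤1+n _))
        (A.+-congˡ (A.sym (Σ∞-partial hF′ (suc (i ℕ.+ j)) i j ℕₚ.≤-refl)))
    ; θ = θ
    ; θ-cong = λ f≈g i j → A.*-congˡ (f≈g i j)
    ; θ-+ = λ f g i j → A.distribˡ (nat (i ℕ.+ j)) (f i j) (g i j)
    ; θ-* = θ-*
    ; θ-Σ∞ = λ {F} _ _ i j → AS.*-distribˡ-sum {suc (i ℕ.+ j)} (nat (i ℕ.+ j)) (λ n → F (toℕ n) i j)
    ; order-θ = λ (order h) → order λ i j lt → A.trans (A.*-congˡ (h i j lt)) (A.zeroʳ _)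
    -- The constant term, invisible to θ, is covered by `h₁`; in positive degree the factor i + j is
    -- cancelled.
    ; order-θ⁻¹ = λ (order h₁) (order h) → order λ
        { zero zero lt → h₁ 0 0 (ℕ.s≤s ℕ.z≤n)
        ; (suc i) j lt → torsionFree (i ℕ.+ j) (h (suc i) j lt)
        ; zero (suc j) lt → torsionFree j (h zero (suc j) lt) }
    }

-- Differential equation, power sums and the product formula

module FormalCalculus {c ℓ o} {S : CommutativeRing c ℓ} (calculus : GradedCalculus S o) where
  open CommutativeRing S hiding (zero)
  open GradedCalculus calculus
  open RingProperties ring
  open Exp semiring using (_^_)
  open Mult semiring using () renaming (_×_ to _·_)
  open SemiringSolver commutativeSemiring
  open SetoidReasoning setoid

  order-neg : ∀ {n f} → Order≥ n f → Order≥ n (- f)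
  order-neg {f = f} h = order-resp (-1*x≈-x f) (order-* {0} order≥0 h)

  -- Each substitution of g f for f raises the known order by one, and the filtration is separated.
  contraction-zero : ∀ {g f} → Order≥ 1 g → f ≈ g * f → f ≈ 0#
  contraction-zero {g} {f} hg f≈gf = separated λ n → go n
    where
    go : ∀ n → Order≥ n f
    go zero    = order≥0
    go (suc n) = order-resp (sym f≈gf) (order-* hg (go n))

  -- The difference z satisfies z = -d z and is zero by contraction, so no inverse of 1 + d has to
  -- be constructed.
  1+-cancelˡ : ∀ {d f g} → Order≥ 1 d → (1# + d) * f ≈ (1# + d) * g → f ≈ g
  1+-cancelˡ {d} {f} {g} hd eq = x∙y⁻¹≈ε⇒x≈y f g (contraction-zero (order-neg hd) (begin
    z                       ≈⟨ +-identityʳ z ⟨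
    z + 0#                  ≈⟨ +-congˡ (trans (*-congʳ (-‿inverseʳ d)) (zeroˡ z)) ⟨
    z + (d + - d) * z       ≈⟨ solve 3 (λ z d e → z :+ (d :+ e) :* z := (con 1 :+ d) :* z :+ e :* z) refl z d (- d) ⟩
    (1# + d) * z + - d * z  ≈⟨ +-congʳ (trans (x[y-z]≈xy-xz (1# + d) f g) (x≈y⇒x∙y⁻¹≈ε eq)) ⟩
    0# + - d * z            ≈⟨ +-identityˡ _ ⟩
    - d * z                 ∎))
    where
    z = f - g

  θ-zero : θ 0# ≈ 0#
  θ-zero = x+x≈x⇒x≈0 (θ 0#) (trans (sym (θ-+ 0# 0#)) (θ-cong (+-identityˡ 0#)))

  θ-one : θ 1# ≈ 0#
  θ-one = x+x≈x⇒x≈0 (θ 1#) (begin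
    θ 1# + θ 1#           ≈⟨ solve 1 (λ x → x :+ x := x :* con 1 :+ con 1 :* x) refl (θ 1#) ⟩
    θ 1# * 1# + 1# * θ 1# ≈⟨ θ-* 1# 1# ⟨
    θ (1# * 1#)           ≈⟨ θ-cong (*-identityˡ 1#) ⟩
    θ 1#                  ∎)

  θ-neg : ∀ f → θ (- f) ≈ - θ f
  θ-neg f = +-cancelˡ (θ f) (θ (- f)) (- θ f) (begin
    θ f + θ (- f)  ≈⟨ θ-+ f (- f) ⟨
    θ (f + - f)    ≈⟨ θ-cong (-‿inverseʳ f) ⟩
    θ 0#           ≈⟨ θ-zero ⟩
    0#             ≈⟨ -‿inverseʳ (θ f) ⟨
    θ f + - θ f    ∎)

  θ-constant* : ∀ {κ} → θ κ ≈ 0# → ∀ f → θ (κ * f) ≈ κ * θ f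
  θ-constant* {κ} θκ f = begin
    θ (κ * f)           ≈⟨ θ-* κ f ⟩
    θ κ * f + κ * θ f   ≈⟨ +-congʳ (trans (*-congʳ θκ) (zeroˡ f)) ⟩
    0# + κ * θ f        ≈⟨ +-identityˡ _ ⟩
    κ * θ f             ∎

  -- The difference z satisfies θz = Lz. Order n of z gives order n + 1 of Lz, hence of θz, hence of
  -- z, because the constant term of z is zero.
  ode-unique : ∀ {L f g} → Order≥ 1 L → Order≥ 1 (f - g) → θ f ≈ L * f → θ g ≈ L * g → f ≈ g
  ode-unique {L} {f} {g} hL h₁ θf θg = x∙y⁻¹≈ε⇒x≈y f g (separated go)
    where
    θz : θ (f - g) ≈ L * (f - g)
    θz = begin
      θ (f - g)       ≈⟨ trans (θ-+ f (- g)) (+-cong θf (trans (θ-neg g) (-‿cong θg))) ⟩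
      L * f - L * g   ≈⟨ x[y-z]≈xy-xz L f g ⟨
      L * (f - g)     ∎
    go : ∀ n → Order≥ n (f - g)
    go zero    = order≥0
    go (suc n) = order-θ⁻¹ h₁ (order-resp (sym θz) (order-* hL (go n)))

  Σ∞-zero : ∀ {F} hF → (∀ n → F n ≈ 0#) → Σ∞ F hF ≈ 0#
  Σ∞-zero {F} hF F≈0 = begin
    Σ∞ F hF                   ≈⟨ Σ∞-cong hF h0F (λ n → trans (F≈0 n) (sym (zeroˡ (F n)))) ⟩
    Σ∞ (λ n → 0# * F n) h0F   ≈⟨ Σ∞-* 0# hF h0F ⟩
    0# * Σ∞ F hF              ≈⟨ zeroˡ _ ⟩
    0#                        ∎
    where
    h0F : ∀ n → Order≥ n (0# * F n)
    h0F n = order-* {0} order≥0 (hF n)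

  θ-^ : ∀ f n → θ (f ^ suc n) ≈ (suc n · 1#) * (f ^ n * θ f)
  θ-^ f zero    = trans (θ-cong (*-identityʳ f)) (solve 1 (λ x → x := (con 1 :+ con 0) :* (con 1 :* x)) refl (θ f))
  θ-^ f (suc n) = begin
    θ (f * f ^ suc n)                      ≈⟨ θ-* f (f ^ suc n) ⟩
    θ f * f ^ suc n + f * θ (f ^ suc n)    ≈⟨ +-congˡ (*-congˡ (θ-^ f n)) ⟩
    θ f * (f * f ^ n) + f * ((1# + n · 1#) * (f ^ n * θ f))
      ≈⟨ solve 4 (λ t x y m → t :* (x :* y) :+ x :* ((con 1 :+ m) :* (y :* t)) := (con 1 :+ (con 1 :+ m)) :* (x :* y :* t))
           refl (θ f) f (f ^ n) (n · 1#) ⟩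
    (suc (suc n) · 1#) * (f ^ suc n * θ f) ∎

  -- `κ n` stands for 1/n!, which enters through its recurrence. The term n = 0 is killed by θ, and
  -- the others shift down by one.
  θ-exp : ∀ (κ : ℕ → Carrier) f → (∀ n → θ (κ n) ≈ 0#) → (∀ n → κ (suc n) * (suc n · 1#) ≈ κ n) →
          ∀ h → θ (Σ∞ (λ n → κ n * f ^ n) h) ≈ θ f * Σ∞ (λ n → κ n * f ^ n) h
  θ-exp κ f θκ κ-step h = begin
    θ (Σ∞ e h)                    ≈⟨ θ-Σ∞ h hθ ⟩
    Σ∞ (θ ∘ e) hθ                 ≈⟨ Σ∞-suc hθ hθ′ ⟩
    θ (e 0) + Σ∞ (θ ∘ e ∘ suc) hθ′ ≈⟨ +-cong θe₀ (Σ∞-cong hθ′ h′ θe) ⟩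
    0# + Σ∞ (λ n → θ f * e n) h′  ≈⟨ +-identityˡ _ ⟩
    Σ∞ (λ n → θ f * e n) h′       ≈⟨ Σ∞-* (θ f) h h′ ⟩
    θ f * Σ∞ e h                  ∎
    where
    e : ℕ → Carrier
    e n = κ n * f ^ n
    hθ : ∀ n → Order≥ n (θ (e n))
    hθ n = order-θ (h n)
    hθ′ : ∀ n → Order≥ n (θ (e (suc n)))
    hθ′ n = order-mono (ℕₚ.n≤1+n n) (hθ (suc n))
    h′ : ∀ n → Order≥ n (θ f * e n)
    h′ n = order-* {0} order≥0 (h n)
    θe₀ : θ (e 0) ≈ 0#
    θe₀ = trans (θ-constant* (θκ 0) 1#) (trans (*-congˡ θ-one) (zeroʳ (κ 0)))
    θe : ∀ n → θ (e (suc n)) ≈ θ f * e n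
    θe n = begin
      θ (κ (suc n) * f ^ suc n)                       ≈⟨ θ-constant* (θκ (suc n)) (f ^ suc n) ⟩
      κ (suc n) * θ (f ^ suc n)                       ≈⟨ *-congˡ (θ-^ f n) ⟩
      κ (suc n) * ((suc n · 1#) * (f ^ n * θ f))      ≈⟨ solve 4 (λ k m x t → k :* (m :* (x :* t)) := t :* (k :* m :* x)) refl (κ (suc n)) (suc n · 1#) (f ^ n) (θ f) ⟩
      θ f * (κ (suc n) * (suc n · 1#) * f ^ n)        ≈⟨ *-congˡ (*-congʳ (κ-step n)) ⟩
      θ f * (κ n * f ^ n)                             ∎

  module PowerSums (e₁ e₂ : Carrier) where
    open Splitting S e₁ e₂ using (powerSum; _^ₑ_; α₁; α₂)

    powerSum-1 : powerSum 1 ≈ e₁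
    powerSum-1 = solve 4 (λ s q z n → (con 0 :* con 1 :+ q :* (con 1 :* con 0)) :+ (s :* con 1 :+ q :* (n :* con 0)) := s)
      refl e₁ (- e₂) 0# (- 1#)

    -- Newton's recurrence: both roots satisfy T² = e₁ T - e₂.
    powerSum-step : ∀ n → powerSum (suc (suc n)) + e₂ * powerSum n ≈ e₁ * powerSum (suc n)
    powerSum-step n = begin
      powerSum (suc (suc n)) + e₂ * (a + a′)
        -- The solver works over semirings, so -e₂ and -1 are the atoms q and m, and each
        -- cancellation is left as an explicit factor: q + e, m m q + e and 1 + m all vanish.
        ≈⟨ solve 8 (λ s q a b a′ b′ m e →
             (con 0 :* (con 0 :* a :+ q :* (con 1 :* b)) :+ q :* (con 1 :* (con 0 :* b :+ con 1 :* a :+ s :* (con 1 :* b))))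
             :+ (s :* (s :* a′ :+ q :* (m :* b′)) :+ q :* (m :* (s :* b′ :+ m :* a′ :+ s :* (m :* b′))))
             :+ e :* (a :+ a′)
             := s :* ((con 0 :* a :+ q :* (con 1 :* b)) :+ (s :* a′ :+ q :* (m :* b′)))
                :+ (q :+ e) :* a :+ (m :* m :* q :+ e) :* a′ :+ (con 1 :+ m) :* (q :* m :* s :* b′))
           refl e₁ (- e₂) a b a′ b′ (- 1#) e₂ ⟩
      e₁ * powerSum (suc n) + (- e₂ + e₂) * a + (- 1# * - 1# * - e₂ + e₂) * a′ + (1# + - 1#) * (- e₂ * - 1# * e₁ * b′)
        ≈⟨ +-cong (+-cong (+-congˡ (zeroˡ′ (-‿inverseˡ e₂)))
             (zeroˡ′ (trans (+-congʳ (trans (*-congʳ (trans (-1*x≈-x (- 1#)) (-‿involutive 1#))) (*-identityˡ (- e₂)))) (-‿inverseˡ e₂))))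
             (zeroˡ′ (-‿inverseʳ 1#)) ⟩
      e₁ * powerSum (suc n) + 0# + 0# + 0# ≈⟨ trans (+-identityʳ _) (trans (+-identityʳ _) (+-identityʳ _)) ⟩
      e₁ * powerSum (suc n) ∎
      where
      a b a′ b′ : Carrier
      a = proj₁ (α₁ ^ₑ n)
      b = proj₂ (α₁ ^ₑ n)
      a′ = proj₁ (α₂ ^ₑ n)
      b′ = proj₂ (α₂ ^ₑ n)
      zeroˡ′ : ∀ {x y} → x ≈ 0# → x * y ≈ 0#
      zeroˡ′ {y = y} x≈0 = trans (*-congʳ x≈0) (zeroˡ y)

    -- Euler's formula: with e₁ of degree 1 and e₂ of degree 2, the n-th power sum is homogeneous of
    -- degree n. The induction carries two consecutive values, as Newton's recurrence requires.
    θ-powerSum : θ e₁ ≈ e₁ → θ e₂ ≈ e₂ + e₂ → ∀ n → θ (powerSum n) ≈ (n · 1#) * powerSum n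
    θ-powerSum θe₁ θe₂ n = proj₁ (go n)
      where
      P : ℕ → Carrier
      P = powerSum
      go : ∀ n → θ (P n) ≈ (n · 1#) * P n × θ (P (suc n)) ≈ (suc n · 1#) * P (suc n)
      go zero =
        trans (θ-+ 1# 1#) (trans (+-cong θ-one θ-one) (trans (+-identityˡ 0#) (sym (zeroˡ _)))) ,
        (begin
          θ (P 1)        ≈⟨ θ-cong powerSum-1 ⟩
          θ e₁           ≈⟨ θe₁ ⟩
          e₁             ≈⟨ powerSum-1 ⟨
          P 1            ≈⟨ trans (*-congʳ (+-identityʳ 1#)) (*-identityˡ _) ⟨
          (1 · 1#) * P 1 ∎)
      -- Adding m e₂ pₙ to both sides allows the recurrence to be used without subtraction; m = n +
      -- 2 is also n plus the degree of e₂.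
      go (suc n) = proj₂ (go n) , +-cancelʳ (m * (e₂ * P n)) _ _ (begin
        θ (P (suc (suc n))) + m * (e₂ * P n)
          ≈⟨ +-congˡ (solve 3 (λ k e p → (con 1 :+ (con 1 :+ k)) :* (e :* p) := (e :+ e) :* p :+ e :* (k :* p)) refl (n · 1#) e₂ (P n)) ⟩
        θ (P (suc (suc n))) + ((e₂ + e₂) * P n + e₂ * ((n · 1#) * P n))
          ≈⟨ +-congˡ (+-cong (*-congʳ θe₂) (*-congˡ (proj₁ (go n)))) ⟨
        θ (P (suc (suc n))) + (θ e₂ * P n + e₂ * θ (P n))   ≈⟨ +-congˡ (θ-* e₂ (P n)) ⟨
        θ (P (suc (suc n))) + θ (e₂ * P n)                  ≈⟨ θ-+ _ _ ⟨
        θ (P (suc (suc n)) + e₂ * P n)                      ≈⟨ θ-cong (powerSum-step n) ⟩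
        θ (e₁ * P (suc n))                                  ≈⟨ θ-* e₁ (P (suc n)) ⟩
        θ e₁ * P (suc n) + e₁ * θ (P (suc n))               ≈⟨ +-cong (*-congʳ θe₁) (*-congˡ (proj₂ (go n))) ⟩
        e₁ * P (suc n) + e₁ * ((suc n · 1#) * P (suc n))
          ≈⟨ solve 3 (λ k e p → e :* p :+ e :* ((con 1 :+ k) :* p) := (con 1 :+ (con 1 :+ k)) :* (e :* p)) refl (n · 1#) e₁ (P (suc n)) ⟩
        m * (e₁ * P (suc n))                                ≈⟨ *-congˡ (powerSum-step n) ⟨
        m * (P (suc (suc n)) + e₂ * P n)                    ≈⟨ distribˡ m _ _ ⟩
        m * P (suc (suc n)) + m * (e₂ * P n)                ∎)
        where m = suc (suc n) · 1#

    -- (1 − κ e₁ + κ² e₂) Σ κⁿ (α₁ⁿ + α₂ⁿ) = 2 − κ e₁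
    powerSum-series : ∀ {κ v a} → v + κ * e₁ ≈ 0# → a ≈ κ * κ * e₂ → ∀ h →
      (1# + (v + a)) * Σ∞ (λ n → κ ^ n * powerSum n) h ≈ 1# + 1# + v
    powerSum-series {κ} {v} {a} v≈ a≈ h = begin
      (1# + (v + a)) * Q                       ≈⟨ solve 3 (λ q v a → (con 1 :+ (v :+ a)) :* q := q :+ v :* q :+ a :* q) refl Q v a ⟩
      Q + v * Q + a * Q                        ≈⟨ +-congʳ (+-cong (trans Q≈ (+-congˡ Q₁≈)) (*-congˡ Q≈)) ⟩
      s 0 + (s 1 + Q₂) + v * (s 0 + Q₁) + a * Q
        ≈⟨ solve 7 (λ s₀ s₁ q₂ v q₁ a q → s₀ :+ (s₁ :+ q₂) :+ v :* (s₀ :+ q₁) :+ a :* q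
                := s₀ :+ s₁ :+ v :* s₀ :+ (q₂ :+ (v :* q₁ :+ a :* q))) refl (s 0) (s 1) Q₂ v Q₁ a Q ⟩
      s 0 + s 1 + v * s 0 + (Q₂ + (v * Q₁ + a * Q)) ≈⟨ +-cong (+-congʳ (+-congˡ (*-congˡ powerSum-1))) tail≈0 ⟩
      1# * (1# + 1#) + κ * 1# * e₁ + v * (1# * (1# + 1#)) + 0#
        ≈⟨ solve 3 (λ k e v → con 1 :* (con 1 :+ con 1) :+ k :* con 1 :* e :+ v :* (con 1 :* (con 1 :+ con 1)) :+ con 0
                := con 1 :+ con 1 :+ v :+ (v :+ k :* e)) refl κ e₁ v ⟩
      1# + 1# + v + (v + κ * e₁)               ≈⟨ +-congˡ v≈ ⟩
      1# + 1# + v + 0#                         ≈⟨ +-identityʳ _ ⟩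
      1# + 1# + v                              ∎
      where
      s : ℕ → Carrier
      s n = κ ^ n * powerSum n
      h₁ : ∀ n → Order≥ n (s (suc n))
      h₁ n = order-mono (ℕₚ.n≤1+n n) (h (suc n))
      h₂ : ∀ n → Order≥ n (s (suc (suc n)))
      h₂ n = order-mono (ℕₚ.n≤1+n n) (h₁ (suc n))
      Q = Σ∞ s h
      Q₁ = Σ∞ (s ∘ suc) h₁
      Q₂ = Σ∞ (s ∘ suc ∘ suc) h₂
      Q≈ : Q ≈ s 0 + Q₁
      Q≈ = Σ∞-suc h h₁
      Q₁≈ : Q₁ ≈ s 1 + Q₂
      Q₁≈ = Σ∞-suc h₁ h₂
      -- Newton's recurrence times κⁿ⁺² kills every coefficient of the product but the first two,
      -- and these add up to 2 + κ e₁ - 2 κ e₁.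
      recurrence : ∀ n → s (suc (suc n)) + (v * s (suc n) + a * s n) ≈ 0#
      recurrence n = begin
        κ * (κ * k) * P₂ + (v * (κ * k * P₁) + a * (k * P₀))
          ≈⟨ +-congˡ (+-congˡ (*-congʳ a≈)) ⟩
        κ * (κ * k) * P₂ + (v * (κ * k * P₁) + κ * κ * e₂ * (k * P₀))
          ≈⟨ solve 7 (λ κ k p₂ v p₁ e p₀ → κ :* (κ :* k) :* p₂ :+ (v :* (κ :* k :* p₁) :+ κ :* κ :* e :* (k :* p₀))
                  := κ :* κ :* k :* (p₂ :+ e :* p₀) :+ v :* (κ :* k :* p₁)) refl κ k P₂ v P₁ e₂ P₀ ⟩
        κ * κ * k * (P₂ + e₂ * P₀) + v * (κ * k * P₁) ≈⟨ +-congʳ (*-congˡ (powerSum-step n)) ⟩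
        κ * κ * k * (e₁ * P₁) + v * (κ * k * P₁)
          ≈⟨ solve 5 (λ κ k e p v → κ :* κ :* k :* (e :* p) :+ v :* (κ :* k :* p) := (v :+ κ :* e) :* (κ :* k :* p)) refl κ k e₁ P₁ v ⟩
        (v + κ * e₁) * (κ * k * P₁)                  ≈⟨ *-congʳ v≈ ⟩
        0# * (κ * k * P₁)                            ≈⟨ zeroˡ _ ⟩
        0#                                           ∎
        where
        k = κ ^ n
        P₀ = powerSum n
        P₁ = powerSum (suc n)
        P₂ = powerSum (suc (suc n))
      tail≈0 : Q₂ + (v * Q₁ + a * Q) ≈ 0#
      tail≈0 = begin
        Q₂ + (v * Q₁ + a * Q)         ≈⟨ +-congˡ (+-cong (Σ∞-* v h₁ hv) (Σ∞-* a h ha)) ⟨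
        Q₂ + (Σ∞ (λ n → v * s (suc n)) hv + Σ∞ (λ n → a * s n) ha) ≈⟨ +-congˡ (Σ∞-+ hv ha hva) ⟨
        Q₂ + Σ∞ (λ n → v * s (suc n) + a * s n) hva ≈⟨ Σ∞-+ h₂ hva hs ⟨
        Σ∞ (λ n → s (suc (suc n)) + (v * s (suc n) + a * s n)) hs ≈⟨ Σ∞-zero hs recurrence ⟩
        0#                            ∎
        where
        hv : ∀ n → Order≥ n (v * s (suc n))
        hv n = order-* {0} order≥0 (h₁ n)
        ha : ∀ n → Order≥ n (a * s n)
        ha n = order-* {0} order≥0 (h n)
        hva : ∀ n → Order≥ n (v * s (suc n) + a * s n)
        hva n = order-+ (hv n) (ha n)
        hs : ∀ n → Order≥ n (s (suc (suc n)) + (v * s (suc n) + a * s n))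
        hs n = order-+ (h₂ n) (hva n)

  -- G′ = G E/D, and D Q = E R = 2 + v says that θD/D = 2 − Q and θE/E = 2 − R.
  logarithmic-step : ∀ {G G′ L L′ D E Q R v} →
    (∀ {f g} → D * f ≈ D * g → f ≈ g) →
    G′ * D ≈ G * E → θ G ≈ L * G →
    D * Q ≈ 1# + 1# + v → E * R ≈ 1# + 1# + v →
    θ D + (1# + 1# + v) ≈ D + D → θ E + (1# + 1# + v) ≈ E + E →
    L′ + R ≈ L + Q → θ G′ ≈ L′ * G′
  logarithmic-step {G} {G′} {L} {L′} {D} {E} {Q} {R} {v} D-cancel G′D≈GE θG DQ ER θD θE L′R =
    -- The added terms replace subtractions: G(E + E) equals G′(D + D), hence G′(θD + t), which
    -- completes (θG′)D to the derivative of G′D = GE; after the product rule, G(θE + t) restores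
    -- G(E + E).
    +-cancelʳ (G′ * R) _ _ (D-cancel (+-cancelʳ (G * (E + E)) _ _ (begin
      D * (θ G′ + G′ * R) + G * (E + E)
        ≈⟨ solve 5 (λ d t g r h → d :* (t :+ g :* r) :+ h := t :* d :+ (g :* d) :* r :+ h) refl D (θ G′) G′ R (G * (E + E)) ⟩
      θ G′ * D + G′ * D * R + G * (E + E)
        ≈⟨ +-congʳ (+-congˡ (trans (*-congʳ G′D≈GE) (trans (*-assoc G E R) (*-congˡ ER)))) ⟩
      θ G′ * D + G * t + G * (E + E)
        ≈⟨ +-congˡ (trans (solve 2 (λ g e → g :* (e :+ e) := g :* e :+ g :* e) refl G E)
             (trans (+-cong (sym G′D≈GE) (sym G′D≈GE)) (solve 2 (λ g d → g :* d :+ g :* d := g :* (d :+ d)) refl G′ D))) ⟩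
      θ G′ * D + G * t + G′ * (D + D)
        ≈⟨ +-congˡ (*-congˡ θD) ⟨
      θ G′ * D + G * t + G′ * (θ D + t)
        ≈⟨ solve 6 (λ x d g t h y → x :* d :+ g :* t :+ h :* (y :+ t) := (x :* d :+ h :* y) :+ g :* t :+ h :* t) refl (θ G′) D G t G′ (θ D) ⟩
      (θ G′ * D + G′ * θ D) + G * t + G′ * t
        ≈⟨ +-congʳ (+-congʳ (trans (sym (θ-* G′ D)) (trans (θ-cong G′D≈GE) (θ-* G E)))) ⟩
      (θ G * E + G * θ E) + G * t + G′ * t
        ≈⟨ solve 6 (λ x e g y t h → (x :* e :+ g :* y) :+ g :* t :+ h :* t := x :* e :+ h :* t :+ g :* (y :+ t)) refl (θ G) E G (θ E) t G′ ⟩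
      θ G * E + G′ * t + G * (θ E + t)
        ≈⟨ +-cong (+-cong (trans (*-congʳ θG) (trans (*-assoc L G E) (*-congˡ (sym G′D≈GE)))) (*-congˡ (sym DQ))) (*-congˡ θE) ⟩
      L * (G′ * D) + G′ * (D * Q) + G * (E + E)
        ≈⟨ +-congʳ (solve 4 (λ l g d q → l :* (g :* d) :+ g :* (d :* q) := d :* ((l :+ q) :* g)) refl L G′ D Q) ⟩
      D * ((L + Q) * G′) + G * (E + E)
        ≈⟨ +-congʳ (*-congˡ (*-congʳ L′R)) ⟨
      D * ((L′ + R) * G′) + G * (E + E)
        ≈⟨ +-congʳ (*-congˡ (solve 3 (λ l r g → (l :+ r) :* g := l :* g :+ g :* r) refl L′ R G′)) ⟩
      D * (L′ * G′ + G′ * R) + G * (E + E) ∎)))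
    where t = 1# + 1# + v

  -- This is L′ - L = Q - R with R moved across: the new summand κⁿ of each truncated t-value
  -- contributes Σ κⁿ(pₙ - qₙ) to the logarithmic derivative.
  Σ∞-step : ∀ {t t′ p q : ℕ → Carrier} {κ} → (∀ n → t′ n ≈ t n + κ ^ n) → ∀ h′ hq h hp →
    Σ∞ (λ n → t′ n * (p n - q n)) h′ + Σ∞ (λ n → κ ^ n * q n) hq ≈
    Σ∞ (λ n → t n * (p n - q n)) h + Σ∞ (λ n → κ ^ n * p n) hp
  Σ∞-step {t} {t′} {p} {q} {κ} t′≈ h′ hq h hp = begin
    Σ∞ (λ n → t′ n * (p n - q n)) h′ + Σ∞ (λ n → κ ^ n * q n) hq   ≈⟨ Σ∞-+ h′ hq hl ⟨
    Σ∞ (λ n → t′ n * (p n - q n) + κ ^ n * q n) hl                 ≈⟨ Σ∞-cong hl hr term ⟩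
    Σ∞ (λ n → t n * (p n - q n) + κ ^ n * p n) hr                  ≈⟨ Σ∞-+ h hp hr ⟩
    Σ∞ (λ n → t n * (p n - q n)) h + Σ∞ (λ n → κ ^ n * p n) hp     ∎
    where
    hl : ∀ n → Order≥ n (t′ n * (p n - q n) + κ ^ n * q n)
    hl n = order-+ (h′ n) (hq n)
    hr : ∀ n → Order≥ n (t n * (p n - q n) + κ ^ n * p n)
    hr n = order-+ (h n) (hp n)
    term : ∀ n → t′ n * (p n - q n) + κ ^ n * q n ≈ t n * (p n - q n) + κ ^ n * p n
    term n = begin
      t′ n * (p n - q n) + κ ^ n * q n            ≈⟨ +-congʳ (*-congʳ (t′≈ n)) ⟩
      (t n + κ ^ n) * (p n - q n) + κ ^ n * q n
        ≈⟨ solve 5 (λ t k p q m → (t :+ k) :* (p :+ m) :+ k :* q := t :* (p :+ m) :+ k :* p :+ k :* (m :+ q)) refl (t n) (κ ^ n) (p n) (q n) (- q n) ⟩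
      t n * (p n - q n) + κ ^ n * p n + κ ^ n * (- q n + q n) ≈⟨ +-congˡ (trans (*-congˡ (-‿inverseˡ (q n))) (zeroʳ _)) ⟩
      t n * (p n - q n) + κ ^ n * p n + 0#        ≈⟨ +-identityʳ _ ⟩
      t n * (p n - q n) + κ ^ n * p n             ∎

  -- Since a = -yρ, the equation for H reads H(1 + v + a) = yG. Adding G(1 + v + a) leaves G(1 + v +
  -- a + y), and a + y = b.
  kernel-identity : ∀ {G G′ H v a b y ρ} → G′ ≈ G + H → H + v * H ≈ y * (G + ρ * H) →
    a + y * ρ ≈ 0# → b ≈ a + y → G′ * (1# + (v + a)) ≈ G * (1# + (v + b))
  kernel-identity {G} {G′} {H} {v} {a} {b} {y} {ρ} G′≈ H≈ a≈ b≈ = begin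
    G′ * (1# + (v + a))       ≈⟨ *-congʳ G′≈ ⟩
    (G + H) * (1# + (v + a))
      ≈⟨ solve 4 (λ g h v a → (g :+ h) :* (con 1 :+ (v :+ a)) := g :* (con 1 :+ (v :+ a)) :+ (h :+ v :* h) :+ a :* h) refl G H v a ⟩
    G * (1# + (v + a)) + (H + v * H) + a * H ≈⟨ +-congʳ (+-congˡ H≈) ⟩
    G * (1# + (v + a)) + y * (G + ρ * H) + a * H
      ≈⟨ solve 6 (λ g h v a y r → g :* (con 1 :+ (v :+ a)) :+ y :* (g :+ r :* h) :+ a :* h
           := g :* (con 1 :+ (v :+ (a :+ y))) :+ (a :+ y :* r) :* h) refl G H v a y ρ ⟩
    G * (1# + (v + (a + y))) + (a + y * ρ) * H ≈⟨ +-cong (*-congˡ (+-congˡ (+-congˡ (sym b≈)))) (trans (*-congʳ a≈) (zeroˡ H)) ⟩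
    G * (1# + (v + b)) + 0#   ≈⟨ +-identityʳ _ ⟩
    G * (1# + (v + b))        ∎

  -- The terms 1, v, a are homogeneous of degrees 0, 1, 2, so 2 - θ multiplies them by 2, 1, 0.
  θ-quadratic : ∀ {v a} → θ v ≈ v → θ a ≈ a + a →
    θ (1# + (v + a)) + (1# + 1# + v) ≈ (1# + (v + a)) + (1# + (v + a))
  θ-quadratic {v} {a} θv θa = begin
    θ (1# + (v + a)) + (1# + 1# + v)
      ≈⟨ +-congʳ (trans (θ-+ 1# (v + a)) (+-cong θ-one (trans (θ-+ v a) (+-cong θv θa)))) ⟩
    0# + (v + (a + a)) + (1# + 1# + v)
      ≈⟨ solve 2 (λ v a → con 0 :+ (v :+ (a :+ a)) :+ (con 1 :+ con 1 :+ v) := (con 1 :+ (v :+ a)) :+ (con 1 :+ (v :+ a))) refl v a ⟩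
    (1# + (v + a)) + (1# + (v + a)) ∎

  θ-square : ∀ {f} → θ f ≈ f → θ (f ^ 2) ≈ f ^ 2 + f ^ 2
  θ-square {f} θf = begin
    θ (f * (f * 1#))             ≈⟨ θ-* f (f * 1#) ⟩
    θ f * (f * 1#) + f * θ (f * 1#) ≈⟨ +-cong (*-congʳ θf) (*-congˡ (trans (θ-cong (*-identityʳ f)) (trans θf (sym (*-identityʳ f))))) ⟩
    f * (f * 1#) + f * (f * 1#)  ∎

  -- In the application `e₁` is u, `α` and `γ` are the products α₁α₂ and γ₁γ₂, `ω` is w², `ρ` is r
  -- and `κ M` is 1/(M + 1). `t M n` is the truncation of the depth-one t-value, `G M` the truncated
  -- generating series, and `H M` its increment whenever M + 1 lies in the residue class.
  module ProductFormula
    (e₁ α γ ω ρ : Carrier)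
    (hα : ∀ n → Order≥ n (Splitting.powerSum S e₁ α n)) (hγ : ∀ n → Order≥ n (Splitting.powerSum S e₁ γ n))
    (he₁ : Order≥ 1 e₁) (hα₁ : Order≥ 1 α)
    (γ≈ : γ ≈ α + ω) (α≈ : α + ω * ρ ≈ 0#)
    (θe₁ : θ e₁ ≈ e₁) (θα : θ α ≈ α + α) (θγ : θ γ ≈ γ + γ)
    (κ : ℕ → Carrier) (θκ : ∀ M → θ (κ M) ≈ 0#) (contributes : ℕ → Bool)
    (t : ℕ → ℕ → Carrier) (t-zero : ∀ n → t 0 n ≈ 0#)
    (t-true : ∀ M → contributes M ≡ true → ∀ n → t (suc M) n ≈ t M n + κ M ^ n)
    (t-false : ∀ M → contributes M ≡ false → ∀ n → t (suc M) n ≈ t M n)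
    (G H : ℕ → Carrier) (G-zero : G 0 ≈ 1#)
    (G-true : ∀ M → contributes M ≡ true → G (suc M) ≈ G M + H M)
    (G-false : ∀ M → contributes M ≡ false → G (suc M) ≈ G M)
    (H≈ : ∀ M → H M + - (κ M * e₁) * H M ≈ κ M * κ M * ω * (G M + ρ * H M))
    where

    module α = PowerSums e₁ α
    module γ = PowerSums e₁ γ

    Pα Pγ P : ℕ → Carrier
    Pα = Splitting.powerSum S e₁ α
    Pγ = Splitting.powerSum S e₁ γ
    P n = Pα n - Pγ n

    order-P : ∀ n → Order≥ n (P n)
    order-P n = order-+ (hα n) (order-neg (hγ n))

    order-scaled : ∀ {n f} a → Order≥ n f → Order≥ n (a * f)
    order-scaled a = order-* {0} order≥0

    order-tP : ∀ M n → Order≥ n (t M n * P n)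
    order-tP M n = order-scaled (t M n) (order-P n)

    -- The logarithmic derivative of `G M`. The sum starts at n = 0, since truncations make sense
    -- also for n = 0 and n = 1, where the infinite series diverge.
    L : ℕ → Carrier
    L M = Σ∞ (λ n → t M n * P n) (order-tP M)

    θ-G : ∀ M → θ (G M) ≈ L M * G M
    θ-G zero    = begin
      θ (G 0)     ≈⟨ trans (θ-cong G-zero) θ-one ⟩
      0#          ≈⟨ zeroˡ (G 0) ⟨
      0# * G 0    ≈⟨ *-congʳ (Σ∞-zero (order-tP 0) λ n → trans (*-congʳ (t-zero n)) (zeroˡ (P n))) ⟨
      L 0 * G 0   ∎
    θ-G (suc M) with contributes M in c
    ... | false = begin
      θ (G (suc M))       ≈⟨ θ-cong (G-false M c) ⟩
      θ (G M)             ≈⟨ θ-G M ⟩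
      L M * G M           ≈⟨ *-cong (Σ∞-cong (order-tP (suc M)) (order-tP M) λ n → *-congʳ (t-false M c n)) (G-false M c) ⟨
      L (suc M) * G (suc M) ∎
    ... | true  = logarithmic-step {G M} {G (suc M)} {L M} {L (suc M)}
      (1+-cancelˡ (order-+ (order-neg (order-scaled k he₁)) (order-scaled (k * k) hα₁)))
      (kernel-identity (G-true M c) (H≈ M) a≈ b≈) (θ-G M)
      (α.powerSum-series (-‿inverseˡ (k * e₁)) refl hkα)
      (γ.powerSum-series (-‿inverseˡ (k * e₁)) refl hkγ)
      (θ-quadratic θv (θ-k² θα)) (θ-quadratic θv (θ-k² θγ))
      (Σ∞-step {t M} {t (suc M)} {Pα} {Pγ} {k} (t-true M c) (order-tP (suc M)) hkγ (order-tP M) hkα)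
      where
      k = κ M
      hkα : ∀ n → Order≥ n (k ^ n * Pα n)
      hkα n = order-scaled (k ^ n) (hα n)
      hkγ : ∀ n → Order≥ n (k ^ n * Pγ n)
      hkγ n = order-scaled (k ^ n) (hγ n)
      a≈ : k * k * α + k * k * ω * ρ ≈ 0#
      a≈ = trans (solve 4 (λ k α ω ρ → k :* k :* α :+ k :* k :* ω :* ρ := k :* k :* (α :+ ω :* ρ)) refl k α ω ρ)
             (trans (*-congˡ α≈) (zeroʳ _))
      b≈ : k * k * γ ≈ k * k * α + k * k * ω
      b≈ = trans (*-congˡ γ≈) (distribˡ (k * k) α ω)
      θv : θ (- (k * e₁)) ≈ - (k * e₁)
      θv = trans (θ-neg (k * e₁)) (-‿cong (trans (θ-constant* (θκ M) e₁) (*-congˡ θe₁)))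
      θ-k² : ∀ {f} → θ f ≈ f + f → θ (k * k * f) ≈ k * k * f + k * k * f
      θ-k² {f} θf = begin
        θ (k * k * f)            ≈⟨ θ-cong (*-assoc k k f) ⟩
        θ (k * (k * f))          ≈⟨ trans (θ-constant* (θκ M) (k * f)) (*-congˡ (trans (θ-constant* (θκ M) f) (*-congˡ θf))) ⟩
        k * (k * (f + f))        ≈⟨ solve 2 (λ k f → k :* (k :* (f :+ f)) := k :* k :* f :+ k :* k :* f) refl k f ⟩
        k * k * f + k * k * f    ∎

    -- θ multiplies the n-th power sum by n, which cancels the denominator n in `σ`. The sum from 2
    -- agrees with the sum from 0 because there are two roots on each side (`P₀`) and both pairs
    -- have sum e₁ (`P₁`).
    θ-exponent : ∀ M (σ : ℕ → Carrier) → (∀ i → θ (σ i) ≈ 0#) →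
      (∀ i → σ i * ((2 ℕ.+ i) · 1#) ≈ t M (2 ℕ.+ i)) → ∀ h →
      θ (Σ∞ (λ i → σ i * P (2 ℕ.+ i)) h) ≈ L M
    θ-exponent M σ θσ σ≈ h = begin
      θ (Σ∞ (λ i → σ i * P (2 ℕ.+ i)) h)              ≈⟨ θ-Σ∞ h hθ ⟩
      Σ∞ (λ i → θ (σ i * P (2 ℕ.+ i))) hθ             ≈⟨ Σ∞-cong hθ h₂ term ⟩
      Σ∞ (λ i → t M (2 ℕ.+ i) * P (2 ℕ.+ i)) h₂       ≈⟨ trans (+-congʳ (zero-term 1 P₁)) (+-identityˡ _) ⟨
      t M 1 * P 1 + Σ∞ (λ i → t M (2 ℕ.+ i) * P (2 ℕ.+ i)) h₂ ≈⟨ Σ∞-suc h₁ h₂ ⟨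
      Σ∞ (λ i → t M (suc i) * P (suc i)) h₁           ≈⟨ trans (+-congʳ (zero-term 0 P₀)) (+-identityˡ _) ⟨
      t M 0 * P 0 + Σ∞ (λ i → t M (suc i) * P (suc i)) h₁ ≈⟨ Σ∞-suc (order-tP M) h₁ ⟨
      L M ∎
      where
      hθ : ∀ i → Order≥ i (θ (σ i * P (2 ℕ.+ i)))
      hθ i = order-θ (h i)
      h₁ : ∀ i → Order≥ i (t M (suc i) * P (suc i))
      h₁ i = order-mono (ℕₚ.m≤n+m i 1) (order-tP M (suc i))
      h₂ : ∀ i → Order≥ i (t M (2 ℕ.+ i) * P (2 ℕ.+ i))
      h₂ i = order-mono (ℕₚ.m≤n+m i 2) (order-tP M (2 ℕ.+ i))
      P₀ : P 0 ≈ 0#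
      P₀ = -‿inverseʳ _
      P₁ : P 1 ≈ 0#
      P₁ = trans (+-cong α.powerSum-1 (-‿cong γ.powerSum-1)) (-‿inverseʳ e₁)
      zero-term : ∀ n → P n ≈ 0# → t M n * P n ≈ 0#
      zero-term n Pₙ = trans (*-congˡ Pₙ) (zeroʳ _)
      θP : ∀ n → θ (P n) ≈ (n · 1#) * P n
      θP n = begin
        θ (Pα n - Pγ n)                     ≈⟨ trans (θ-+ _ _) (+-congˡ (θ-neg _)) ⟩
        θ (Pα n) - θ (Pγ n)                 ≈⟨ +-cong (α.θ-powerSum θe₁ θα n) (-‿cong (γ.θ-powerSum θe₁ θγ n)) ⟩
        (n · 1#) * Pα n - (n · 1#) * Pγ n   ≈⟨ x[y-z]≈xy-xz (n · 1#) (Pα n) (Pγ n) ⟨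
        (n · 1#) * P n                      ∎
      term : ∀ i → θ (σ i * P (2 ℕ.+ i)) ≈ t M (2 ℕ.+ i) * P (2 ℕ.+ i)
      term i = begin
        θ (σ i * P n)             ≈⟨ θ-constant* (θσ i) (P n) ⟩
        σ i * θ (P n)             ≈⟨ *-congˡ (θP n) ⟩
        σ i * ((n · 1#) * P n)    ≈⟨ *-assoc _ _ _ ⟨
        σ i * (n · 1#) * P n      ≈⟨ *-congʳ (σ≈ i) ⟩
        t M n * P n               ∎
        where n = 2 ℕ.+ i

    G≈exp : ∀ M (σ τ : ℕ → Carrier) → (∀ i → θ (σ i) ≈ 0#) → (∀ n → θ (τ n) ≈ 0#) →
      (∀ i → σ i * ((2 ℕ.+ i) · 1#) ≈ t M (2 ℕ.+ i)) → (∀ n → τ (suc n) * (suc n · 1#) ≈ τ n) → ∀ h →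
      let f = Σ∞ (λ i → σ i * P (2 ℕ.+ i)) h in Order≥ 1 f → ∀ hₑ →
      Order≥ 1 (G M - Σ∞ (λ n → τ n * f ^ n) hₑ) → G M ≈ Σ∞ (λ n → τ n * f ^ n) hₑ
    G≈exp M σ τ θσ θτ σ≈ τ≈ h hf hₑ h₁ = ode-unique (order-resp θf (order-θ hf)) h₁ (θ-G M)
      (trans (θ-exp τ f θτ τ≈ hₑ) (*-congʳ θf))
      where
      f : Carrier
      f = Σ∞ (λ i → σ i * P (2 ℕ.+ i)) h
      θf : θ f ≈ L M
      θf = θ-exponent M σ θσ σ≈ h

-- Sums over indices

module ListSum {c ℓ} (B : CommutativeRing c ℓ) where
  open CommutativeRing B hiding (zero)
  open SetoidReasoning setoid

  ΣL : ∀ {x} {X : Set x} → (X → Carrier) → List X → Carrier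
  ΣL f = foldr (λ x s → f x + s) 0#

  ΣL-cong : ∀ {x} {X : Set x} {f g : X → Carrier} xs → All (λ x → f x ≈ g x) xs → ΣL f xs ≈ ΣL g xs
  ΣL-cong []       []        = refl
  ΣL-cong (x ∷ xs) (eq ∷ eqs) = +-cong eq (ΣL-cong xs eqs)

  ΣL-++ : ∀ {x} {X : Set x} (f : X → Carrier) xs ys → ΣL f (xs ++ ys) ≈ ΣL f xs + ΣL f ys
  ΣL-++ f []       ys = sym (+-identityˡ _)
  ΣL-++ f (x ∷ xs) ys = trans (+-congˡ (ΣL-++ f xs ys)) (sym (+-assoc _ _ _))

  ΣL-map : ∀ {x y} {X : Set x} {Y : Set y} (f : Y → Carrier) (g : X → Y) xs → ΣL f (map g xs) ≡ ΣL (f ∘ g) xs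
  ΣL-map f g []       = ≡.refl
  ΣL-map f g (x ∷ xs) = ≡.cong (λ s → f (g x) + s) (ΣL-map f g xs)

  ΣL-scale : ∀ {x} {X : Set x} a (f : X → Carrier) xs → ΣL (λ x → a * f x) xs ≈ a * ΣL f xs
  ΣL-scale a f []       = sym (zeroʳ a)
  ΣL-scale a f (x ∷ xs) = trans (+-congˡ (ΣL-scale a f xs)) (sym (distribˡ a _ _))

module Mergings {c ℓ} (B : CommutativeRing c ℓ) (r : CommutativeRing.Carrier B) where
  open CommutativeRing B hiding (zero)
  open Exp semiring using (_^_)
  open ListSum B
  open SemiringSolver commutativeSemiring
  open SetoidReasoning setoid

  -- The recursion behind tʳ: a comma closes the entry k and moves it into f, a plus sign merges it
  -- with the next entry at the price of r. The exponent n - dep(p) is never formed.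
  mergeSum : (List ℕ → Carrier) → ℕ → List ℕ → Carrier
  mergeSum f k []       = f (k ∷ [])
  mergeSum f k (l ∷ ls) = mergeSum (f ∘ (k ∷_)) l ls + r * mergeSum f (k ℕ.+ l) ls

  mergeSum-cong : ∀ {f g} → (∀ q qs → f (q ∷ qs) ≈ g (q ∷ qs)) → ∀ k ks → mergeSum f k ks ≈ mergeSum g k ks
  mergeSum-cong f≈g k []       = f≈g k []
  mergeSum-cong f≈g k (l ∷ ls) =
    +-cong (mergeSum-cong (λ q qs → f≈g k (q ∷ qs)) l ls) (*-congˡ (mergeSum-cong f≈g (k ℕ.+ l) ls))

  mergeSum-+ : ∀ f g k ks → mergeSum (λ q → f q + g q) k ks ≈ mergeSum f k ks + mergeSum g k ks
  mergeSum-+ f g k []       = refl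
  mergeSum-+ f g k (l ∷ ls) = trans
    (+-cong (mergeSum-+ (f ∘ (k ∷_)) (g ∘ (k ∷_)) l ls) (*-congˡ (mergeSum-+ f g (k ℕ.+ l) ls)))
    (solve 5 (λ a b c d r → (a :+ b) :+ r :* (c :+ d) := (a :+ r :* c) :+ (b :+ r :* d)) refl
      (mergeSum (f ∘ (k ∷_)) l ls) (mergeSum (g ∘ (k ∷_)) l ls) (mergeSum f (k ℕ.+ l) ls) (mergeSum g (k ℕ.+ l) ls) r)

  mergeSum-scale : ∀ x f k ks → mergeSum (λ q → x * f q) k ks ≈ x * mergeSum f k ks
  mergeSum-scale x f k []       = refl
  mergeSum-scale x f k (l ∷ ls) = trans
    (+-cong (mergeSum-scale x (f ∘ (k ∷_)) l ls) (*-congˡ (mergeSum-scale x f (k ℕ.+ l) ls)))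
    (solve 4 (λ a b x r → x :* a :+ r :* (x :* b) := x :* (a :+ r :* b)) refl
      (mergeSum (f ∘ (k ∷_)) l ls) (mergeSum f (k ℕ.+ l) ls) x r)

  mergings-length : ∀ k ks → All (λ q → length q ℕ.≤ suc (length ks)) (mergings′ k ks)
  mergings-length k []       = ℕₚ.≤-refl ∷ []
  mergings-length k (l ∷ ls) = Allₚ.++⁺
    (Allₚ.map⁺ (All.map ℕ.s≤s (mergings-length l ls)))
    (All.map ℕₚ.m≤n⇒m≤1+n (mergings-length (k ℕ.+ l) ls))

  -- Indices made with a plus at the first box come from a list shorter by one and therefore need
  -- one more factor r. `mergings-length` ensures that the subtraction in the exponent is not cut
  -- off at zero.
  ΣL-mergings : ∀ f k ks →
    ΣL (λ q → r ^ (suc (length ks) ∸ length q) * f q) (mergings′ k ks) ≈ mergeSum f k ks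
  ΣL-mergings f k []       = trans (+-identityʳ _) (*-identityˡ _)
  ΣL-mergings f k (l ∷ ls) = begin
    ΣL F (map (k ∷_) (mergings′ l ls) ++ mergings′ (k ℕ.+ l) ls)
      ≈⟨ ΣL-++ F (map (k ∷_) (mergings′ l ls)) (mergings′ (k ℕ.+ l) ls) ⟩
    ΣL F (map (k ∷_) (mergings′ l ls)) + ΣL F (mergings′ (k ℕ.+ l) ls)
      ≈⟨ +-cong (reflexive (ΣL-map F (k ∷_) (mergings′ l ls)))
           (ΣL-cong (mergings′ (k ℕ.+ l) ls) (All.map (λ {q} → shift q) (mergings-length (k ℕ.+ l) ls))) ⟩
    ΣL (F ∘ (k ∷_)) (mergings′ l ls) + ΣL (λ q → r * F′ q) (mergings′ (k ℕ.+ l) ls)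
      ≈⟨ +-cong (ΣL-mergings (f ∘ (k ∷_)) l ls)
           (trans (ΣL-scale r F′ (mergings′ (k ℕ.+ l) ls)) (*-congˡ (ΣL-mergings f (k ℕ.+ l) ls))) ⟩
    mergeSum f k (l ∷ ls) ∎
    where
    F F′ : List ℕ → Carrier
    F q = r ^ (suc (suc (length ls)) ∸ length q) * f q
    F′ q = r ^ (suc (length ls) ∸ length q) * f q
    shift : ∀ q → length q ℕ.≤ suc (length ls) → F q ≈ r * F′ q
    shift q le rewrite ℕₚ.+-∸-assoc 1 le = *-assoc r _ (f q)

module Compositions {c ℓ} (B : CommutativeRing c ℓ) where
  open CommutativeRing B hiding (zero)
  open Sum semiring
  open PowerSeries B using (sum-zero)
  open SetoidReasoning setoid

  -- The sum of f over the sequences of n integers ≥ 2 with sum d + 2n.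
  compSum : (List ℕ → Carrier) → ℕ → ℕ → Carrier
  compSum f zero    zero    = f []
  compSum f zero    (suc d) = 0#
  compSum f (suc n) d       = ∑[ i ≤ d ] compSum (f ∘ (2 ℕ.+ toℕ i ∷_)) n (d ∸ toℕ i)

  compSum-cong : ∀ {f g} → (∀ ks → f ks ≈ g ks) → ∀ n d → compSum f n d ≈ compSum g n d
  compSum-cong f≈g zero    zero    = f≈g []
  compSum-cong f≈g zero    (suc d) = refl
  compSum-cong f≈g (suc n) d       = sum-cong-≋ {suc d} λ i →
    compSum-cong (λ ks → f≈g (2 ℕ.+ toℕ i ∷ ks)) n (d ∸ toℕ i)

  compSum-+ : ∀ f g n d → compSum (λ ks → f ks + g ks) n d ≈ compSum f n d + compSum g n d
  compSum-+ f g zero    zero    = refl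
  compSum-+ f g zero    (suc d) = sym (+-identityˡ 0#)
  compSum-+ f g (suc n) d       = trans
    (sum-cong-≋ {suc d} λ i → compSum-+ (f ∘ (2 ℕ.+ toℕ i ∷_)) (g ∘ (2 ℕ.+ toℕ i ∷_)) n (d ∸ toℕ i))
    (∑-distrib-+ {suc d} (λ i → compSum (f ∘ (2 ℕ.+ toℕ i ∷_)) n (d ∸ toℕ i))
                         (λ i → compSum (g ∘ (2 ℕ.+ toℕ i ∷_)) n (d ∸ toℕ i)))

  compSum-scale : ∀ x f n d → compSum (λ ks → x * f ks) n d ≈ x * compSum f n d
  compSum-scale x f zero    zero    = refl
  compSum-scale x f zero    (suc d) = sym (zeroʳ x)
  compSum-scale x f (suc n) d       = trans
    (sum-cong-≋ {suc d} λ i → compSum-scale x (f ∘ (2 ℕ.+ toℕ i ∷_)) n (d ∸ toℕ i))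
    (sym (*-distribˡ-sum {suc d} x (λ i → compSum (f ∘ (2 ℕ.+ toℕ i ∷_)) n (d ∸ toℕ i))))

  compSum-zero : ∀ {f} → (∀ k ks → f (k ∷ ks) ≈ 0#) → ∀ n d → compSum f (suc n) d ≈ 0#
  compSum-zero {f} f≈0 n d = sum-zero {suc d} (λ i → compSum (f ∘ (2 ℕ.+ toℕ i ∷_)) n (d ∸ toℕ i))
    λ i → go n (d ∸ toℕ i) (f≈0 (2 ℕ.+ toℕ i))
    where
    go : ∀ {f} n d → (∀ ks → f ks ≈ 0#) → compSum f n d ≈ 0#
    go zero    zero    f≈0 = f≈0 []
    go zero    (suc d) f≈0 = refl
    go {f} (suc n) d f≈0 = sum-zero {suc d} (λ i → compSum (f ∘ (2 ℕ.+ toℕ i ∷_)) n (d ∸ toℕ i))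
      λ i → go n (d ∸ toℕ i) (λ ks → f≈0 (2 ℕ.+ toℕ i ∷ ks))

-- Truncated interpolated sums and their growth in M

record RationalScalars {c ℓ} (B : CommutativeRing c ℓ) (ι : ℚ → CommutativeRing.Carrier B) : Set ℓ where
  open CommutativeRing B
  field
    ι-1 : ι 1ℚ ≈ 1#
    ι-+ : ∀ p q → ι (p Rat.+ q) ≈ ι p + ι q
    ι-* : ∀ p q → ι (p Rat.* q) ≈ ι p * ι q

module Truncations (N a : ℕ) .{{_ : NonZero N}} {c ℓ} (B : CommutativeRing c ℓ)
                   {ι : ℚ → CommutativeRing.Carrier B} (ι-scalars : RationalScalars B ι)
                   (r : CommutativeRing.Carrier B) where

  open CommutativeRing B hiding (zero)
  open RationalScalars ι-scalars

  open MultipleT N a using (truncated; summand)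
  open Exp semiring
  open Sum semiring
  open ListSum B
  open Mergings B r
  open Compositions B
  open PowerSeries B using (sum-zero)
  open SemiringSolver commutativeSemiring
  open SetoidReasoning setoid

  ι-^ : ∀ q n → ι (q ^ℚ n) ≈ ι q ^ n
  ι-^ q zero    = ι-1
  ι-^ q (suc n) = trans (ι-* q (q ^ℚ n)) (*-congˡ (ι-^ q n))

  x : ℕ → Carrier
  x M = ι (+ 1 / suc M)

  contributes : ℕ → Bool
  contributes M = does (suc M % N ℕₚ.≟ a % N)

  -- T M and E M are the sums defining tʳ, restricted to m₁ ≤ M and, disregarding
  -- the congruence condition on m₁, to m₁ = M + 1.
  T E : ℕ → List ℕ → Carrier
  first : ℕ → List ℕ → Carrier

  T M []       = 1#
  T M (k ∷ ks) = mergeSum (λ q → ι (truncated q M)) k ks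

  first M []       = 0#
  first M (k ∷ ks) = x M ^ k * ι (truncated ks M)

  E M []       = 0#
  E M (k ∷ ks) = mergeSum (first M) k ks

  -- Merging only enlarges the first entry, so every term of `E` carries x to a first entry that
  -- contains l as a summand; replacing l by k + l multiplies all of them by xᵏ.
  E-scale : ∀ M k l ls → E M (k ℕ.+ l ∷ ls) ≈ x M ^ k * E M (l ∷ ls)
  E-scale M k l []        = trans (*-congʳ (^-homo-* (x M) k l)) (*-assoc _ _ _)
  E-scale M k l (l′ ∷ ls) = begin
    mergeSum (first M ∘ (k ℕ.+ l ∷_)) l′ ls + r * E M (k ℕ.+ l ℕ.+ l′ ∷ ls)
      ≈⟨ +-cong (trans (mergeSum-cong (λ q qs → trans (*-congʳ (^-homo-* (x M) k l)) (*-assoc _ _ _)) l′ ls)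
                       (mergeSum-scale (x M ^ k) (first M ∘ (l ∷_)) l′ ls))
           (*-congˡ (trans (reflexive (≡.cong (λ m → E M (m ∷ ls)) (ℕₚ.+-assoc k l l′))) (E-scale M k (l ℕ.+ l′) ls))) ⟩
    x M ^ k * mergeSum (first M ∘ (l ∷_)) l′ ls + r * (x M ^ k * E M (l ℕ.+ l′ ∷ ls))
      ≈⟨ solve 4 (λ y a r b → y :* a :+ r :* (y :* b) := y :* (a :+ r :* b)) refl
           (x M ^ k) (mergeSum (first M ∘ (l ∷_)) l′ ls) r (E M (l ℕ.+ l′ ∷ ls)) ⟩
    x M ^ k * E M (l ∷ l′ ∷ ls) ∎

  -- With m₁ = M + 1 fixed, a comma after k leaves m₂ ≤ M, which is `T`; a plus sign means m₂ = m₁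
  -- and gives r times `E`. The values 1 and 0 of `T` and `E` at the empty index cover depth one.
  E-∷ : ∀ M k ks → E M (k ∷ ks) ≈ x M ^ k * (T M ks + r * E M ks)
  E-∷ M k []       = *-congˡ (trans ι-1 (sym (trans (+-congˡ (zeroʳ r)) (+-identityʳ 1#))))
  E-∷ M k (l ∷ ls) = begin
    mergeSum (λ q → x M ^ k * ι (truncated q M)) l ls + r * E M (k ℕ.+ l ∷ ls)
      ≈⟨ +-cong (mergeSum-scale (x M ^ k) (λ q → ι (truncated q M)) l ls) (*-congˡ (E-scale M k l ls)) ⟩
    x M ^ k * T M (l ∷ ls) + r * (x M ^ k * E M (l ∷ ls))
      ≈⟨ solve 4 (λ y a r b → y :* a :+ r :* (y :* b) := y :* (a :+ r :* b)) refl
           (x M ^ k) (T M (l ∷ ls)) r (E M (l ∷ ls)) ⟩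
    x M ^ k * (T M (l ∷ ls) + r * E M (l ∷ ls)) ∎

  truncated-step : ∀ M k ks → ι (truncated (k ∷ ks) (suc M)) ≈
    ι (truncated (k ∷ ks) M) + ι (summand k ks M)
  truncated-step M k ks = trans (reflexive (≡.cong ι (RationalFacts.sum-last (summand k ks) M))) (ι-+ _ _)

  ι-0 : ι 0ℚ ≈ 0#
  ι-0 = x+x≈x⇒x≈0 (ι 0ℚ) (sym (ι-+ 0ℚ 0ℚ))
    where open import Algebra.Properties.Ring ring using (x+x≈x⇒x≈0)

  truncated-step-true : ∀ M → contributes M ≡ true → ∀ k ks →
    ι (truncated (k ∷ ks) (suc M)) ≈ ι (truncated (k ∷ ks) M) + first M (k ∷ ks)
  truncated-step-true M c k ks = trans (truncated-step M k ks) (+-congˡ eq)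
    where
    eq : ι (summand k ks M) ≈ first M (k ∷ ks)
    eq rewrite c = trans (ι-* _ _) (*-congʳ (ι-^ (+ 1 / suc M) k))

  truncated-step-false : ∀ M → contributes M ≡ false → ∀ k ks →
    ι (truncated (k ∷ ks) (suc M)) ≈ ι (truncated (k ∷ ks) M)
  truncated-step-false M c k ks = trans (truncated-step M k ks) (trans (+-congˡ eq) (+-identityʳ _))
    where
    eq : ι (summand k ks M) ≈ 0#
    eq rewrite c = ι-0

  T-step-true : ∀ M → contributes M ≡ true → ∀ ks → T (suc M) ks ≈ T M ks + E M ks
  T-step-true M c []       = sym (+-identityʳ 1#)
  T-step-true M c (k ∷ ks) = trans (mergeSum-cong (truncated-step-true M c) k ks)
    (mergeSum-+ (λ q → ι (truncated q M)) (first M) k ks)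

  T-step-false : ∀ M → contributes M ≡ false → ∀ ks → T (suc M) ks ≈ T M ks
  T-step-false M c []       = refl
  T-step-false M c (k ∷ ks) = mergeSum-cong (truncated-step-false M c) k ks

  T-zero : ∀ k ks → T 0 (k ∷ ks) ≈ 0#
  T-zero k ks = begin
    mergeSum (λ q → ι (truncated q 0)) k ks      ≈⟨ mergeSum-cong (λ q qs → trans ι-0 (sym (zeroˡ (ι 0ℚ)))) k ks ⟩
    mergeSum (λ q → 0# * ι 0ℚ) k ks              ≈⟨ mergeSum-scale 0# (λ _ → ι 0ℚ) k ks ⟩
    0# * mergeSum (λ _ → ι 0ℚ) k ks              ≈⟨ zeroˡ _ ⟩
    0#                                           ∎

  -- the coefficients of uᵈ w²ⁿ in the generating series of T M and of E M
  g h : ℕ → ℕ → ℕ → Carrier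
  g M n d = compSum (T M) n d
  h M n d = compSum (E M) n d

  h-first : ∀ M n i d → compSum (E M ∘ (i ∷_)) n d ≈ x M ^ i * (g M n d + r * h M n d)
  h-first M n i d = begin
    compSum (E M ∘ (i ∷_)) n d                             ≈⟨ compSum-cong (E-∷ M i) n d ⟩
    compSum (λ ks → x M ^ i * (T M ks + r * E M ks)) n d   ≈⟨ compSum-scale (x M ^ i) (λ ks → T M ks + r * E M ks) n d ⟩
    x M ^ i * compSum (λ ks → T M ks + r * E M ks) n d     ≈⟨ *-congˡ (compSum-+ (T M) (λ ks → r * E M ks) n d) ⟩
    x M ^ i * (g M n d + compSum (λ ks → r * E M ks) n d)  ≈⟨ *-congˡ (+-congˡ (compSum-scale r (E M) n d)) ⟩
    x M ^ i * (g M n d + r * h M n d)                      ∎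

  h-zero : ∀ M d → h M 0 d ≈ 0#
  h-zero M zero    = refl
  h-zero M (suc d) = refl

  h-suc-0 : ∀ M n → h M (suc n) 0 ≈ x M ^ 2 * (g M n 0 + r * h M n 0)
  h-suc-0 M n = trans (+-identityʳ _) (h-first M n 2 0)

  -- The geometric series in the first entry, coefficient by coefficient: first entry 2 gives the
  -- first summand, and lowering a larger first entry by one takes out a factor x and one power of
  -- u.
  h-suc-suc : ∀ M n d → h M (suc n) (suc d) ≈ x M ^ 2 * (g M n (suc d) + r * h M n (suc d)) + x M * h M (suc n) d
  h-suc-suc M n d = +-cong (h-first M n 2 (suc d)) (begin
    (∑[ i ≤ d ] compSum (E M ∘ (3 ℕ.+ toℕ i ∷_)) n (d ∸ toℕ i))
      ≈⟨ sum-cong-≋ {suc d} (λ i → trans (h-first M n (3 ℕ.+ toℕ i) (d ∸ toℕ i))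
           (trans (*-assoc _ _ _) (*-congˡ (sym (h-first M n (2 ℕ.+ toℕ i) (d ∸ toℕ i)))))) ⟩
    (∑[ i ≤ d ] (x M * compSum (E M ∘ (2 ℕ.+ toℕ i ∷_)) n (d ∸ toℕ i)))
      ≈⟨ *-distribˡ-sum {suc d} (x M) (λ i → compSum (E M ∘ (2 ℕ.+ toℕ i ∷_)) n (d ∸ toℕ i)) ⟨
    x M * h M (suc n) d ∎)

  g-step-true : ∀ M → contributes M ≡ true → ∀ n d → g (suc M) n d ≈ g M n d + h M n d
  g-step-true M c n d = trans (compSum-cong (T-step-true M c) n d) (compSum-+ (T M) (E M) n d)

  g-step-false : ∀ M → contributes M ≡ false → ∀ n d → g (suc M) n d ≈ g M n d
  g-step-false M c = compSum-cong (T-step-false M c)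

  g-0 : ∀ n d → g 0 (suc n) d ≈ 0#
  g-0 = compSum-zero {T 0} T-zero

-- Indices of full height as compositions into parts at least 2

split-weight : ∀ {d i} n → i ℕ.≤ d → d ℕ.+ 2 ℕ.* suc n ≡ 2 ℕ.+ i ℕ.+ (d ∸ i ℕ.+ 2 ℕ.* n)
split-weight {d} {i} n i≤d = begin
  d ℕ.+ 2 ℕ.* suc n                     ≡⟨ ≡.cong₂ ℕ._+_ (≡.sym (ℕₚ.m+[n∸m]≡n i≤d)) (ℕₚ.*-suc 2 n) ⟩
  i ℕ.+ (d ∸ i) ℕ.+ (2 ℕ.+ 2 ℕ.* n)     ≡⟨ solve 3 (λ i e m → i :+ e :+ (con 2 :+ m) := con 2 :+ i :+ (e :+ m)) ≡.refl i (d ∸ i) (2 ℕ.* n) ⟩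
  2 ℕ.+ i ℕ.+ (d ∸ i ℕ.+ 2 ℕ.* n)       ∎
  where
  open ≡.≡-Reasoning
  open +-*-Solver

module Indices {c ℓ} (B : CommutativeRing c ℓ) where
  open CommutativeRing B hiding (zero)
  open Sum semiring
  open ListSum B
  open Compositions B
  open FiniteSum B
  open SetoidReasoning setoid

  guard : ∀ {p} {P : Set p} → Dec P → Carrier → Carrier
  guard P? x = if does P? then x else 0#

  guard-no : ∀ {p} {P : Set p} (P? : Dec P) → ¬ P → ∀ x → guard P? x ≈ 0#
  guard-no P? ¬P x rewrite dec-false P? ¬P = refl

  guard-⇔ : ∀ {p q} {P : Set p} {Q : Set q} → P ⇔ Q → (P? : Dec P) (Q? : Dec Q) → ∀ x → guard P? x ≈ guard Q? x
  guard-⇔ P⇔Q P? Q? x = reflexive (≡.cong (if_then x else 0#) (does-⇔ P⇔Q P? Q?))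

  ΣL-zero : ∀ {x} {X : Set x} {f : X → Carrier} xs → All (λ x → f x ≈ 0#) xs → ΣL f xs ≈ 0#
  ΣL-zero []       []       = refl
  ΣL-zero (x ∷ xs) (eq ∷ eqs) = trans (+-cong eq (ΣL-zero xs eqs)) (+-identityˡ 0#)

  ΣL-filter : ∀ {x p} {X : Set x} {P : X → Set p} (P? : ∀ x → Dec (P x)) (f : X → Carrier) xs →
              ΣL f (filter P? xs) ≈ ΣL (λ x → guard (P? x) (f x)) xs
  ΣL-filter P? f []       = refl
  ΣL-filter P? f (x ∷ xs) with does (P? x)
  ... | true  = +-congˡ (ΣL-filter P? f xs)
  ... | false = trans (ΣL-filter P? f xs) (sym (+-identityˡ _))

  ΣL-cartesianProductWith : ∀ {x y z} {X : Set x} {Y : Set y} {Z : Set z} (f : Z → Carrier) (_•_ : X → Y → Z) xs ys →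
    ΣL f (cartesianProductWith _•_ xs ys) ≈ ΣL (λ x → ΣL (λ y → f (x • y)) ys) xs
  ΣL-cartesianProductWith f _•_ []       ys = refl
  ΣL-cartesianProductWith f _•_ (x ∷ xs) ys = trans (ΣL-++ f (map (x •_) ys) (cartesianProductWith _•_ xs ys))
    (+-cong (reflexive (ΣL-map f (x •_) ys)) (ΣL-cartesianProductWith f _•_ xs ys))

  ΣL-applyUpTo : ∀ {x} {X : Set x} (f : X → Carrier) g n → ΣL f (applyUpTo g n) ≡ sum {n} (f ∘ g ∘ toℕ)
  ΣL-applyUpTo f g zero    = ≡.refl
  ΣL-applyUpTo f g (suc n) = ≡.cong (λ s → f (g 0) + s) (ΣL-applyUpTo f (g ∘ suc) n)

  tuples-length : ∀ n b → All (λ p → length p ≡ n) (tuples n b)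
  tuples-length zero    b = ≡.refl ∷ []
  tuples-length (suc n) b = go (applyUpTo suc b)
    where
    go : ∀ xs → All (λ p → length p ≡ suc n) (cartesianProductWith _∷_ xs (tuples n b))
    go []       = []
    go (x ∷ xs) = Allₚ.++⁺ (Allₚ.map⁺ (All.map (≡.cong suc) (tuples-length n b))) (go xs)

  Composition : ℕ → List ℕ → Set
  Composition k p = All (2 ℕ.≤_) p × weight p ≡ k

  composition? : ∀ k p → Dec (Composition k p)
  composition? k p = All.all? (2 ℕₚ.≤?_) p ×-dec weight p ℕₚ.≟ k

  2*length≤weight : ∀ {p} → All (2 ℕ.≤_) p → 2 ℕ.* length p ℕ.≤ weight p
  2*length≤weight []                    = ℕ.z≤n
  2*length≤weight {k ∷ ks} (2≤k ∷ 2≤ks) = ℕₚ.≤-trans (ℕₚ.≤-reflexive (ℕₚ.*-suc 2 (length ks)))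
    (ℕₚ.+-mono-≤ 2≤k (2*length≤weight 2≤ks))

  private
    boundedSum : (List ℕ → Carrier) → ℕ → ℕ → ℕ → Carrier
    boundedSum f n b k = ΣL (λ p → guard (composition? k p) (f p)) (tuples n b)

    first : (List ℕ → Carrier) → ℕ → ℕ → ℕ → ℕ → Carrier
    first f n b k l = ΣL (λ ks → guard (composition? k (l ∷ ks)) (f (l ∷ ks))) (tuples n b)

    boundedSum-suc : ∀ f n b k → boundedSum f (suc n) b k ≈ sum {b} (first f n b k ∘ suc ∘ toℕ)
    boundedSum-suc f n b k = trans
      (ΣL-cartesianProductWith (λ p → guard (composition? k p) (f p)) _∷_ (applyUpTo suc b) (tuples n b))
      (reflexive (ΣL-applyUpTo (first f n b k) suc b))

    boundedSum-zero : ∀ f n b k → k ℕ.< 2 ℕ.* n → boundedSum f n b k ≈ 0#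
    boundedSum-zero f n b k k<2n = ΣL-zero (tuples n b) (All.map
      (λ { {p} ≡.refl → guard-no (composition? k p)
        (λ { (2≤p , ≡.refl) → ℕₚ.<⇒≱ k<2n (2*length≤weight 2≤p) }) (f p) })
      (tuples-length n b))

    first-zero : ∀ f n b k l → ¬ (2 ℕ.≤ l × l ℕ.≤ k) → first f n b k l ≈ 0#
    first-zero f n b k l ¬l = ΣL-zero (tuples n b) (All.map
      (λ {ks} _ → guard-no (composition? k (l ∷ ks))
        (λ { (2≤l ∷ _ , ≡.refl) → ¬l (2≤l , ℕₚ.m≤m+n l (weight ks)) }) (f (l ∷ ks)))
      (tuples-length n b))

    first-+ : ∀ f n b k l → 2 ℕ.≤ l → first f n b (l ℕ.+ k) l ≈ boundedSum (f ∘ (l ∷_)) n b k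
    first-+ f n b k l 2≤l = ΣL-cong (tuples n b) (All.map
      (λ {ks} _ → guard-⇔ (mk⇔ (λ { (_ ∷ 2≤ks , eq) → 2≤ks , ℕₚ.+-cancelˡ-≡ l _ _ eq })
                               (λ { (2≤ks , eq) → 2≤l ∷ 2≤ks , ≡.cong (l ℕ.+_) eq }))
                    (composition? (l ℕ.+ k) (l ∷ ks)) (composition? k ks) (f (l ∷ ks)))
      (tuples-length n b))

    -- The enumeration offers first entries from 1 to b. Entry 1 is too small, and an entry above d
    -- + 2 leaves too little weight for n further entries ≥ 2, so exactly 2, ..., d + 2 survive. The
    -- bound b stays fixed while the weight drops in the recursion, hence an inequality as
    -- hypothesis.
    boundedSum-compSum : ∀ f n b d → d ℕ.+ 2 ℕ.* n ℕ.≤ b → boundedSum f n b (d ℕ.+ 2 ℕ.* n) ≈ compSum f n d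
    boundedSum-compSum f zero    b zero    _ = +-identityʳ _
    boundedSum-compSum f zero    b (suc d) _ = +-identityʳ _
    boundedSum-compSum f (suc n) b d le = begin
      boundedSum f (suc n) b k                        ≈⟨ boundedSum-suc f n b k ⟩
      sum {b} (first f n b k ∘ suc ∘ toℕ)             ≈⟨ sum-extend (first f n b k ∘ suc) (ℕₚ.≤-trans 2+d≤k le) large ⟩
      sum {2 ℕ.+ d} (first f n b k ∘ suc ∘ toℕ)       ≈⟨ +-congʳ (first-zero f n b k 1 λ { (ℕ.s≤s () , _) }) ⟩
      0# + sum {suc d} (first f n b k ∘ (2 ℕ.+_) ∘ toℕ) ≈⟨ +-identityˡ _ ⟩
      sum {suc d} (first f n b k ∘ (2 ℕ.+_) ∘ toℕ)    ≈⟨ sum-cong-≋ {suc d} (λ i → small (toℕ i) (ℕₚ.≤-pred (Finₚ.toℕ<n i))) ⟩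
      compSum f (suc n) d                             ∎
      where
      k : ℕ
      k = d ℕ.+ 2 ℕ.* suc n
      k≡ : ∀ {i} → i ℕ.≤ d → k ≡ 2 ℕ.+ i ℕ.+ (d ∸ i ℕ.+ 2 ℕ.* n)
      k≡ = split-weight n
      2+d≤k : 2 ℕ.+ d ℕ.≤ k
      2+d≤k = ℕₚ.≤-trans (ℕₚ.m≤m+n (2 ℕ.+ d) _) (ℕₚ.≤-reflexive (≡.sym (k≡ ℕₚ.≤-refl)))
      small : ∀ i → i ℕ.≤ d → first f n b k (2 ℕ.+ i) ≈ compSum (f ∘ (2 ℕ.+ i ∷_)) n (d ∸ i)
      small i i≤d = begin
        first f n b k (2 ℕ.+ i)
          ≡⟨ ≡.cong (λ k → first f n b k (2 ℕ.+ i)) (k≡ i≤d) ⟩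
        first f n b (2 ℕ.+ i ℕ.+ (d ∸ i ℕ.+ 2 ℕ.* n)) (2 ℕ.+ i)
          ≈⟨ first-+ f n b (d ∸ i ℕ.+ 2 ℕ.* n) (2 ℕ.+ i) (ℕ.s≤s (ℕ.s≤s ℕ.z≤n)) ⟩
        boundedSum (f ∘ (2 ℕ.+ i ∷_)) n b (d ∸ i ℕ.+ 2 ℕ.* n)
          ≈⟨ boundedSum-compSum (f ∘ (2 ℕ.+ i ∷_)) n b (d ∸ i)
               (ℕₚ.≤-trans (ℕₚ.m≤n+m _ (2 ℕ.+ i)) (ℕₚ.≤-trans (ℕₚ.≤-reflexive (≡.sym (k≡ i≤d))) le)) ⟩
        compSum (f ∘ (2 ℕ.+ i ∷_)) n (d ∸ i) ∎
      large : ∀ l → 2 ℕ.+ d ℕ.≤ l → first f n b k (suc l) ≈ 0#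
      large l 2+d≤l with suc l ℕₚ.≤? k
      ... | no  l≰k = first-zero f n b k (suc l) (l≰k ∘ proj₂)
      ... | yes l≤k = begin
        first f n b k (suc l)                             ≡⟨ ≡.cong (λ k → first f n b k (suc l)) (ℕₚ.m+[n∸m]≡n l≤k) ⟨
        first f n b (suc l ℕ.+ (k ∸ suc l)) (suc l)       ≈⟨ first-+ f n b (k ∸ suc l) (suc l) (ℕ.s≤s (ℕₚ.≤-trans (ℕ.s≤s ℕ.z≤n) 2+d≤l)) ⟩
        boundedSum (f ∘ (suc l ∷_)) n b (k ∸ suc l)       ≈⟨ boundedSum-zero (f ∘ (suc l ∷_)) n b (k ∸ suc l) rest<2n ⟩
        0#                                                ∎
        where
        -- The entry suc l is at least d + 3, while k = d + 2 + 2n.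
        rest<2n : k ∸ suc l ℕ.< 2 ℕ.* n
        rest<2n = ℕₚ.+-cancelˡ-< (2 ℕ.+ d) _ _ (ℕₚ.<-≤-trans
          (ℕₚ.<-≤-trans (ℕ.s≤s (ℕₚ.+-monoˡ-≤ (k ∸ suc l) 2+d≤l)) (ℕₚ.≤-reflexive (ℕₚ.m+[n∸m]≡n l≤k)))
          (ℕₚ.≤-reflexive (≡.trans (k≡ ℕₚ.≤-refl) (≡.cong (λ e → 2 ℕ.+ d ℕ.+ (e ℕ.+ 2 ℕ.* n)) (ℕₚ.n∸n≡0 d)))))

  full-height : ∀ p → height p ≡ length p → All (2 ℕ.≤_) p
  full-height []      _  = []
  full-height (k ∷ p) eq with 2 ℕₚ.≤? k
  ... | yes 2≤k = 2≤k ∷ full-height p (ℕₚ.suc-injective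
    (≡.trans (≡.cong length (≡.sym (Listₚ.filter-accept (2 ℕₚ.≤?_) {xs = p} 2≤k))) eq))
  ... | no  2≰k = contradiction (≡.subst (ℕ._≤ length p)
    (≡.trans (≡.cong length (≡.sym (Listₚ.filter-reject (2 ℕₚ.≤?_) {xs = p} 2≰k))) eq)
    (Listₚ.length-filter (2 ℕₚ.≤?_) p)) ℕₚ.1+n≰n

  -- Height equal to depth means that no entry is 1, and this already implies admissibility once the
  -- index is nonempty; hence the length n + 1.
  inI₀⇔composition : ∀ k n {p} → length p ≡ suc n → InI₀ k (suc n) (suc n) p ⇔ Composition k p
  inI₀⇔composition k n {p} len = mk⇔
    (λ (_ , wt , _ , ht) → full-height p (≡.trans ht (≡.sym len)) , wt)
    (λ (2≤p , wt) → admissible len 2≤p , wt , len , ≡.trans (≡.cong length (Listₚ.filter-all (2 ℕₚ.≤?_) 2≤p)) len)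
    where
    admissible : ∀ {p} → length p ≡ suc n → All (2 ℕ.≤_) p → Admissible p
    admissible _ (2≤k ∷ 2≤ks) = 2≤k , All.map ℕₚ.<⇒≤ 2≤ks

  ΣL-I₀ : ∀ f n d → let k = d ℕ.+ 2 ℕ.* suc n in ΣL f (I₀ k (suc n) (suc n)) ≈ compSum f (suc n) d
  ΣL-I₀ f n d = begin
    ΣL f (filter (inI₀? k (suc n) (suc n)) (tuples (suc n) k))
      ≈⟨ ΣL-filter (inI₀? k (suc n) (suc n)) f (tuples (suc n) k) ⟩
    ΣL (λ p → guard (inI₀? k (suc n) (suc n) p) (f p)) (tuples (suc n) k)
      ≈⟨ ΣL-cong (tuples (suc n) k) (All.map (λ {p} len →
           guard-⇔ (inI₀⇔composition k n len) (inI₀? k (suc n) (suc n) p) (composition? k p) (f p)) (tuples-length (suc n) k)) ⟩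
    boundedSum f (suc n) k k ≈⟨ boundedSum-compSum f (suc n) k d ℕₚ.≤-refl ⟩
    compSum f (suc n) d ∎
    where
    k : ℕ
    k = d ℕ.+ 2 ℕ.* suc n

-- The truncated identity

module SeriesCoefficients {c ℓ} (R : CommutativeRing c ℓ) where
  open CommutativeRing R hiding (zero)
  open PowerSeries R

  const-⊛ : ∀ a f n → (const a ⊛ f) n ≈ a * f n
  const-⊛ a f zero    = +-identityʳ _
  const-⊛ a f (suc n) = trans (+-congˡ (sum-zero {suc n} _ λ i → zeroˡ (f (n ∸ toℕ i)))) (+-identityʳ _)

  X-⊛-zero : ∀ f → (X ⊛ f) 0 ≈ 0#
  X-⊛-zero f = trans (+-identityʳ _) (zeroˡ _)

  X-⊛-suc : ∀ f n → (X ⊛ f) (suc n) ≈ f n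
  X-⊛-suc f n = trans (+-cong (zeroˡ _)
      (⊛-cong {X ∘ suc} {const 1#} {f} {f} (λ { zero → refl ; (suc _) → refl }) (λ _ → refl) n))
    (trans (+-identityˡ _) (⊛-identityˡ f n))

  sum-single : ∀ {n} (f : ℕ → Carrier) k → k ℕ.< n → (∀ i → i ℕ.< n → i ≢ k → f i ≈ 0#) →
               Sum.sum semiring {n} (f ∘ toℕ) ≈ f k
  sum-single {suc n} f zero    _ h = trans (+-congˡ (sum-zero {n} _ λ i → h (suc (toℕ i)) (ℕ.s≤s (Finₚ.toℕ<n i)) λ ())) (+-identityʳ _)
  sum-single {suc n} f (suc k) (ℕ.s≤s k<n) h = trans
    (+-cong (h 0 (ℕ.s≤s ℕ.z≤n) λ ()) (sum-single (f ∘ suc) k k<n λ i i<n i≢k → h (suc i) (ℕ.s≤s i<n) (i≢k ∘ ℕₚ.suc-injective)))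
    (+-identityˡ _)

-- Only even powers of w carry coefficients in the generating series; `nothing` marks the odd ones.
half : ℕ → Maybe ℕ
half zero          = just 0
half (suc zero)    = nothing
half (suc (suc j)) = Maybe.map suc (half j)

half-2* : ∀ m → half (2 ℕ.* m) ≡ just m
half-2* zero = ≡.refl
half-2* (suc m) rewrite ℕₚ.+-suc m (m ℕ.+ 0) | half-2* m = ≡.refl

half-just : ∀ j {m} → half j ≡ just m → j ≡ 2 ℕ.* m
half-just zero          ≡.refl = ≡.refl
half-just (suc (suc j)) eq with half j in eq′
half-just (suc (suc j)) ≡.refl | just m = ≡.trans (≡.cong (2 ℕ.+_) (half-just j eq′)) (≡.sym (ℕₚ.*-suc 2 m))

m≤⌊n/2⌋⇒2*m≤n : ∀ {m n} → m ℕ.≤ ⌊ n /2⌋ → 2 ℕ.* m ℕ.≤ n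
m≤⌊n/2⌋⇒2*m≤n {zero} _ = ℕ.z≤n
m≤⌊n/2⌋⇒2*m≤n {suc m} {suc (suc n)} (ℕ.s≤s m≤) =
  ℕₚ.≤-trans (ℕₚ.≤-reflexive (ℕₚ.*-suc 2 m)) (ℕ.s≤s (ℕ.s≤s (m≤⌊n/2⌋⇒2*m≤n m≤)))

m≤⌊i+2*m/2⌋ : ∀ i m → m ℕ.≤ ⌊ i ℕ.+ 2 ℕ.* m /2⌋
m≤⌊i+2*m/2⌋ i m = ℕₚ.≤-trans (ℕₚ.≤-reflexive (≡.trans (ℕₚ.n≡⌊n+n/2⌋ m) (≡.cong (λ n → ⌊ m ℕ.+ n /2⌋) (≡.sym (ℕₚ.+-identityʳ m)))))
  (ℕₚ.⌊n/2⌋-mono (ℕₚ.m≤n+m (2 ℕ.* m) i))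

module BivariateCoefficients {c ℓ} (A : CommutativeRing c ℓ) (ι : ℚ → CommutativeRing.Carrier A)
                             (r : CommutativeRing.Carrier A) where
  open Sides A ι r hiding (zero)
  private
    module A where
      open CommutativeRing A public
      open SeriesCoefficients A public
      open Sum (CommutativeRing.semiring A) public using (sum)
    module W = PowerSeries A
    module WC = SeriesCoefficients A
    module UC = SeriesCoefficients W.seriesRing
  open Sum semiring using () renaming (sum to ∑∑)

  const-coeff : ∀ a f i j → (const a * f) i j A.≈ a A.* f i j
  const-coeff a f i j = A.trans (UC.const-⊛ (W.const a) f i j) (WC.const-⊛ a (f i) j)

  u-coeff-zero : ∀ f j → (u * f) 0 j A.≈ A.0#
  u-coeff-zero f j = UC.X-⊛-zero f j

  u-coeff-suc : ∀ f i j → (u * f) (suc i) j A.≈ f i j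
  u-coeff-suc f i j = UC.X-⊛-suc f i j

  w-coeff-zero : ∀ f i → (w * f) i 0 A.≈ A.0#
  w-coeff-zero f i = A.trans (UC.const-⊛ W.X f i 0) (WC.X-⊛-zero (f i))

  w-coeff-suc : ∀ f i j → (w * f) i (suc j) A.≈ f i j
  w-coeff-suc f i j = A.trans (UC.const-⊛ W.X f i (suc j)) (WC.X-⊛-suc (f i) j)

  w²-coeff-suc-suc : ∀ f i j → (w ^ 2 * f) i (suc (suc j)) A.≈ f i j
  w²-coeff-suc-suc f i j = A.trans (w²≈ f i (suc (suc j))) (A.trans (w-coeff-suc (w * f) i (suc j)) (w-coeff-suc f i j))
    where
    w²≈ : ∀ f → w ^ 2 * f ≈ w * (w * f)
    w²≈ f = trans {w ^ 2 * f} {w * (w * 1# * f)} {w * (w * f)} (*-assoc w (w * 1#) f)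
      (*-cong {w} {w} {w * 1# * f} {w * f} (refl {w}) (*-cong {w * 1#} {w} {f} {f} (*-identityʳ w) (refl {f})))

  w²-coeff-zero : ∀ f i → (w ^ 2 * f) i 0 A.≈ A.0#
  w²-coeff-zero f i = A.trans (*-assoc w (w ^ 1) f i 0) (w-coeff-zero (w ^ 1 * f) i)

  w²-coeff-one : ∀ f i → (w ^ 2 * f) i 1 A.≈ A.0#
  w²-coeff-one f i = A.trans (*-assoc w (w ^ 1) f i 1) (A.trans (w-coeff-suc (w ^ 1 * f) i 0)
    (A.trans (*-assoc w 1# f i 0) (w-coeff-zero (1# * f) i)))

  w^-coeff : ∀ b → (w ^ b) 0 b A.≈ A.1#
  w^-coeff zero    = A.refl
  w^-coeff (suc b) = A.trans (w-coeff-suc (w ^ b) 0 b) (w^-coeff b)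

  w^-coeff-≢ : ∀ b i j → ¬ (i ≡ 0 × j ≡ b) → (w ^ b) i j A.≈ A.0#
  w^-coeff-≢ zero    zero    zero    ne = contradiction (≡.refl , ≡.refl) ne
  w^-coeff-≢ zero    zero    (suc j) ne = A.refl
  w^-coeff-≢ zero    (suc i) j       ne = A.refl
  w^-coeff-≢ (suc b) i       zero    ne = w-coeff-zero (w ^ b) i
  w^-coeff-≢ (suc b) i       (suc j) ne = A.trans (w-coeff-suc (w ^ b) i j)
    (w^-coeff-≢ b i j λ { (p , q) → ne (p , ≡.cong suc q) })

  monomial-coeff : ∀ a b → (u ^ a * w ^ b) a b A.≈ A.1#
  monomial-coeff zero    b = A.trans (*-identityˡ (w ^ b) 0 b) (w^-coeff b)
  monomial-coeff (suc a) b = A.trans (*-assoc u (u ^ a) (w ^ b) (suc a) b)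
    (A.trans (u-coeff-suc (u ^ a * w ^ b) a b) (monomial-coeff a b))

  monomial-coeff-≢ : ∀ a b i j → ¬ (i ≡ a × j ≡ b) → (u ^ a * w ^ b) i j A.≈ A.0#
  monomial-coeff-≢ zero    b i       j ne = A.trans (*-identityˡ (w ^ b) i j) (w^-coeff-≢ b i j ne)
  monomial-coeff-≢ (suc a) b zero    j ne = A.trans (*-assoc u (u ^ a) (w ^ b) 0 j) (u-coeff-zero (u ^ a * w ^ b) j)
  monomial-coeff-≢ (suc a) b (suc i) j ne = A.trans (*-assoc u (u ^ a) (w ^ b) (suc i) j)
    (A.trans (u-coeff-suc (u ^ a * w ^ b) i j) (monomial-coeff-≢ a b i j λ { (p , q) → ne (≡.cong suc p , q) }))

  -- Σ g n d uᵈ w²ⁿ over all n and d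
  spread : (ℕ → ℕ → A.Carrier) → Carrier
  spread g i j = maybe (λ n → g n i) A.0# (half j)

  spread-coeff : ∀ g i j {m} → half j ≡ m → spread g i j A.≈ maybe (λ n → g n i) A.0# m
  spread-coeff g i j ≡.refl = A.refl

  module _ (X : ℕ → ℕ → A.Carrier) where
    private
      term : ℕ → ℕ → Carrier
      term k n = const (X k n) * (u ^ (k ∸ 2 ℕ.* n) * w ^ (2 ℕ.* n))

      term-≢ : ∀ k n i j → ¬ (i ≡ k ∸ 2 ℕ.* n × j ≡ 2 ℕ.* n) → term k n i j A.≈ A.0#
      term-≢ k n i j ne = A.trans (const-coeff (X k n) (u ^ (k ∸ 2 ℕ.* n) * w ^ (2 ℕ.* n)) i j)
        (A.trans (A.*-congˡ (monomial-coeff-≢ (k ∸ 2 ℕ.* n) (2 ℕ.* n) i j ne)) (A.zeroʳ _))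

      term-≡ : ∀ n i → term (i ℕ.+ 2 ℕ.* n) n i (2 ℕ.* n) A.≈ X (i ℕ.+ 2 ℕ.* n) n
      term-≡ n i = A.trans (const-coeff (X k n) (u ^ (k ∸ 2 ℕ.* n) * w ^ (2 ℕ.* n)) i (2 ℕ.* n)) (A.trans (A.*-congˡ
        (A.trans (A.reflexive (≡.cong (λ i′ → (u ^ (k ∸ 2 ℕ.* n) * w ^ (2 ℕ.* n)) i′ (2 ℕ.* n)) (≡.sym (ℕₚ.m+n∸n≡m i (2 ℕ.* n)))))
          (monomial-coeff (k ∸ 2 ℕ.* n) (2 ℕ.* n)))) (A.*-identityʳ _))
        where k = i ℕ.+ 2 ℕ.* n

      weightPart-coeff : ∀ k i j → weightPart X k i j A.≈ A.sum {⌊ k /2⌋} (λ a → term k (suc (toℕ a)) i j)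
      weightPart-coeff k i j = go ⌊ k /2⌋ (λ n → term k (suc n))
        where
        go : ∀ m (F : ℕ → Carrier) → ∑∑ {m} (F ∘ toℕ) i j A.≈ A.sum {m} (λ a → F (toℕ a) i j)
        go zero    F = A.refl
        go (suc m) F = A.+-congˡ (go m (F ∘ suc))

      weightPart-≢ : ∀ k i j → (∀ n → suc n ℕ.≤ ⌊ k /2⌋ → ¬ (i ≡ k ∸ 2 ℕ.* suc n × j ≡ 2 ℕ.* suc n)) →
                     weightPart X k i j A.≈ A.0#
      weightPart-≢ k i j ne = A.trans (weightPart-coeff k i j) (W.sum-zero {⌊ k /2⌋} _ λ a →
        term-≢ k (suc (toℕ a)) i j (ne (toℕ a) (Finₚ.toℕ<n a)))

      weightPart-≡ : ∀ i n → weightPart X (i ℕ.+ 2 ℕ.* suc n) i (2 ℕ.* suc n) A.≈ X (i ℕ.+ 2 ℕ.* suc n) (suc n)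
      weightPart-≡ i n = A.trans (weightPart-coeff k i j)
        (A.trans (A.sum-single {⌊ k /2⌋} (λ m → term k (suc m) i j) n (m≤⌊i+2*m/2⌋ i (suc n)) λ m _ m≢n →
          term-≢ k (suc m) i j λ (_ , eq) → m≢n (ℕₚ.suc-injective (≡.sym (ℕₚ.*-cancelˡ-≡ (suc n) (suc m) 2 eq))))
        (term-≡ (suc n) i))
        where
        k j : ℕ
        k = i ℕ.+ 2 ℕ.* suc n
        j = 2 ℕ.* suc n

    -- A monomial determines its term: the exponent of w gives n, and the exponent of u then gives
    -- k. So one summand survives in the sum over k and one in the sum over n.
    generatingSeries-even : ∀ i n → generatingSeries X i (2 ℕ.* suc n) A.≈ X (i ℕ.+ 2 ℕ.* suc n) (suc n)
    generatingSeries-even i n = A.trans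
      (A.sum-single {suc k} (λ k′ → weightPart X k′ i j) k ℕₚ.≤-refl λ k′ _ k′≢k →
        weightPart-≢ k′ i j λ m m< (i≡ , j≡) → k′≢k (≡.trans
          (≡.sym (ℕₚ.m∸n+n≡m (m≤⌊n/2⌋⇒2*m≤n m<))) (≡.cong₂ ℕ._+_ (≡.sym i≡) (≡.sym j≡))))
      (weightPart-≡ i n)
      where
      k j : ℕ
      k = i ℕ.+ 2 ℕ.* suc n
      j = 2 ℕ.* suc n

    generatingSeries-other : ∀ i j → (∀ n → j ≢ 2 ℕ.* suc n) → generatingSeries X i j A.≈ A.0#
    generatingSeries-other i j ne = W.sum-zero {suc (i ℕ.+ j)} _ λ k →
      weightPart-≢ (toℕ k) i j λ n _ (_ , j≡) → ne n j≡

    -- The row n = 0, which belongs to the empty index, supplies the summand 1.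
    spread-generatingSeries : ∀ g → (g 0 0 A.≈ A.1#) → (∀ d → g 0 (suc d) A.≈ A.0#) →
      (∀ n d → X (d ℕ.+ 2 ℕ.* suc n) (suc n) A.≈ g (suc n) d) →
      1# + generatingSeries X ≈ spread g
    spread-generatingSeries g g00 g0s X≈g i j = cases (half j) ≡.refl
      where
      one-coeff-≢ : ∀ i j → half j ≢ just 0 → 1# i j A.≈ A.0#
      one-coeff-≢ zero    zero    ne = contradiction ≡.refl ne
      one-coeff-≢ zero    (suc j) ne = A.refl
      one-coeff-≢ (suc i) j       ne = A.refl

      one-coeff : ∀ i → 1# i 0 A.≈ g 0 i
      one-coeff zero    = A.sym g00
      one-coeff (suc i) = A.sym (g0s i)

      cases : ∀ m → half j ≡ m → (1# + generatingSeries X) i j A.≈ maybe (λ n → g n i) A.0# m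
      cases nothing eq = A.trans
        (A.+-cong (one-coeff-≢ i j λ eq′ → case ≡.trans (≡.sym eq) eq′ of λ ())
          (generatingSeries-other i j λ n j≡ → case ≡.trans (≡.sym eq) (≡.trans (≡.cong half j≡) (half-2* (suc n))) of λ ()))
        (A.+-identityˡ A.0#)
      cases (just zero) eq = A.trans
        (A.+-cong (A.reflexive (≡.cong (1# i) (half-just j eq)))
          (generatingSeries-other i j λ n j≡ → case ≡.trans (≡.sym (half-just j eq)) j≡ of λ ()))
        (A.trans (A.+-identityʳ _) (one-coeff i))
      cases (just (suc n)) eq = A.trans
        (A.+-cong (one-coeff-≢ i j λ eq′ → case ≡.trans (≡.sym eq) eq′ of λ ())
          (A.trans (A.reflexive (≡.cong (generatingSeries X i) (half-just j eq))) (generatingSeries-even i n)))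
        (A.trans (A.+-identityˡ _) (X≈g n i))

-- Reciprocals and factorials in ℚ

module _ where
  open RationalFacts
  open Rat using (_+_; _*_)
  open ≡.≡-Reasoning

  recip-cancel : ∀ n .{{_ : NonZero n}} → + 1 / n * ι n ≡ 1ℚ
  recip-cancel (suc n) = recip-* n

  ι-homo-+ : ∀ m n → ι (m ℕ.+ n) ≡ ι m + ι n
  ι-homo-+ zero    n = ≡.sym (ℚₚ.+-identityˡ (ι n))
  ι-homo-+ (suc m) n = begin
    ι (suc (m ℕ.+ n))     ≡⟨ ι-suc (m ℕ.+ n) ⟩
    1ℚ + ι (m ℕ.+ n)      ≡⟨ ≡.cong (λ z → 1ℚ + z) (ι-homo-+ m n) ⟩
    1ℚ + (ι m + ι n)      ≡⟨ ℚₚ.+-assoc 1ℚ (ι m) (ι n) ⟨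
    1ℚ + ι m + ι n        ≡⟨ ≡.cong (_+ ι n) (ι-suc m) ⟨
    ι (suc m) + ι n       ∎

  ι-homo-* : ∀ m n → ι (m ℕ.* n) ≡ ι m * ι n
  ι-homo-* zero    n = ≡.sym (ℚₚ.*-zeroˡ (ι n))
  ι-homo-* (suc m) n = begin
    ι (n ℕ.+ m ℕ.* n)     ≡⟨ ι-homo-+ n (m ℕ.* n) ⟩
    ι n + ι (m ℕ.* n)     ≡⟨ ≡.cong₂ _+_ (≡.sym (ℚₚ.*-identityˡ (ι n))) (ι-homo-* m n) ⟩
    1ℚ * ι n + ι m * ι n  ≡⟨ ℚₚ.*-distribʳ-+ (ι n) 1ℚ (ι m) ⟨
    (1ℚ + ι m) * ι n      ≡⟨ ≡.cong (_* ι n) (ι-suc m) ⟨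
    ι (suc m) * ι n       ∎

  recip-! : ∀ n → (+ 1 / suc n !) {{suc n ℕₚ.!≢0}} * ι (suc n) ≡ (+ 1 / n !) {{n ℕₚ.!≢0}}
  recip-! n = begin
    x * ι (suc n)                          ≡⟨ ℚₚ.*-identityʳ _ ⟨
    x * ι (suc n) * 1ℚ                     ≡⟨ ≡.cong (x * ι (suc n) *_) (≡.trans (ℚₚ.*-comm (ι (n !)) y) (recip-cancel (n !) {{n ℕₚ.!≢0}})) ⟨
    x * ι (suc n) * (ι (n !) * y)          ≡⟨ ℚₚ.*-assoc (x * ι (suc n)) (ι (n !)) y ⟨
    x * ι (suc n) * ι (n !) * y            ≡⟨ ≡.cong (_* y) (ℚₚ.*-assoc x (ι (suc n)) (ι (n !))) ⟩
    x * (ι (suc n) * ι (n !)) * y          ≡⟨ ≡.cong (λ z → x * z * y) (ι-homo-* (suc n) (n !)) ⟨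
    x * ι (suc n !) * y                    ≡⟨ ≡.cong (_* y) (recip-cancel (suc n !) {{suc n ℕₚ.!≢0}}) ⟩
    1ℚ * y                                 ≡⟨ ℚₚ.*-identityˡ y ⟩
    y                                      ∎
    where
    x y : ℚ
    x = (+ 1 / suc n !) {{suc n ℕₚ.!≢0}}
    y = (+ 1 / n !) {{n ℕₚ.!≢0}}

module TruncatedIdentity (N a : ℕ) .{{_ : NonZero N}} {c ℓ} (B : CommutativeRing c ℓ)
                         {ι : ℚ → CommutativeRing.Carrier B} (ι-scalars : RationalScalars B ι)
                         (r : CommutativeRing.Carrier B) where

  open RationalScalars ι-scalars
  open Sides B ι r hiding (zero)
  open BivariateCoefficients B ι r
  open Truncations N a B ι-scalars r
  open ListSum B
  open Indices B
  open MultipleT N a using (truncated)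
  private
    module B = CommutativeRing B
    module BM = Mult B.semiring
    module BE = Exp (CommutativeRing.semiring B)
    module BP = RingProperties B.ring
    module SP = RingProperties ring
    module SM = Mult semiring

  nat≈ι : ∀ n → n BM.× B.1# B.≈ ι (RationalFacts.ι n)
  nat≈ι zero    = B.sym ι-0
  nat≈ι (suc n) = B.trans (B.+-cong (B.sym ι-1) (nat≈ι n))
    (B.trans (B.sym (ι-+ 1ℚ (RationalFacts.ι n))) (B.reflexive (≡.cong ι (≡.sym (RationalFacts.ι-suc n)))))

  torsionFree : TorsionFree B
  torsionFree n {x} nx≈0 = begin
    x                                        ≈⟨ B.trans (B.*-congʳ ι-1) (B.*-identityˡ x) ⟨
    ι 1ℚ B.* x                               ≡⟨ ≡.cong (λ q → ι q B.* x) (RationalFacts.recip-* n) ⟨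
    ι (+ 1 / suc n Rat.* RationalFacts.ι (suc n)) B.* x ≈⟨ B.*-congʳ (B.trans (ι-* _ _) (B.*-congˡ (B.sym (nat≈ι (suc n))))) ⟩
    ι (+ 1 / suc n) B.* (suc n BM.× B.1#) B.* x ≈⟨ B.trans (B.*-assoc _ _ x) (B.*-congˡ nx≈0) ⟩
    ι (+ 1 / suc n) B.* B.0#                 ≈⟨ B.zeroʳ _ ⟩
    B.0#                                     ∎
    where open SetoidReasoning B.setoid

  open BivariateCalculus B ι torsionFree using (θ; calculus)
  open FormalCalculus calculus using (module ProductFormula; θ-square; θ-neg; θ-constant*)

  const-+ : ∀ x y → const (x B.+ y) ≈ const x + const y
  const-+ x y zero    zero    = B.refl
  const-+ x y zero    (suc j) = B.sym (B.+-identityˡ B.0#)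
  const-+ x y (suc i) j       = B.sym (B.+-identityˡ B.0#)

  const-cong : ∀ {x y} → x B.≈ y → const x ≈ const y
  const-cong x≈y zero    zero    = x≈y
  const-cong x≈y zero    (suc j) = B.refl
  const-cong x≈y (suc i) j       = B.refl

  const-* : ∀ x y → const (x B.* y) ≈ const x * const y
  const-* x y i j = B.trans (term i j) (B.sym (const-coeff x (const y) i j))
    where
    term : ∀ i j → const (x B.* y) i j B.≈ x B.* const y i j
    term zero    zero    = B.refl
    term zero    (suc j) = B.sym (B.zeroʳ x)
    term (suc i) j       = B.sym (B.zeroʳ x)

  const-1 : const B.1# ≈ 1#
  const-1 zero    zero    = B.refl
  const-1 zero    (suc j) = B.refl
  const-1 (suc i) j       = B.refl

  const-0 : const B.0# ≈ 0#
  const-0 zero    zero    = B.refl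
  const-0 zero    (suc j) = B.refl
  const-0 (suc i) j       = B.refl

  const-^ : ∀ x n → const (x BE.^ n) ≈ const x ^ n
  const-^ x zero    = const-1
  const-^ x (suc n) = trans {const (x BE.^ suc n)} {const x * const (x BE.^ n)} {const x ^ suc n}
    (const-* x (x BE.^ n)) (*-cong {const x} {const x} {const (x BE.^ n)} {const x ^ n} (refl {const x}) (const-^ x n))

  const-nat : ∀ n → const (n BM.× B.1#) ≈ n SM.× 1#
  const-nat zero    = const-0
  const-nat (suc n) = trans {const (suc n BM.× B.1#)} {const B.1# + const (n BM.× B.1#)} {suc n SM.× 1#}
    (const-+ B.1# (n BM.× B.1#))
    (+-cong {const B.1#} {1#} {const (n BM.× B.1#)} {n SM.× 1#} const-1 (const-nat n))

  θ-const : ∀ x → θ (const x) ≈ 0#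
  θ-const x zero    zero    = B.zeroˡ x
  θ-const x zero    (suc j) = B.zeroʳ _
  θ-const x (suc i) j       = B.zeroʳ _

  θ-u : θ u ≈ u
  θ-u zero          j       = B.zeroʳ _
  θ-u (suc zero)    zero    = B.trans (B.*-identityʳ _) (B.+-identityʳ B.1#)
  θ-u (suc zero)    (suc j) = B.zeroʳ _
  θ-u (suc (suc i)) j       = B.zeroʳ _

  θ-w : θ w ≈ w
  θ-w zero    zero          = B.zeroʳ _
  θ-w zero    (suc zero)    = B.trans (B.*-identityʳ _) (B.+-identityʳ B.1#)
  θ-w zero    (suc (suc j)) = B.zeroʳ _
  θ-w (suc i) j             = B.zeroʳ _

  θ-scaled-w² : ∀ x → θ (const x * w ^ 2) ≈ const x * w ^ 2 + const x * w ^ 2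
  θ-scaled-w² x = trans {θ (const x * w ^ 2)} {const x * θ (w ^ 2)} {const x * w ^ 2 + const x * w ^ 2}
    (θ-constant* {const x} (θ-const x) (w ^ 2))
    (trans {const x * θ (w ^ 2)} {const x * (w ^ 2 + w ^ 2)} {const x * w ^ 2 + const x * w ^ 2}
      (*-cong {const x} {const x} {θ (w ^ 2)} {w ^ 2 + w ^ 2} (refl {const x}) (θ-square {w} θ-w))
      (distribˡ (const x) (w ^ 2) (w ^ 2)))

  θ-αα : θ αα ≈ αα + αα
  θ-αα = trans {θ αα} { - θ (const r * w ^ 2)} {αα + αα} (θ-neg (const r * w ^ 2))
    (trans { - θ (const r * w ^ 2)} { - (const r * w ^ 2 + const r * w ^ 2)} {αα + αα}
      (-‿cong {θ (const r * w ^ 2)} {const r * w ^ 2 + const r * w ^ 2} (θ-scaled-w² r))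
      (sym {αα + αα} { - (const r * w ^ 2 + const r * w ^ 2)} (SP.-‿+-comm (const r * w ^ 2) (const r * w ^ 2))))

  αα+w²r : αα + w ^ 2 * const r ≈ 0#
  αα+w²r = trans {αα + w ^ 2 * const r} {αα + const r * w ^ 2} {0#}
    (+-cong {αα} {αα} {w ^ 2 * const r} {const r * w ^ 2} (refl {αα}) (*-comm (w ^ 2) (const r)))
    (-‿inverseˡ (const r * w ^ 2))

  γγ≈αα+w² : γγ ≈ αα + w ^ 2
  γγ≈αα+w² i j = begin
    γγ i j                                        ≈⟨ const-coeff (B.1# B.- r) (w ^ 2) i j ⟩
    (B.1# B.- r) B.* z                            ≈⟨ BP.[y-z]x≈yx-zx z B.1# r ⟩
    B.1# B.* z B.- r B.* z                        ≈⟨ B.+-cong (B.*-identityˡ z) (B.-‿cong (B.sym (const-coeff r (w ^ 2) i j))) ⟩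
    z B.+ αα i j                                  ≈⟨ B.+-comm _ _ ⟩
    (αα + w ^ 2) i j                              ∎
    where
    open SetoidReasoning B.setoid
    z = (w ^ 2) i j

  G H : ℕ → Carrier
  G M = spread (g M)
  H M = spread (h M)

  κ : ℕ → Carrier
  κ M = const (x M)

  -κu-coeff : ∀ M f i j → (- (κ M * u) * f) i j B.≈ B.- (x M B.* (u * f) i j)
  -κu-coeff M f i j = B.trans (B.sym (SP.-‿distribˡ-* (κ M * u) f i j))
    (B.-‿cong (B.trans (*-assoc (κ M) u f i j) (const-coeff (x M) (u * f) i j)))

  κκw²-coeff : ∀ M f i j → (κ M * κ M * w ^ 2 * f) i j B.≈ x M BE.^ 2 B.* (w ^ 2 * f) i j
  κκw²-coeff M f i j = begin
    (κ M * κ M * w ^ 2 * f) i j               ≈⟨ *-assoc (κ M * κ M) (w ^ 2) f i j ⟩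
    (κ M * κ M * (w ^ 2 * f)) i j             ≈⟨ *-assoc (κ M) (κ M) (w ^ 2 * f) i j ⟩
    (κ M * (κ M * (w ^ 2 * f))) i j           ≈⟨ const-coeff (x M) (κ M * (w ^ 2 * f)) i j ⟩
    x M B.* (κ M * (w ^ 2 * f)) i j           ≈⟨ B.*-congˡ (const-coeff (x M) (w ^ 2 * f) i j) ⟩
    x M B.* (x M B.* (w ^ 2 * f) i j)         ≈⟨ B.*-assoc _ _ _ ⟨
    x M B.* x M B.* (w ^ 2 * f) i j           ≈⟨ B.*-congʳ (B.*-congˡ (B.*-identityʳ (x M))) ⟨
    x M BE.^ 2 B.* (w ^ 2 * f) i j            ∎
    where open SetoidReasoning B.setoid

  -- The recurrences `h-suc-0` and `h-suc-suc` read as an equation of series: multiplication by u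
  -- shifts d, and multiplication by w² shifts n. For exponents of w that are zero or odd, both
  -- sides vanish.
  H-equation : ∀ M → H M + - (κ M * u) * H M ≈ κ M * κ M * w ^ 2 * (G M + const r * H M)
  H-equation M i j = begin
    H M i j B.+ (- (κ M * u) * H M) i j             ≈⟨ B.+-congˡ (-κu-coeff M (H M) i j) ⟩
    H M i j B.- x M B.* (u * H M) i j               ≈⟨ go i j ⟩
    x M BE.^ 2 B.* (w ^ 2 * Z) i j                  ≈⟨ κκw²-coeff M Z i j ⟨
    (κ M * κ M * w ^ 2 * Z) i j                     ∎
    where
    open SetoidReasoning B.setoid
    Z : Carrier
    Z = G M + const r * H M

    Z-coeff : ∀ i j {n} → half j ≡ just n → Z i j B.≈ g M n i B.+ r B.* h M n i
    Z-coeff i j eq = B.+-cong (spread-coeff (g M) i j eq)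
      (B.trans (const-coeff r (H M) i j) (B.*-congˡ (spread-coeff (h M) i j eq)))

    vanish : ∀ {a b z} → a B.≈ B.0# → b B.≈ B.0# → z B.≈ B.0# → a B.- x M B.* b B.≈ x M BE.^ 2 B.* z
    vanish a≈0 b≈0 z≈0 = B.trans
      (B.+-cong a≈0 (B.trans (B.-‿cong (B.trans (B.*-congˡ b≈0) (B.zeroʳ _))) BP.-0#≈0#))
      (B.trans (B.+-identityˡ B.0#) (B.sym (B.trans (B.*-congˡ z≈0) (B.zeroʳ _))))

    u*H-odd : ∀ i j → half j ≡ nothing → (u * H M) i j B.≈ B.0#
    u*H-odd zero    j eq = u-coeff-zero (H M) j
    u*H-odd (suc i) j eq = B.trans (u-coeff-suc (H M) i j) (spread-coeff (h M) i j eq)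

    u*H-0 : ∀ i → (u * H M) i 0 B.≈ B.0#
    u*H-0 zero    = u-coeff-zero (H M) 0
    u*H-0 (suc i) = B.trans (u-coeff-suc (H M) i 0) (h-zero M i)

    step : ∀ i j n → half j ≡ just n →
      h M (suc n) i B.- x M B.* (u * H M) i (suc (suc j)) B.≈ x M BE.^ 2 B.* Z i j
    step zero    j n eq = begin
      h M (suc n) 0 B.- x M B.* (u * H M) 0 (suc (suc j))
        ≈⟨ B.+-congˡ (B.trans (B.-‿cong (B.trans (B.*-congˡ (u-coeff-zero (H M) (suc (suc j)))) (B.zeroʳ _))) BP.-0#≈0#) ⟩
      h M (suc n) 0 B.+ B.0#                       ≈⟨ B.+-identityʳ _ ⟩
      h M (suc n) 0                                ≈⟨ h-suc-0 M n ⟩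
      x M BE.^ 2 B.* (g M n 0 B.+ r B.* h M n 0)   ≈⟨ B.*-congˡ (Z-coeff 0 j eq) ⟨
      x M BE.^ 2 B.* Z 0 j                         ∎
    step (suc i) j n eq = begin
      h M (suc n) (suc i) B.- x M B.* (u * H M) (suc i) (suc (suc j))
        ≈⟨ B.+-cong (h-suc-suc M n i) (B.-‿cong (B.*-congˡ (B.trans (u-coeff-suc (H M) i (suc (suc j)))
             (spread-coeff (h M) i (suc (suc j)) (≡.cong (Maybe.map suc) eq))))) ⟩
      x M BE.^ 2 B.* (g M n (suc i) B.+ r B.* h M n (suc i)) B.+ x M B.* h M (suc n) i B.- x M B.* h M (suc n) i
        ≈⟨ B.trans (B.+-assoc _ _ _) (B.trans (B.+-congˡ (B.-‿inverseʳ _)) (B.+-identityʳ _)) ⟩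
      x M BE.^ 2 B.* (g M n (suc i) B.+ r B.* h M n (suc i)) ≈⟨ B.*-congˡ (Z-coeff (suc i) j eq) ⟨
      x M BE.^ 2 B.* Z (suc i) j ∎

    go : ∀ i j → H M i j B.- x M B.* (u * H M) i j B.≈ x M BE.^ 2 B.* (w ^ 2 * Z) i j
    go i zero          = vanish (h-zero M i) (u*H-0 i) (w²-coeff-zero Z i)
    go i (suc zero)    = vanish B.refl (u*H-odd i 1 ≡.refl) (w²-coeff-one Z i)
    go i (suc (suc j)) = cases (half j) ≡.refl
      where
      cases : ∀ m → half j ≡ m → H M i (suc (suc j)) B.- x M B.* (u * H M) i (suc (suc j)) B.≈
                                 x M BE.^ 2 B.* (w ^ 2 * Z) i (suc (suc j))
      cases nothing eq = vanish (spread-coeff (h M) i (suc (suc j)) (≡.cong (Maybe.map suc) eq))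
        (u*H-odd i (suc (suc j)) (≡.cong (Maybe.map suc) eq))
        (B.trans (w²-coeff-suc-suc Z i j) (B.trans (B.+-cong (spread-coeff (g M) i j eq)
          (B.trans (const-coeff r (H M) i j) (B.trans (B.*-congˡ (spread-coeff (h M) i j eq)) (B.zeroʳ r))))
          (B.+-identityˡ B.0#)))
      cases (just n) eq = B.trans
        (B.+-congʳ (spread-coeff (h M) i (suc (suc j)) (≡.cong (Maybe.map suc) eq)))
        (B.trans (step i j n eq) (B.*-congˡ (B.sym (w²-coeff-suc-suc Z i j))))

  spread-cong : ∀ {f f′} → (∀ n d → f n d B.≈ f′ n d) → spread f ≈ spread f′
  spread-cong f≈f′ i j with half j
  ... | just n  = f≈f′ n i
  ... | nothing = B.refl

  G-true : ∀ M → contributes M ≡ true → G (suc M) ≈ G M + H M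
  G-true M c i j with half j
  ... | just n  = g-step-true M c n i
  ... | nothing = B.sym (B.+-identityˡ B.0#)

  G-zero : G 0 ≈ 1#
  G-zero zero    zero       = B.refl
  G-zero (suc i) zero       = B.refl
  G-zero zero    (suc zero) = B.refl
  G-zero (suc i) (suc zero) = B.refl
  G-zero i (suc (suc j)) with half j
  G-zero zero    (suc (suc j)) | just n  = g-0 n 0
  G-zero (suc i) (suc (suc j)) | just n  = g-0 n (suc i)
  G-zero zero    (suc (suc j)) | nothing = B.refl
  G-zero (suc i) (suc (suc j)) | nothing = B.refl

  t : ℕ → ℕ → Carrier
  t M n = const (ι (truncated (n ∷ []) M))

  t-true : ∀ M → contributes M ≡ true → ∀ n → t (suc M) n ≈ t M n + κ M ^ n
  t-true M c n = trans {t (suc M) n} {const (ι (truncated (n ∷ []) M) B.+ x M BE.^ n)} {t M n + κ M ^ n}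
    (const-cong (B.trans (truncated-step-true M c n []) (B.+-congˡ (B.trans (B.*-congˡ ι-1) (B.*-identityʳ _)))))
    (trans {const (ι (truncated (n ∷ []) M) B.+ x M BE.^ n)} {t M n + const (x M BE.^ n)} {t M n + κ M ^ n}
      (const-+ (ι (truncated (n ∷ []) M)) (x M BE.^ n))
      (+-cong {t M n} {t M n} {const (x M BE.^ n)} {κ M ^ n} (refl {t M n}) (const-^ (x M) n)))

  order-α : ∀ n → Order≥ n (α.powerSum n)
  order-α = order-powerSum order-u (order-neg (order-scale (const r) (order-^ order-w 2)))

  order-γ : ∀ n → Order≥ n (γ.powerSum n)
  order-γ = order-powerSum order-u (order-scale (const (B.1# B.- r)) (order-^ order-w 2))

  module Product = ProductFormula u αα γγ (w ^ 2) (const r) order-α order-γ order-u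
    (order-mono (ℕₚ.n≤1+n 1) (order-neg (order-scale (const r) (order-^ order-w 2))))
    γγ≈αα+w² αα+w²r θ-u θ-αα (θ-scaled-w² (B.1# B.- r))
    κ (λ M → θ-const (x M)) contributes
    t (λ n → trans {t 0 n} {const B.0#} {0#} (const-cong ι-0) const-0) t-true
    (λ M c n → const-cong (truncated-step-false M c n []))
    G H G-zero G-true (λ M c → spread-cong (g-step-false M c)) H-equation

  const-ι-cancel : ∀ {p q} n → p Rat.* RationalFacts.ι n ≡ q → const (ι p) * (n SM.× 1#) ≈ const (ι q)
  const-ι-cancel {p} {q} n eq = trans {const (ι p) * (n SM.× 1#)} {const (ι p) * const (n BM.× B.1#)} {const (ι q)}
    (*-cong {const (ι p)} {const (ι p)} {n SM.× 1#} {const (n BM.× B.1#)} (refl {const (ι p)})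
      (sym {const (n BM.× B.1#)} {n SM.× 1#} (const-nat n)))
    (trans {const (ι p) * const (n BM.× B.1#)} {const (ι p B.* (n BM.× B.1#))} {const (ι q)}
      (sym {const (ι p B.* (n BM.× B.1#))} {const (ι p) * const (n BM.× B.1#)} (const-* (ι p) (n BM.× B.1#)))
      (const-cong (B.trans (B.*-congˡ (nat≈ι n)) (B.trans (B.sym (ι-* p (RationalFacts.ι n))) (B.reflexive (≡.cong ι eq))))))

  X : ℕ → ℕ → ℕ → B.Carrier
  X M k n = ΣL (T M) (I₀ k n n)

  -- The product with 1/n is taken in ℚ, so that it is the M-th term of the Cauchy sequence of the
  -- real coefficient t(n)/n.
  τ : ℕ → (n : ℕ) → 2 ℕ.≤ n → B.Carrier
  τ M n 2≤n = ι (truncated (n ∷ []) M Rat.* (+ 1 / n) {{ℕ.>-nonZero (ℕₚ.<⇒≤ 2≤n)}})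

  truncated-identity : ∀ M → 1# + generatingSeries (X M) ≈ exp (exponent (τ M)) (order-exponent (τ M))
  truncated-identity M = trans {1# + generatingSeries (X M)} {G M} {exp (exponent (τ M)) (order-exponent (τ M))}
    (spread-generatingSeries (X M) (g M) B.refl (λ _ → B.refl) (λ n d → ΣL-I₀ (T M) n d))
    (Product.G≈exp M (λ i → const (τ M (2 ℕ.+ i) (ℕ.s≤s (ℕ.s≤s ℕ.z≤n)))) (λ n → const (ι (1/ n !)))
      (λ i → θ-const (τ M (2 ℕ.+ i) (ℕ.s≤s (ℕ.s≤s ℕ.z≤n)))) (λ n → θ-const (ι (1/ n !)))
      (λ i → const-ι-cancel {truncated (2 ℕ.+ i ∷ []) M Rat.* (+ 1 / (2 ℕ.+ i))} (2 ℕ.+ i)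
        (≡.trans (ℚₚ.*-assoc (truncated (2 ℕ.+ i ∷ []) M) _ _)
          (≡.trans (≡.cong (truncated (2 ℕ.+ i ∷ []) M Rat.*_) (RationalFacts.recip-* (suc i))) (ℚₚ.*-identityʳ _))))
      (λ n → const-ι-cancel {1/ suc n !} (suc n) (recip-! n))
      (λ i → order-mono (ℕₚ.m≤n+m i 2) (order-exponentTerm (τ M) i))
      (order-exponent (τ M))
      (λ n → order-scale (const (ι (1/ n !))) (order-^ (order-exponent (τ M)) n))
      -- Below order 1 there is only the constant term. It is 1 in `G M`, from the empty index, and
      -- 1 in exp, from its term n = 0.
      (order λ { zero zero _ → constant-term ; zero (suc j) (ℕ.s≤s ()) ; (suc i) j (ℕ.s≤s ()) }))
    where
    1/_! : ℕ → ℚ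
    1/ n ! = (+ 1 / n !) {{n ℕₚ.!≢0}}
    constant-term : (G M - exp (exponent (τ M)) (order-exponent (τ M))) 0 0 B.≈ B.0#
    constant-term = B.trans (B.+-congˡ (B.-‿cong (B.trans (B.+-identityʳ _)
      (B.trans (const-coeff (ι 1ℚ) 1# 0 0) (B.trans (B.*-identityʳ _) ι-1))))) (B.-‿inverseʳ B.1#)

module FromTruncations (N a : ℕ) .{{_ : NonZero N}} {c ℓ c′ ℓ′} (A : CommutativeRing c ℓ) (B : CommutativeRing c′ ℓ′)
  (ι : ℚ → CommutativeRing.Carrier A) {ι′ : ℚ → CommutativeRing.Carrier B} (ι′-scalars : RationalScalars B ι′)
  (r : CommutativeRing.Carrier A) (r′ : CommutativeRing.Carrier B) where

  private module S = Sides∼ A B ι ι′ r r′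
  open S public using (module A)
  open TruncatedIdentity N a B ι′-scalars r′ public using (X; τ)
  private module T = TruncatedIdentity N a B ι′-scalars r′

  module _ {ρ} (R : ℕ → RingRelation A B ρ)
    (ι∼ : ∀ M q → RingRelation._∼_ (R M) (ι q) (ι′ q)) (r∼ : ∀ M → RingRelation._∼_ (R M) r r′)
    (respʳ : ∀ M {x y y′} → RingRelation._∼_ (R M) x y → CommutativeRing._≈_ B y y′ → RingRelation._∼_ (R M) x y′)
    (separating : ∀ {x x′} → (∀ M → ∃ λ y → RingRelation._∼_ (R M) x y × RingRelation._∼_ (R M) x′ y) →
                  CommutativeRing._≈_ A x x′) where

    identity : ∀ X₀ σ →
      (∀ M k n → RingRelation._∼_ (R M) (X₀ k n) (X M k n)) →
      (∀ M n 2≤n → RingRelation._∼_ (R M) (σ n 2≤n) (τ M n 2≤n)) →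
      ∀ {one series f} (h : A.Order≥ 1 f) → one ≡ A.1# → series ≡ A.generatingSeries X₀ → f ≡ A.exponent σ →
      one A.+ series A.≈ A.exp f h
    identity X₀ σ X∼ τ∼ = S.identity-from-relations R ι∼ r∼ respʳ separating X₀ σ {X} {τ} X∼ τ∼ T.truncated-identity

-- Transfer to ℝ

-- Over ℝ each summand depends on a proof, for instance of admissibility, which guarantees
-- convergence; its truncated partner depends on the index alone.
reduce∼ : ∀ {c ℓ c′ ℓ′ ρ} {A : CommutativeRing c ℓ} {B : CommutativeRing c′ ℓ′} (R : RingRelation A B ρ)
          {x p} {X : Set x} {P : X → Set p} (f : ∀ {x} → P x → CommutativeRing.Carrier A)
          (g : X → CommutativeRing.Carrier B) → (∀ {x} (px : P x) → RingRelation._∼_ R (f px) (g x)) →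
          ∀ {xs} (pxs : All P xs) → RingRelation._∼_ R
            (foldr (CommutativeRing._+_ A) (CommutativeRing.0# A) (All.reduce f pxs)) (ListSum.ΣL B g xs)
reduce∼ R f g f∼g []         = RingRelation.0∼ R
reduce∼ R f g f∼g (px ∷ pxs) = RingRelation.+∼ R (f∼g px) (reduce∼ R f g f∼g pxs)

ℚ-ring : CommutativeRing 0ℓ 0ℓ
ℚ-ring = ℚₚ.+-*-commutativeRing

-- Power series in r instead of polynomials: the comparison with ℝ[r] is coefficientwise and carries
-- no degree bounds.
module ℚ⟦r⟧ = PowerSeries ℚ-ring

open CommutativeRing ℚ⟦r⟧.seriesRing using () renaming (_≈_ to _≋_; _+_ to _⊕_; _*_ to _⊛_)
open SeriesCoefficients ℚ-ring using (const-⊛)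

const-+ : ∀ p q → ℚ⟦r⟧.const (p Rat.+ q) ≋ ℚ⟦r⟧.const p ⊕ ℚ⟦r⟧.const q
const-+ p q zero    = ≡.refl
const-+ p q (suc _) = ≡.refl

const-* : ∀ p q → ℚ⟦r⟧.const (p Rat.* q) ≋ ℚ⟦r⟧.const p ⊛ ℚ⟦r⟧.const q
const-* p q zero    = ≡.sym (ℚₚ.+-identityʳ (p Rat.* q))
const-* p q (suc n) = ≡.sym (≡.trans (const-⊛ p (ℚ⟦r⟧.const q) (suc n)) (ℚₚ.*-zeroʳ p))

const-scalars : RationalScalars ℚ⟦r⟧.seriesRing ℚ⟦r⟧.const
const-scalars = record { ι-1 = λ _ → ≡.refl ; ι-+ = const-+ ; ι-* = const-* }

module Truncated (N a : ℕ) .{{_ : NonZero N}} =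
  FromTruncations N a ℝ[r]-ring ℚ⟦r⟧.seriesRing (fromℝ ∘ fromℚ) const-scalars r ℚ⟦r⟧.X

open ℝ[r]⟦u,w⟧ using (_≈_; _+_; 1#; generatingSeries; exp; exponent; order-exponent)
open Interpolated using (X₀ʳ; t/n)

module AtTruncation (M : ℕ) where

  record _≈ᵗ_ (x : ℝ) (q : ℚ) : Set where
    constructor mk≈ᵗ
    field seq-≡ : seq x M ≡ q
  open _≈ᵗ_

  seq∼ : RingRelation ℝ-ring ℚ-ring 0ℓ
  seq∼ = record
    { _∼_ = _≈ᵗ_
    ; 0∼ = mk≈ᵗ ≡.refl
    ; 1∼ = mk≈ᵗ ≡.refl
    ; +∼ = λ (mk≈ᵗ p) (mk≈ᵗ q) → mk≈ᵗ (≡.cong₂ Rat._+_ p q)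
    ; *∼ = λ (mk≈ᵗ p) (mk≈ᵗ q) → mk≈ᵗ (≡.cong₂ Rat._*_ p q)
    ; -∼ = λ (mk≈ᵗ p) → mk≈ᵗ (≡.cong (λ q → Rat.- q) p) }

  module ℝ⟦r⟧∼ = PowerSeries∼ seq∼

  record _≈ₜ_ (p : ℝ[r]) (f : ℕ → ℚ) : Set where
    constructor mk≈ₜ
    field coeff-≈ₜ : Polynomials.coeff p ℝ⟦r⟧∼.∼ₛ f
  open _≈ₜ_

  coeff∼ : RingRelation ℝ[r]-ring ℚ⟦r⟧.seriesRing 0ℓ
  coeff∼ = record
    { _∼_ = _≈ₜ_
    ; 0∼ = mk≈ₜ S.0∼
    ; 1∼ = mk≈ₜ S.1∼
    ; +∼ = λ {p} {f} {q} {g} (mk≈ₜ p∼f) (mk≈ₜ q∼g) → mk≈ₜ (S.+∼ {coeff p} {f} {coeff q} {g} p∼f q∼g)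
    ; *∼ = λ {p} {f} {q} {g} (mk≈ₜ p∼f) (mk≈ₜ q∼g) → mk≈ₜ (S.*∼ {coeff p} {f} {coeff q} {g} p∼f q∼g)
    ; -∼ = λ {p} {f} (mk≈ₜ p∼f) → mk≈ₜ (S.-∼ {coeff p} {f} p∼f) }
    where
    open Polynomials ℝ-ring using (coeff)
    module S = RingRelation ℝ⟦r⟧∼.relation

  r∼ : r ≈ₜ ℚ⟦r⟧.X
  r∼ = mk≈ₜ ℝ⟦r⟧∼.X∼

  open RingRelation coeff∼
  open ListSum ℚ⟦r⟧.seriesRing
  open Mergings ℚ⟦r⟧.seriesRing ℚ⟦r⟧.X using (ΣL-mergings)

  fromℝ∼ : ∀ x → fromℝ x ∼ ℚ⟦r⟧.const (seq x M)
  fromℝ∼ x = mk≈ₜ (ℝ⟦r⟧∼.const∼ (mk≈ᵗ ≡.refl))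

  respʳ : ∀ {p f g} → p ∼ f → f ≋ g → p ∼ g
  respʳ (mk≈ₜ p∼f) f≋g = mk≈ₜ λ l → mk≈ᵗ (≡.trans (seq-≡ (p∼f l)) (f≋g l))

  module _ (N a : ℕ) .{{_ : NonZero N}} where
    open Truncated N a using (X; τ)
    open Truncations N a ℚ⟦r⟧.seriesRing const-scalars ℚ⟦r⟧.X using (T)
    open Interpolated N a using (tʳ)
    open MultipleT N a using (truncated; t)

    module _ (k : ℕ) (ks : List ℕ) where
      open CommutativeRing ℝ[r]-ring using (_*_; semiring)
      open Exp semiring using (_^_)
      open Exp (CommutativeRing.semiring ℚ⟦r⟧.seriesRing) using () renaming (_^_ to _^ₛ_)

      polynomialTerm : ∀ {p} → Admissible p → ℝ[r]
      polynomialTerm {p} adm-p = r ^ (depth (k ∷ ks) ∸ depth p) * fromℝ (t p adm-p)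

      truncatedTerm : List ℕ → ℕ → ℚ
      truncatedTerm p = (ℚ⟦r⟧.X ^ₛ (depth (k ∷ ks) ∸ depth p)) ⊛ ℚ⟦r⟧.const (truncated p M)

      r^∼ : ∀ n → (r ^ n) ∼ (ℚ⟦r⟧.X ^ₛ n)
      r^∼ n = ^∼ coeff∼ {r} {ℚ⟦r⟧.X} n r∼

      product∼ : ∀ {p q f g} → p ∼ f → q ∼ g → (p * q) ∼ (f ⊛ g)
      product∼ {p} {q} {f} {g} p∼f q∼g = *∼ {p} {f} {q} {g} p∼f q∼g

      term∼ : ∀ {p} (adm-p : Admissible p) → polynomialTerm adm-p ∼ truncatedTerm p
      term∼ {p} adm-p = product∼ {r ^ (depth (k ∷ ks) ∸ depth p)} {fromℝ (t p adm-p)}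
        (r^∼ (depth (k ∷ ks) ∸ depth p)) (fromℝ∼ (t p adm-p))

    -- The relation is taken apart into equations between coefficients: the polynomials
    -- contain proofs, and unfolding those to see that two of them agree is infeasible.
    tʳ∼ΣL : ∀ k ks (adm : Admissible (k ∷ ks)) → tʳ (k ∷ ks) adm ∼ ΣL (truncatedTerm k ks) (mergings′ k ks)
    tʳ∼ΣL k ks adm = reduce∼ coeff∼ _ (truncatedTerm k ks)
      (λ adm-p → mk≈ₜ λ l → mk≈ᵗ (seq-≡ (coeff-≈ₜ (term∼ k ks adm-p) l))) (mergings-admissible {k ∷ ks} adm)

    tʳ∼ : ∀ {k} (adm : Admissible k) → tʳ k adm ∼ T M k
    tʳ∼ {k ∷ ks} adm = respʳ {f = ΣL (truncatedTerm k ks) (mergings′ k ks)} {T M (k ∷ ks)} (tʳ∼ΣL k ks adm)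
      (ΣL-mergings (λ q → ℚ⟦r⟧.const (truncated q M)) k ks)

    X₀ʳ∼ : ∀ k n → X₀ʳ N a k n n ∼ X M k n
    X₀ʳ∼ k n = reduce∼ coeff∼ _ (T M) (λ p∈I₀ → tʳ∼ (proj₁ p∈I₀)) (I₀-sound k n n)

    t/n∼ : ∀ n 2≤n → t/n N a n 2≤n ∼ τ M n 2≤n
    t/n∼ n 2≤n = fromℝ∼ _

-- Agreement of the M-th terms for all M makes the representing sequences equal term by term, so no
-- ε is involved.
separating : ∀ {p q} → (∀ M → ∃ λ f → AtTruncation._≈ₜ_ M p f × AtTruncation._≈ₜ_ M q f) →
             CommutativeRing._≈_ ℝ[r]-ring p q
separating h = Polynomials.mk≈ₚ λ l → Real.pointwise λ M → let open AtTruncation M ; _ , p∼f , q∼f = h M in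
  ≡.trans (_≈ᵗ_.seq-≡ (_≈ₜ_.coeff-≈ₜ p∼f l)) (≡.sym (_≈ᵗ_.seq-≡ (_≈ₜ_.coeff-≈ₜ q∼f l)))

module _ (N a : ℕ) .{{_ : NonZero N}} where
  open Truncated N a
  open AtTruncation

  -- Comparing the polynomial coefficients of the two sides by unfolding is infeasible,
  -- so the parts of the identity are variables here and are compared one by one.
  from-equal-parts : ∀ {one series f} → one ≡ A.1# →
    series ≡ A.generatingSeries (λ k n → X₀ʳ N a k n n) → f ≡ A.exponent (t/n N a) →
    ∀ h → one + series ≈ exp f h
  from-equal-parts {one} {series} {f} one≡ series≡ f≡ h =
    identity coeff∼ (λ M q → fromℝ∼ M (fromℚ q)) r∼ respʳ separating
      (λ k n → X₀ʳ N a k n n) (t/n N a) (λ M → X₀ʳ∼ M N a) (λ M → t/n∼ M N a)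
      {one} {series} {f} h one≡ series≡ f≡

corollary3p2 : (N a : ℕ) .{{_ : NonZero N}} → 1 ≤ a → a ≤ N →
    1# + generatingSeries (λ k n → X₀ʳ N a k n n)
    ≈ exp (exponent (t/n N a)) (order-exponent (t/n N a))
corollary3p2 N a _ _ = from-equal-parts N a 1≡ generatingSeries≡ exponent≡ (order-exponent (t/n N a))
  where
  open Truncated N a using (module A)
  1≡ : 1# ≡ A.1#
  1≡ = ≡.refl

  generatingSeries≡ : generatingSeries (λ k n → X₀ʳ N a k n n) ≡ A.generatingSeries (λ k n → X₀ʳ N a k n n)
  generatingSeries≡ = ≡.refl

  exponent≡ : exponent (t/n N a) ≡ A.exponent (t/n N a)
  exponent≡ = ≡.refl
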